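{- Let $q=p^t$ with $p$ prime, let $n\ge 3$ and $1\le r\le n-2$. Let $A_1$ be the $(0,1)$ incidence matrix between the $r$-flats (rows) and points (columns) of the affine space $\mathrm{AG}(n,q)=\mathbb{F}_q^n$, the $(Y,Z)$-entry being $1$ iff $Z\in Y$. Then the $p$-adic invariant factors of $A_1$ (its invariant factors over $\mathbb{Z}_p$, up to units) are $p^\alpha$, $0\le\alpha\le rt$, where $p^\alpha$ occurs with multiplicity $m(\alpha,n,r+1)-m(\alpha,n-1,r+1)$.
   Context: For integers $N\ge2$, $1<i\le N$ and $\alpha\ge0$, $m(\alpha,N,i)$ denotes the multiplicity of $p^\alpha$ among the $p$-adic invariant factors (invariant factors over $\mathbb{Z}_p$) of the $(0,1)$ incidence matrix whose rows are indexed by the $i$-dimensional subspaces of $\mathbb{F}_q^{N+1}$ (projective $(i-1)$-spaces of $\mathrm{PG}(N,q)$), whose columns are indexed by the $1$-dimensional subspaces (points), with entry $1$ iff the point is contained in the subspace. -}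

module Defs where

open import Level using (0ℓ)
open import Data.Bool using (Bool; true; false)
open import Data.Nat as ℕ using (ℕ; zero; suc; _≤_; _<_; _≤?_)
open import Data.Nat.DivMod using (_%_; _/_)
open import Data.Fin as Fin using (Fin; punchIn; toℕ)
open import Data.Integer as ℤ using (ℤ; +_; ∣_∣)
open import Data.List as List using (List; []; _∷_; _++_; allFin; concatMap; foldr)
open import Data.Vec as Vec using (Vec; []; _∷_; lookup; zipWith; replicate)
open import Data.Maybe using (Maybe; just; nothing)
open import Data.Product using (Σ; ∃; _×_; _,_)
open import Relation.Nullary using (¬_; yes; no)
open import Relation.Binary.PropositionalEquality using (_≡_; _≢_)
open import Algebra.Structures using (IsCommutativeRing)
open import Function.Bundles using (_⇔_)

-- Finite fields of order q, with carrier Fin q (every finite field of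
-- order q is isomorphic to one of these).

record FiniteField (q : ℕ) : Set where
  field
    _+_ _*_ : Fin q → Fin q → Fin q
    -_      : Fin q → Fin q
    0# 1#   : Fin q
    isCommutativeRing : IsCommutativeRing _≡_ _+_ _*_ -_ 0# 1#
    0≢1     : 0# ≢ 1#
    inverse : ∀ x → x ≢ 0# → ∃ λ y → x * y ≡ 1#

module LinAlg {q : ℕ} (F : FiniteField q) where
  open FiniteField F

  _⊕_ : ∀ {n} → Vec (Fin q) n → Vec (Fin q) n → Vec (Fin q) n
  _⊕_ = zipWith _+_

  _⊙_ : ∀ {n} → Fin q → Vec (Fin q) n → Vec (Fin q) n
  c ⊙ v = Vec.map (c *_) v

  zeroV : ∀ {n} → Vec (Fin q) n
  zeroV = replicate _ 0#

  lincomb : ∀ {n k} → Vec (Fin q) k → Vec (Vec (Fin q) n) k → Vec (Fin q) n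
  lincomb [] [] = zeroV
  lincomb (c ∷ cs) (v ∷ vs) = (c ⊙ v) ⊕ lincomb cs vs

  LinIndep : ∀ {n k} → Vec (Vec (Fin q) n) k → Set
  LinIndep {k = k} vs = ∀ (c : Vec (Fin q) k) → lincomb c vs ≡ zeroV → c ≡ replicate k 0#

  IsSubspace : ∀ {n} → ℕ → (Vec (Fin q) n → Bool) → Set
  IsSubspace {n} k S = Σ (Vec (Vec (Fin q) n) k) λ vs → LinIndep vs ×
    (∀ x → (S x ≡ true) ⇔ (∃ λ c → x ≡ lincomb c vs))

  IsFlat : ∀ {n} → ℕ → (Vec (Fin q) n → Bool) → Set
  IsFlat {n} r Y = Σ (Vec (Fin q) n) λ a → Σ (Vec (Vec (Fin q) n) r) λ vs → LinIndep vs ×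
    (∀ x → (Y x ≡ true) ⇔ (∃ λ c → x ≡ a ⊕ lincomb c vs))

  SameSet : ∀ {n} → (Vec (Fin q) n → Bool) → (Vec (Fin q) n → Bool) → Set
  SameSet Y Y' = ∀ x → Y x ≡ Y' x

  record FlatIncidence (n r : ℕ) : Set where
    field
      nRows nCols : ℕ
      pt     : Fin nCols → Vec (Fin q) n
      pt-inj : ∀ k k' → pt k ≡ pt k' → k ≡ k'
      pt-sur : ∀ x → ∃ λ k → pt k ≡ x
      fl      : Fin nRows → (Vec (Fin q) n → Bool)
      fl-flat : ∀ j → IsFlat r (fl j)
      fl-inj  : ∀ j j' → SameSet (fl j) (fl j') → j ≡ j'
      fl-sur  : ∀ Y → IsFlat r Y → ∃ λ j → SameSet Y (fl j)
      M       : Fin nRows → Fin nCols → ℤ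
      M-inc   : ∀ j k → fl j (pt k) ≡ true → M j k ≡ + 1
      M-out   : ∀ j k → fl j (pt k) ≡ false → M j k ≡ + 0

  -- An incidence matrix between i-dimensional subspaces (rows) and
  -- 1-dimensional subspaces (columns) of F^(N+1), i.e. between
  -- projective (i-1)-spaces and points of PG(N,q), with enumerations.
  record SubspaceIncidence (N i : ℕ) : Set where
    field
      nRows nCols : ℕ
      pt      : Fin nCols → (Vec (Fin q) (suc N) → Bool)
      pt-sub  : ∀ k → IsSubspace 1 (pt k)
      pt-inj  : ∀ k k' → SameSet (pt k) (pt k') → k ≡ k'
      pt-sur  : ∀ P → IsSubspace 1 P → ∃ λ k → SameSet P (pt k)
      sp      : Fin nRows → (Vec (Fin q) (suc N) → Bool)
      sp-sub  : ∀ j → IsSubspace i (sp j)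
      sp-inj  : ∀ j j' → SameSet (sp j) (sp j') → j ≡ j'
      sp-sur  : ∀ S → IsSubspace i S → ∃ λ j → SameSet S (sp j)
      M       : Fin nRows → Fin nCols → ℤ
      M-inc   : ∀ j k → (∀ x → pt k x ≡ true → sp j x ≡ true) → M j k ≡ + 1
      M-out   : ∀ j k → ¬ (∀ x → pt k x ≡ true → sp j x ≡ true) → M j k ≡ + 0

sumℤ : List ℤ → ℤ
sumℤ = foldr ℤ._+_ (+ 0)

sgn : ℕ → ℤ
sgn zero = + 1
sgn (suc n) = ℤ.- sgn n

det : (k : ℕ) → (Fin k → Fin k → ℤ) → ℤ
det zero A = + 1
det (suc k) A = sumℤ (List.map (λ j → sgn (toℕ j) ℤ.* (A Fin.zero j ℤ.* det k (λ a b → A (Fin.suc a) (punchIn j b)))) (allFin (suc k)))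

subsets : (k n : ℕ) → List (Vec (Fin n) k)
subsets zero n = [] ∷ []
subsets (suc k) zero = []
subsets (suc k) (suc n) =
  List.map (λ v → Fin.zero ∷ Vec.map Fin.suc v) (subsets k n) ++
  List.map (Vec.map Fin.suc) (subsets (suc k) n)

minors : ∀ {R C} → (Fin R → Fin C → ℤ) → (k : ℕ) → List ℤ
minors {R} {C} A k =
  concatMap (λ rs → List.map (λ cs → det k (λ a b → A (lookup rs a) (lookup cs b))) (subsets k C)) (subsets k R)

-- p-adic valuation of a positive natural number (fuel-based; fuel m suffices)
valAux : ℕ → (p m : ℕ) → ℕ
valAux zero p m = 0
valAux (suc f) zero m = 0
valAux (suc f) (suc zero) m = 0
valAux (suc f) (suc (suc p)) zero = 0
valAux (suc f) (suc (suc p)) (suc m) with (suc m) % (suc (suc p))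
... | zero  = suc (valAux f (suc (suc p)) ((suc m) / (suc (suc p))))
... | suc _ = 0

val : (p m : ℕ) → ℕ
val p m = valAux m p m

minMaybe : Maybe ℕ → Maybe ℕ → Maybe ℕ
minMaybe nothing y = y
minMaybe (just a) nothing = just a
minMaybe (just a) (just b) = just (a ℕ.⊓ b)

detDivExp : ∀ {R C} → ℕ → (Fin R → Fin C → ℤ) → ℕ → Maybe ℕ
detDivExp p A k = foldr step nothing (minors A k)
  where
  step : ℤ → Maybe ℕ → Maybe ℕ
  step z acc with ∣ z ∣
  ... | zero = acc
  ... | suc m = minMaybe (just (val p (suc m))) acc

-- number of k ∈ {1,…,min(R,C)} whose k-th p-adic invariant factor
-- (= d_k / d_{k-1}) equals p^α (zero invariant factors are not counted)
invMult : ∀ {R C} → (p : ℕ) → (Fin R → Fin C → ℤ) → ℕ → ℕ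
invMult {R} {C} p A α = go (R ℕ.⊓ C) 
  where
  check : ℕ → ℕ
  check k with detDivExp p A (suc k) | detDivExp p A k
  ... | just a | just b with (a ℕ.∸ b) ℕ.≟ α
  ...   | yes _ = 1
  ...   | no _  = 0
  check k | _ | _ = 0
  go : ℕ → ℕ
  go zero = 0
  go (suc k) = check k ℕ.+ go k

sumUpTo : ℕ → (ℕ → ℕ) → ℕ
sumUpTo zero f = f 0
sumUpTo (suc n) f = sumUpTo n f ℕ.+ f (suc n)

{-# OPTIONS --safe #-}
-- Put a hyperplane at infinity. A subspace of PG(n,q) is either the closure of a flat of AG(n,q) or lies at infinity,
-- so its incidence matrix is [A₁ A₂; 0 A₃], where A₃ belongs to PG(n-1,q) and A₂ records the directions D of the flats
-- Y = a + D. Over ℤ₍ₚ₎ one has A₂ = -A₁X + ZA₃, with X(v,⟨u⟩) = 1 iff v is a nonzero multiple of u: the row of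
-- A₂ + A₁X at Y is [⟨a,D⟩] if 0 ∉ Y and q[D] if 0 ∈ Y. Both are in the row span of A₃. For q[D], take E ⊃ D of dimension
-- r + 2; the pencil of (r+1)-spaces between D and E sums to q[D] + [E], and iterating pencils inside E down to the zero
-- space gives (1 + q + ⋯ + q^r)[E] in the span, whose coefficient is a unit. Hence the matrix is equivalent to
-- diag(A₁, A₃) and the multiplicities add up.
--
-- For the bound on the exponents: in affine space the member [E] of a pencil relation is itself a disjoint union of
-- parallel flats of dimension dim E - 1, so that iterated pencils express q^r times each point by r-flats.
module Submission where

open import Defs
open import Level using (0ℓ)
open import Algebra.Bundles using (CommutativeRing)
open import Algebra.Structures using (IsCommutativeRing)
import Algebra.Properties.Ring
import Algebra.Properties.Semiring.Mult.TCOptimised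
import Algebra.Solver.Ring
import Algebra.Solver.Ring.AlmostCommutativeRing as ACR
open import Data.Bool using (Bool; true; false)
open import Data.Empty using (⊥; ⊥-elim)
open import Data.Fin as Fin using (Fin; punchIn; punchOut; toℕ)
import Data.Fin.Properties as Finₚ
open import Data.Integer as ℤ using (ℤ; ∣_∣; -[1+_]) renaming (+_ to pos)
import Data.Integer.Divisibility.Signed as ℤ∣
import Data.Integer.Properties as ℤₚ
open import Data.List as List using (List; []; _∷_; _++_; length)
open import Data.List.Membership.Propositional using (_∈_; find; lose)
open import Data.List.Membership.Propositional.Properties using (∈-++⁺ˡ; ∈-++⁺ʳ; ∈-++⁻; ∈-map⁺; ∈-map⁻; ∈-concatMap⁺; ∈-concatMap⁻)
import Data.List.Properties as Listₚ
open import Data.List.Relation.Binary.Permutation.Propositional using (_↭_)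
open import Data.List.Relation.Unary.All as ListAll using ([]; _∷_)
open import Data.List.Relation.Unary.AllPairs using (AllPairs; []; _∷_)
open import Data.List.Relation.Unary.Any using (here; there)
open import Data.List.Relation.Unary.Sorted.TotalOrder.Properties using (Sorted⇒AllPairs)
open import Data.Maybe using (Maybe; just; nothing)
open import Data.Nat as ℕ using (ℕ; zero; suc; _^_; NonZero; _≤_; _<_; z≤n; s≤s)
import Data.Nat.Divisibility as ℕ∣
open import Data.Nat.DivMod using (_/_; _%_; m/n*n≡m; m/n<m)
open import Data.Nat.Primality using (Prime; euclidsLemma; prime⇒nonZero; prime⇒nonTrivial)
import Data.Nat.Properties as ℕₚ
open import Data.List.Sort ℕₚ.≤-decTotalOrder using (sort; sort-↭; sort-↗)
open import Data.Product using (Σ; ∃; _×_; _,_; proj₁; proj₂)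
import Data.Sign as Sign
open import Data.Sum using (_⊎_; inj₁; inj₂; [_,_]′)
open import Data.Unit using (⊤; tt)
open import Data.Vec as Vec using (Vec; []; _∷_; lookup)
import Data.Vec.Properties as Vecₚ
open import Data.Vec.Relation.Unary.All using (All; []; _∷_)
open import Function using (_∘_; id; flip; const)
open import Function.Bundles using (_⇔_; mk⇔; Equivalence)
open import Relation.Binary.PropositionalEquality
open import Relation.Nullary using (¬_; Dec; yes; no; does)
open import Relation.Nullary.Decidable using (map′)

-- `invMult` speaks of valuations of minors, so equivalence has to be turned into divisibility: if
-- `A ≼ B`, a power of p that divides all k-minors of B divides all those of A. The clearing divides
-- by 1 + q + ⋯ + q^r, a unit of ℤ₍ₚ₎ but not of ℤ. Unimodular integer operations are therefore too
-- weak; the substitute is integer matrices with cancellation of factors prime to p. Index types are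
-- arbitrary and repeated rows or columns are harmless, so subspaces can be replaced by their bases
-- and points by nonzero vectors; enumerations return only at the end. Smith forms turn
-- multiplicities into counts of exponents, which visibly add up for block sums. For the bound, a
-- vector p^(rt) δ_y in the row span borders a k-minor to a (k+1)-minor, so consecutive
-- determinantal exponents differ by at most rt. The same argument forces full column rank, and the
-- multiplicities for 0 ≤ α ≤ rt then sum to the number of points.

module IncidenceMatrices where

  -- With integer coefficients the solver sees cancellations such as x - x = 0 in an abstract ring.
  module IntegerCoefficients {K : Set} {_+_ _*_ : K → K → K} { -_ : K → K} {0# 1# : K}
    (isCommutativeRing : IsCommutativeRing _≡_ _+_ _*_ -_ 0# 1#) where

    commutativeRing : CommutativeRing 0ℓ 0ℓ
    commutativeRing = record { isCommutativeRing = isCommutativeRing }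

    open CommutativeRing commutativeRing using
      ( ring; semiring; +-identityˡ; +-identityʳ; +-assoc; +-comm; -‿inverseʳ; -‿inverseˡ
      ; *-identityʳ; *-identityˡ; *-comm; *-assoc; distribˡ; distribʳ; zeroˡ; zeroʳ ) public
    open Algebra.Properties.Ring ring public
      using (-‿distribˡ-*; -‿distribʳ-*; -0#≈0#; -‿involutive; -‿+-comm)
    open Algebra.Properties.Semiring.Mult.TCOptimised semiring using (×-homo-+; 1+×; ×1-homo-*) renaming (_×_ to _·_)

    private
      fromℤ : ℤ → K
      fromℤ (pos n) = n · 1#
      fromℤ -[1+ n ] = - (suc n · 1#)

      neg-homo : ∀ i → fromℤ (ℤ.- i) ≡ - fromℤ i
      neg-homo (pos zero) = sym -0#≈0#
      neg-homo (pos (suc n)) = refl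
      neg-homo -[1+ n ] = sym (-‿involutive _)

      cancel : ∀ x y z → (z + x) + (- (z + y)) ≡ x + (- y)
      cancel x y z = begin
        (z + x) + (- (z + y))        ≡⟨ cong₂ _+_ (+-comm z x) (sym (-‿+-comm z y)) ⟩
        (x + z) + ((- z) + (- y))    ≡⟨ +-assoc x z _ ⟩
        x + (z + ((- z) + (- y)))    ≡⟨ cong (x +_) (sym (+-assoc z _ _)) ⟩
        x + ((z + (- z)) + (- y))    ≡⟨ cong (λ w → x + (w + (- y))) (-‿inverseʳ z) ⟩
        x + (0# + (- y))             ≡⟨ cong (x +_) (+-identityˡ _) ⟩
        x + (- y)                    ∎
        where open ≡-Reasoning

      ⊖-homo : ∀ m n → fromℤ (m ℤ.⊖ n) ≡ (m · 1#) + (- (n · 1#))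
      ⊖-homo m zero = sym (trans (cong ((m · 1#) +_) -0#≈0#) (+-identityʳ _))
      ⊖-homo zero (suc n) = sym (+-identityˡ _)
      ⊖-homo (suc m) (suc n) = begin
        fromℤ (suc m ℤ.⊖ suc n)             ≡⟨ cong fromℤ (ℤₚ.[1+m]⊖[1+n]≡m⊖n m n) ⟩
        fromℤ (m ℤ.⊖ n)                     ≡⟨ ⊖-homo m n ⟩
        (m · 1#) + (- (n · 1#))             ≡⟨ sym (cancel _ _ 1#) ⟩
        (1# + (m · 1#)) + (- (1# + (n · 1#))) ≡⟨ sym (cong₂ (λ x y → x + (- y)) (1+× m 1#) (1+× n 1#)) ⟩
        (suc m · 1#) + (- (suc n · 1#))     ∎
        where open ≡-Reasoning

      +-homo : ∀ i j → fromℤ (i ℤ.+ j) ≡ fromℤ i + fromℤ j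
      +-homo (pos m) (pos n) = ×-homo-+ 1# m n
      +-homo (pos m) -[1+ n ] = ⊖-homo m (suc n)
      +-homo -[1+ m ] (pos n) = trans (⊖-homo n (suc m)) (+-comm _ _)
      +-homo -[1+ m ] -[1+ n ] = trans
        (cong -_ (trans (cong (λ k → suc k · 1#) (sym (ℕₚ.+-suc m n))) (×-homo-+ 1# (suc m) (suc n))))
        (sym (-‿+-comm _ _))

      minus-homo : ∀ n → fromℤ (Sign.- ℤ.◃ n) ≡ - (n · 1#)
      minus-homo n = trans (cong fromℤ (ℤₚ.-◃n≡-n n)) (neg-homo (pos n))

      plus-homo : ∀ n → fromℤ (Sign.+ ℤ.◃ n) ≡ n · 1#
      plus-homo n = cong fromℤ (ℤₚ.+◃n≡+n n)

      *-homo : ∀ i j → fromℤ (i ℤ.* j) ≡ fromℤ i * fromℤ j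
      *-homo (pos m) (pos n) = trans (plus-homo (m ℕ.* n)) (×1-homo-* m n)
      *-homo (pos m) -[1+ n ] = trans (minus-homo (m ℕ.* suc n))
        (trans (cong -_ (×1-homo-* m (suc n))) (-‿distribʳ-* _ _))
      *-homo -[1+ m ] (pos n) = trans (minus-homo (suc m ℕ.* n))
        (trans (cong -_ (×1-homo-* (suc m) n)) (-‿distribˡ-* _ _))
      *-homo -[1+ m ] -[1+ n ] = trans (plus-homo (suc m ℕ.* suc n)) (trans (×1-homo-* (suc m) (suc n))
        (trans (sym (-‿involutive _)) (trans (cong -_ (-‿distribˡ-* _ _)) (-‿distribʳ-* _ _))))

      morphism : ℤ.+-*-rawRing ACR.-Raw-AlmostCommutative⟶ ACR.fromCommutativeRing commutativeRing
      morphism = record { ⟦_⟧ = fromℤ ; +-homo = +-homo ; *-homo = *-homo ; -‿homo = neg-homo ; 0-homo = refl ; 1-homo = refl }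

      _≟?_ : ∀ i j → Maybe (fromℤ i ≡ fromℤ j)
      i ≟? j with i ℤ.≟ j
      ... | yes eq = just (cong fromℤ eq)
      ... | no _ = nothing

    open Algebra.Solver.Ring ℤ.+-*-rawRing (ACR.fromCommutativeRing commutativeRing) morphism _≟?_ public
      using (solve; _:=_; _:+_; _:*_; :-_; con)

  -- Determinants

  infixl 6 _+_
  infixl 7 _*_
  infix 8 -_

  -- Opaque, because ℤ._+_ and ℤ._*_ unfold during unification.
  opaque
    _+_ _*_ : ℤ → ℤ → ℤ
    _+_ = ℤ._+_
    _*_ = ℤ._*_

    -_ : ℤ → ℤ
    -_ = ℤ.-_

    +-def : ∀ x y → x + y ≡ x ℤ.+ y
    +-def x y = refl

    *-def : ∀ x y → x * y ≡ x ℤ.* y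
    *-def x y = refl

    ℤ-isCommutativeRing : IsCommutativeRing _≡_ _+_ _*_ -_ (pos 0) (pos 1)
    ℤ-isCommutativeRing = ℤₚ.+-*-isCommutativeRing

  open IntegerCoefficients ℤ-isCommutativeRing

  opaque
    unfolding _+_

    ∑ : (n : ℕ) → (Fin n → ℤ) → ℤ
    ∑ zero f = pos 0
    ∑ (suc n) f = f Fin.zero + ∑ n (f ∘ Fin.suc)

    ∑-empty : (f : Fin 0 → ℤ) → ∑ 0 f ≡ pos 0
    ∑-empty f = refl

    ∑-suc : ∀ n (f : Fin (suc n) → ℤ) → ∑ (suc n) f ≡ f Fin.zero + ∑ n (f ∘ Fin.suc)
    ∑-suc n f = refl

    sumℤ-tabulate : ∀ n (f : Fin n → ℤ) → sumℤ (List.tabulate f) ≡ ∑ n f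
    sumℤ-tabulate zero f = refl
    sumℤ-tabulate (suc n) f = cong (f Fin.zero +_) (sumℤ-tabulate n (f ∘ Fin.suc))

  ∑-cong : ∀ n {f g : Fin n → ℤ} → (∀ i → f i ≡ g i) → ∑ n f ≡ ∑ n g
  ∑-cong zero h = trans (∑-empty _) (sym (∑-empty _))
  ∑-cong (suc n) h = trans (∑-suc n _) (trans (cong₂ _+_ (h Fin.zero) (∑-cong n (h ∘ Fin.suc))) (sym (∑-suc n _)))

  ∑-zero : ∀ n {f : Fin n → ℤ} → (∀ i → f i ≡ pos 0) → ∑ n f ≡ pos 0
  ∑-zero zero h = ∑-empty _
  ∑-zero (suc n) h = trans (∑-suc n _) (trans (cong₂ _+_ (h Fin.zero) (∑-zero n (h ∘ Fin.suc))) (+-identityˡ _))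

  ∑-distrib-+ : ∀ n (f g : Fin n → ℤ) → ∑ n (λ i → f i + g i) ≡ ∑ n f + ∑ n g
  ∑-distrib-+ zero f g = trans (∑-empty _) (sym (trans (cong₂ _+_ (∑-empty f) (∑-empty g)) (+-identityˡ _)))
  ∑-distrib-+ (suc n) f g = begin
    ∑ (suc n) (λ i → f i + g i)   ≡⟨ ∑-suc n _ ⟩
    _                             ≡⟨ cong (_+_ _) (∑-distrib-+ n (f ∘ Fin.suc) (g ∘ Fin.suc)) ⟩
    _                             ≡⟨ solve 4 (λ a b c d → (a :+ b) :+ (c :+ d) := (a :+ c) :+ (b :+ d)) refl _ _ _ _ ⟩
    _                             ≡⟨ sym (cong₂ _+_ (∑-suc n f) (∑-suc n g)) ⟩
    ∑ (suc n) f + ∑ (suc n) g     ∎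
    where open ≡-Reasoning

  *-distribˡ-∑ : ∀ n c (f : Fin n → ℤ) → c * ∑ n f ≡ ∑ n (λ i → c * f i)
  *-distribˡ-∑ zero c f = trans (cong (c *_) (∑-empty f)) (trans (zeroʳ c) (sym (∑-empty _)))
  *-distribˡ-∑ (suc n) c f = trans (cong (c *_) (∑-suc n f)) (trans (distribˡ c _ _)
    (trans (cong (_+_ _) (*-distribˡ-∑ n c (f ∘ Fin.suc))) (sym (∑-suc n _))))

  ∑-swap : ∀ m n (f : Fin m → Fin n → ℤ) → ∑ m (λ i → ∑ n (f i)) ≡ ∑ n (λ j → ∑ m (λ i → f i j))
  ∑-swap zero n f = trans (∑-empty _) (sym (∑-zero n (λ _ → ∑-empty _)))
  ∑-swap (suc m) n f = begin
    ∑ (suc m) (λ i → ∑ n (f i))              ≡⟨ ∑-suc m _ ⟩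
    _                                        ≡⟨ cong (_+_ _) (∑-swap m n (f ∘ Fin.suc)) ⟩
    _                                        ≡⟨ sym (∑-distrib-+ n (f Fin.zero) _) ⟩
    _                                        ≡⟨ ∑-cong n (λ j → sym (∑-suc m _)) ⟩
    ∑ n (λ j → ∑ (suc m) (λ i → f i j))      ∎
    where open ≡-Reasoning

  -∑ : ∀ n (f : Fin n → ℤ) → - ∑ n f ≡ ∑ n (λ i → - f i)
  -∑ zero f = trans (cong -_ (∑-empty f)) (trans -0#≈0# (sym (∑-empty _)))
  -∑ (suc n) f = trans (cong -_ (∑-suc n f)) (trans (sym (-‿+-comm _ _))
    (trans (cong (_+_ _) (-∑ n (f ∘ Fin.suc))) (sym (∑-suc n _))))

  opaque
    unfolding ∑

    sg : ∀ {n} → Fin n → ℤ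
    sg j = sgn (toℕ j)

    sg-zero : ∀ {n} → sg {suc n} Fin.zero ≡ pos 1
    sg-zero = refl

    sg-suc : ∀ {n} (j : Fin n) → sg (Fin.suc j) ≡ - sg j
    sg-suc j = refl

    Det : (k : ℕ) → (Fin k → Fin k → ℤ) → ℤ
    Det = det

    Det-def : ∀ k A → det k A ≡ Det k A
    Det-def k A = refl

    Det-zero : ∀ A → Det 0 A ≡ pos 1
    Det-zero A = refl

    Det-row : ∀ k (A : Fin (suc k) → Fin (suc k) → ℤ) →
      Det (suc k) A ≡ ∑ (suc k) (λ j → sg j * (A Fin.zero j * Det k (λ a b → A (Fin.suc a) (punchIn j b))))
    Det-row k A = trans (cong sumℤ (Listₚ.map-tabulate id f)) (sumℤ-tabulate (suc k) f)
      where
      f : Fin (suc k) → ℤ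
      f j = sg j * (A Fin.zero j * Det k (λ a b → A (Fin.suc a) (punchIn j b)))

  Det-cong : ∀ k {A B : Fin k → Fin k → ℤ} → (∀ a b → A a b ≡ B a b) → Det k A ≡ Det k B
  Det-cong zero h = trans (Det-zero _) (sym (Det-zero _))
  Det-cong (suc k) {A} {B} h = begin
    Det (suc k) A  ≡⟨ Det-row k A ⟩
    _              ≡⟨ ∑-cong (suc k) (λ j → cong (sg j *_) (cong₂ _*_ (h Fin.zero j)
                       (Det-cong k (λ a b → h (Fin.suc a) (punchIn j b))))) ⟩
    _              ≡⟨ sym (Det-row k B) ⟩
    Det (suc k) B  ∎
    where open ≡-Reasoning

  -- Apart from the corner term, which both expansions share, each minor of the row expansion still
  -- contains column 0 and is expanded along it by induction. Exchanging the two sums and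
  -- reassembling along rows gives the column expansion.
  Det-column : ∀ k (A : Fin (suc k) → Fin (suc k) → ℤ) →
    Det (suc k) A ≡ ∑ (suc k) (λ i → sg i * (A i Fin.zero * Det k (λ a b → A (punchIn i a) (Fin.suc b))))
  Det-column zero A = trans (Det-row zero A)
      (∑-cong 1 (λ { Fin.zero → cong (λ z → sg Fin.zero * (A Fin.zero Fin.zero * z)) (Det-cong 0 λ ()) }))
  Det-column (suc k) A = begin
    Det (suc (suc k)) A
      ≡⟨ Det-row (suc k) A ⟩
    _ ≡⟨ ∑-suc (suc k) _ ⟩
    _ ≡⟨ cong (_+_ _) (∑-cong (suc k) (λ j → trans
           (cong₂ (λ s z → s * (A Fin.zero (Fin.suc j) * z)) (sg-suc j) (Det-column k _))
           (pull (sg j) (A Fin.zero (Fin.suc j)) _))) ⟩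
    _ ≡⟨ cong (_+_ _) (∑-swap (suc k) (suc k) _) ⟩
    _ ≡⟨ cong (_+_ _) (∑-cong (suc k) (λ i → ∑-cong (suc k) (λ j →
           shuffle (sg j) (A Fin.zero (Fin.suc j)) (sg i) (A (Fin.suc i) Fin.zero) _))) ⟩
    _ ≡⟨ cong (_+_ _) (∑-cong (suc k) (λ i → sym (trans
           (cong₂ (λ s z → s * (A (Fin.suc i) Fin.zero * z)) (sg-suc i) (Det-row k _))
           (pull (sg i) (A (Fin.suc i) Fin.zero) _)))) ⟩
    _ ≡⟨ sym (∑-suc (suc k) _) ⟩
    ∑ (suc (suc k)) (λ i → sg i * (A i Fin.zero * Det (suc k) (λ a b → A (punchIn i a) (Fin.suc b)))) ∎
    where
    open ≡-Reasoning
    shuffle : ∀ s x t y z → (- (s * x)) * (t * (y * z)) ≡ (- (t * y)) * (s * (x * z))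
    shuffle = solve 5 (λ s x t y z → (:- (s :* x)) :* (t :* (y :* z)) := (:- (t :* y)) :* (s :* (x :* z))) refl
    pull : ∀ s x (f : Fin (suc k) → ℤ) → (- s) * (x * ∑ (suc k) f) ≡ ∑ (suc k) (λ i → (- (s * x)) * f i)
    pull s x f = trans (solve 3 (λ s x z → (:- s) :* (x :* z) := (:- (s :* x)) :* z) refl s x _)
        (*-distribˡ-∑ (suc k) _ f)

  Det-transpose : ∀ k (A : Fin k → Fin k → ℤ) → Det k A ≡ Det k (λ a b → A b a)
  Det-transpose zero A = Det-cong 0 λ ()
  Det-transpose (suc k) A = begin
    Det (suc k) A                ≡⟨ Det-column k A ⟩
    _                            ≡⟨ ∑-cong (suc k) (λ i → cong (λ z → sg i * (A i Fin.zero * z)) (Det-transpose k _)) ⟩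
    _                            ≡⟨ sym (Det-row k (λ a b → A b a)) ⟩
    Det (suc k) (λ a b → A b a)  ∎
    where open ≡-Reasoning

  -- The double Laplace expansion along two rows a and b; the remaining rows enter through
  -- the function G of the increasing sequence of the remaining columns.
  laplace₂ : ∀ k (a b : Fin (suc (suc k)) → ℤ) → ((Fin k → Fin (suc (suc k))) → ℤ) → ℤ
  laplace₂ k a b G = ∑ (suc (suc k)) λ j → sg j * (a j *
    ∑ (suc k) λ l → sg l * (b (punchIn j l) * G (λ x → punchIn j (punchIn l x))))

  liftFin : ∀ {m n} → (Fin m → Fin n) → Fin (suc m) → Fin (suc n)
  liftFin f Fin.zero = Fin.zero
  liftFin f (Fin.suc i) = Fin.suc (f i)

  Extensional : ∀ {m n} → ((Fin m → Fin n) → ℤ) → Set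
  Extensional G = ∀ {f g} → (∀ x → f x ≡ g x) → G f ≡ G g

  -- Peeling off column 0 from both expansions leaves a term antisymmetric in (a , b) and the
  -- expansion on the remaining columns.
  laplace₂-antisym : ∀ k a b G → Extensional G → laplace₂ k a b G + laplace₂ k b a G ≡ pos 0
  laplace₂-antisym k a b G ext = trans (cong₂ _+_ (split a b) (split b a))
    (trans (regroup (U a b) (U b a) (T k a b G) (T k b a G)) (T-antisym k a b G ext))
    where
    U : (a b : Fin (suc (suc k)) → ℤ) → ℤ
    U a b = a Fin.zero * ∑ (suc k) (λ l → sg l * (b (Fin.suc l) * G (λ x → Fin.suc (punchIn l x))))
    T : ∀ k (a b : Fin (suc (suc k)) → ℤ) → ((Fin k → Fin (suc (suc k))) → ℤ) → ℤ
    T k a b G = ∑ (suc k) λ j → sg j * (a (Fin.suc j) *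
      ∑ k λ l → sg l * (b (Fin.suc (punchIn j l)) * G (λ x → punchIn (Fin.suc j) (punchIn (Fin.suc l) x))))
    regroup : ∀ u v s t → ((u + - v) + s) + ((v + - u) + t) ≡ s + t
    regroup = solve 4 (λ u v s t → ((u :+ :- v) :+ s) :+ ((v :+ :- u) :+ t) := s :+ t) refl
    expand : ∀ s x y w z → (- s) * (x * (pos 1 * (y * w) + - z)) ≡ (- (y * (s * (x * w)))) + s * (x * z)
    expand = solve 5 (λ s x y w z → (:- s) :* (x :* (con (pos 1) :* (y :* w) :+ :- z))
                                  := (:- (y :* (s :* (x :* w)))) :+ s :* (x :* z)) refl
    inner : ∀ a b j → sg (Fin.suc j) * (a (Fin.suc j) * ∑ (suc k) (λ l → sg l * (b (punchIn (Fin.suc j) l) * G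
        (λ x → punchIn (Fin.suc j) (punchIn l x)))))
        ≡ (- (b Fin.zero * (sg j * (a (Fin.suc j) * G (λ x → Fin.suc (punchIn j x))))))
          + sg j * (a (Fin.suc j) * ∑ k (λ l → sg l * (b (Fin.suc (punchIn j l)) * G (λ x → punchIn (Fin.suc j)
              (punchIn (Fin.suc l) x)))))
    inner a b j = trans
      (cong₂ (λ s z → s * (a (Fin.suc j) * z)) (sg-suc j) (trans (∑-suc k _) (cong₂ _+_ (cong₂ _*_ sg-zero refl)
        (trans (∑-cong k (λ l → trans (cong₂ _*_ (sg-suc l) refl) (sym (-‿distribˡ-* _ _)))) (sym (-∑ k _))))))
      (expand (sg j) (a (Fin.suc j)) (b Fin.zero) _ _)
    split : ∀ a b → laplace₂ k a b G ≡ (U a b + - U b a) + T k a b G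
    split a b = trans (∑-suc (suc k) _) (trans
      (cong₂ _+_ (trans (cong₂ _*_ sg-zero refl) (*-identityˡ _)) (trans (∑-cong (suc k) (inner a b))
          (trans (∑-distrib-+ (suc k) _ _)
        (cong (_+ T k a b G) (trans (sym (-∑ (suc k) _)) (cong -_ (sym (*-distribˡ-∑ (suc k) (b Fin.zero) _))))))))
      (sym (+-assoc (U a b) (- U b a) (T k a b G))))
    T-antisym : ∀ k a b G → Extensional G → T k a b G + T k b a G ≡ pos 0
    T-antisym zero a b G ext = trans (cong₂ _+_ (∑-zero 1 (vanish a b)) (∑-zero 1 (vanish b a))) (+-identityˡ _)
      where
      vanish : ∀ a b (j : Fin 1) → sg j * (a (Fin.suc j) *
        ∑ 0 (λ l → sg l * (b (Fin.suc (punchIn j l)) * G (λ x → punchIn (Fin.suc j) (punchIn (Fin.suc l) x))))) ≡ pos 0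
      vanish a b j = trans (cong (λ z → sg j * (a (Fin.suc j) * z)) (∑-empty _))
        (trans (cong (sg j *_) (zeroʳ (a (Fin.suc j)))) (zeroʳ (sg j)))
    -- In T neither row uses column 0, so it stays the first remaining column: the selections are
    -- lifts, and the sum is a double expansion on the other columns.
    T-antisym (suc k) a b G ext = trans (cong₂ _+_ (eq a b) (eq b a))
      (laplace₂-antisym k (a ∘ Fin.suc) (b ∘ Fin.suc) (G ∘ liftFin)
          (λ h → ext (λ { Fin.zero → refl ; (Fin.suc x) → cong Fin.suc (h x) })))
      where
      eq : ∀ a b → T (suc k) a b G ≡ laplace₂ k (a ∘ Fin.suc) (b ∘ Fin.suc) (G ∘ liftFin)
      eq a b = ∑-cong (suc (suc k)) (λ j → cong (λ z → sg j * (a (Fin.suc j) * z)) (∑-cong (suc k) (λ l →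
        cong (λ z → sg l * (b (Fin.suc (punchIn j l)) * z)) (ext (λ { Fin.zero → refl ; (Fin.suc x) → refl })))))

  -- Divisibility of minors

  infix 4 _∣_

  _∣_ : ℤ → ℤ → Set
  m ∣ z = ∃ λ k → z ≡ k * m

  ∣-zero : ∀ {m} → m ∣ pos 0
  ∣-zero {m} = pos 0 , sym (zeroˡ m)

  ∣-+ : ∀ {m x y} → m ∣ x → m ∣ y → m ∣ x + y
  ∣-+ {m} (k , refl) (l , refl) = k + l , sym (distribʳ m k l)

  ∣-* : ∀ {m x} c → m ∣ x → m ∣ c * x
  ∣-* {m} c (k , refl) = c * k , sym (*-assoc c k m)

  ∣-neg : ∀ {m x} → m ∣ x → m ∣ - x
  ∣-neg {m} (k , refl) = - k , -‿distribˡ-* k m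

  ∣-resp : ∀ {m x y} → x ≡ y → m ∣ x → m ∣ y
  ∣-resp refl d = d

  ∣-∑ : ∀ {m} n (f : Fin n → ℤ) → (∀ i → m ∣ f i) → m ∣ ∑ n f
  ∣-∑ zero f h = ∣-resp (sym (∑-empty f)) ∣-zero
  ∣-∑ (suc n) f h = ∣-resp (sym (∑-suc n f)) (∣-+ (h Fin.zero) (∣-∑ n _ (h ∘ Fin.suc)))

  ∣⇒ℕ∣ : ∀ {m z} → m ∣ z → ∣ m ∣ ℕ∣.∣ ∣ z ∣
  ∣⇒ℕ∣ {m} (k , refl) = ℕ∣.divides ∣ k ∣ (trans (cong ∣_∣ (*-def k m)) (ℤₚ.abs-* k m))

  ℕ∣⇒∣ : ∀ {m z} → ∣ m ∣ ℕ∣.∣ ∣ z ∣ → m ∣ z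
  ℕ∣⇒∣ {m} {z} d with ℤ∣.∣ᵤ⇒∣ {m} {z} d
  ... | ℤ∣.divides k eq = k , trans eq (sym (*-def k m))

  ≡-neg⇒≡0 : ∀ {z} → z ≡ - z → z ≡ pos 0
  ≡-neg⇒≡0 {z} eq = halve (trans (cong (_+ z) eq) (-‿inverseˡ z))
    where
    opaque
      unfolding _+_
      halve : ∀ {z} → z + z ≡ pos 0 → z ≡ pos 0
      halve {pos zero} _ = refl
      halve {pos (suc n)} ()
      halve { -[1+ n ]} ()

  -- Only adjacent transpositions are demanded, in the shape that recursion on the vector consumes:
  -- one at the front, the others in the tail. Vanishing at equal neighbours follows from
  -- `≡-neg⇒≡0`, as ℤ has no 2-torsion.
  Alternating : ∀ {X : Set} k → (Vec X k → ℤ) → Set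
  Alternating zero f = ⊤
  Alternating (suc zero) f = ⊤
  Alternating (suc (suc k)) f =
    (∀ x y v → f (x ∷ y ∷ v) ≡ - f (y ∷ x ∷ v)) × (∀ x → Alternating (suc k) (λ v → f (x ∷ v)))

  Alternating-tail : ∀ {X : Set} k {f : Vec X (suc k) → ℤ} → Alternating (suc k) f → ∀ x → Alternating k
      (λ v → f (x ∷ v))
  Alternating-tail zero alt x = tt
  Alternating-tail (suc k) alt x = proj₂ alt x

  Alternating-map : ∀ {X Y : Set} (h : X → Y) k {f : Vec Y k → ℤ} → Alternating k f → Alternating k (f ∘ Vec.map h)
  Alternating-map h zero alt = tt
  Alternating-map h (suc zero) alt = tt
  Alternating-map h (suc (suc k)) (swap , rest) =
    (λ x y v → swap (h x) (h y) (Vec.map h v)) , λ x → Alternating-map h (suc k) (rest (h x))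

  Alternating-∑ : ∀ {X : Set} k n (c : Fin n → ℤ) (g : Fin n → Vec X k → ℤ) {f : Vec X k → ℤ} →
    (∀ v → f v ≡ ∑ n (λ j → c j * g j v)) → (∀ j → Alternating k (g j)) → Alternating k f
  Alternating-∑ zero n c g eq alt = tt
  Alternating-∑ (suc zero) n c g eq alt = tt
  Alternating-∑ (suc (suc k)) n c g eq alt =
    (λ x y v → trans (eq (x ∷ y ∷ v)) (trans
      (∑-cong n (λ j → trans (cong (c j *_) (proj₁ (alt j) x y v)) (sym (-‿distribʳ-* (c j) _))))
      (trans (sym (-∑ n _)) (cong -_ (sym (eq (y ∷ x ∷ v))))))) ,
    λ x → Alternating-∑ (suc k) n c (λ j v → g j (x ∷ v)) (λ v → eq (x ∷ v)) (λ j → proj₂ (alt j) x)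

  -- Vectors are functions compared pointwise, hence the third field.
  record Linear {C : Set} (g : (C → ℤ) → ℤ) : Set where
    field
      additive : ∀ x y → g (λ c → x c + y c) ≡ g x + g y
      homogeneous : ∀ s x → g (λ c → s * x c) ≡ s * g x
      extensional : ∀ {x y} → (∀ c → x c ≡ y c) → g x ≡ g y

  open Linear

  Multilinear : ∀ {C : Set} k → (Vec (C → ℤ) k → ℤ) → Set
  Multilinear zero f = ⊤
  Multilinear (suc k) f = (∀ v → Linear (λ x → f (x ∷ v))) × (∀ x → Multilinear k (λ v → f (x ∷ v)))

  Linear-∑ : ∀ {C : Set} n (c : Fin n → ℤ) (g : Fin n → (C → ℤ) → ℤ) {f : (C → ℤ) → ℤ} →
    (∀ x → f x ≡ ∑ n (λ j → c j * g j x)) → (∀ j → Linear (g j)) → Linear f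
  Linear-∑ n c g eq lin .additive x y = trans (eq _) (trans
    (∑-cong n (λ j → trans (cong (c j *_) (lin j .additive x y)) (distribˡ (c j) _ _)))
    (trans (∑-distrib-+ n _ _) (sym (cong₂ _+_ (eq x) (eq y)))))
  Linear-∑ n c g eq lin .homogeneous s x = trans (eq _) (trans
    (∑-cong n (λ j → trans (cong (c j *_) (lin j .homogeneous s x))
      (solve 3 (λ a b d → a :* (b :* d) := b :* (a :* d)) refl (c j) s _)))
    (trans (sym (*-distribˡ-∑ n s _)) (cong (s *_) (sym (eq x)))))
  Linear-∑ n c g eq lin .extensional h = trans (eq _) (trans (∑-cong n (λ j → cong (c j *_) (lin j .extensional h)))
      (sym (eq _)))

  Multilinear-∑ : ∀ {C : Set} k n (c : Fin n → ℤ) (g : Fin n → Vec (C → ℤ) k → ℤ) {f : Vec (C → ℤ) k → ℤ} →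
    (∀ v → f v ≡ ∑ n (λ j → c j * g j v)) → (∀ j → Multilinear k (g j)) → Multilinear k f
  Multilinear-∑ zero n c g eq ml = tt
  Multilinear-∑ (suc k) n c g eq ml =
    (λ v → Linear-∑ n c (λ j x → g j (x ∷ v)) (λ x → eq (x ∷ v)) (λ j → proj₁ (ml j) v)) ,
    (λ x → Multilinear-∑ k n c (λ j v → g j (x ∷ v)) (λ v → eq (x ∷ v)) (λ j → proj₂ (ml j) x))

  -- Only the columns are fixed. Letting the rows be arbitrary vectors makes alternation and
  -- multilinearity expressible, and rows of one matrix replaceable by combinations of rows of
  -- another.
  minor : ∀ {C : Set} {k} → (Fin k → C) → Vec (C → ℤ) k → ℤ
  minor {k = k} cs v = Det k (λ a b → lookup v a (cs b))

  minor-cons : ∀ {C : Set} {k} (cs : Fin (suc k) → C) x v →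
    minor cs (x ∷ v) ≡ ∑ (suc k) (λ j → (sg j * x (cs j)) * minor (λ b → cs (punchIn j b)) v)
  minor-cons {k = k} cs x v = trans (Det-row k _) (∑-cong (suc k) (λ j → sym (*-assoc (sg j) _ _)))

  -- For the first two rows this is the antisymmetry of the double Laplace expansion; for later
  -- rows, expanding along the first row leaves smaller minors.
  minor-alternating : ∀ {C : Set} k (cs : Fin k → C) → Alternating k (minor cs)
  minor-alternating zero cs = tt
  minor-alternating (suc zero) cs = tt
  minor-alternating {C} (suc (suc k)) cs = swap , λ x →
      Alternating-∑ (suc k) (suc (suc k)) (λ j → sg j * x (cs j)) _ (minor-cons cs x) (λ j → minor-alternating
          (suc k) _)
    where
    expand : ∀ x y v → minor cs (x ∷ y ∷ v) ≡ laplace₂ k (x ∘ cs) (y ∘ cs) (λ h → minor (cs ∘ h) v)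
    expand x y v = trans (Det-row (suc k) _) (∑-cong (suc (suc k)) (λ j → cong (λ z → sg j * (x (cs j) * z))
        (Det-row k _)))
    opp : ∀ {a b} → a + b ≡ pos 0 → a ≡ - b
    opp {a} {b} eq = trans (solve 2 (λ a b → a := (a :+ b) :+ :- b) refl a b) (trans (cong (_+ - b) eq) (+-identityˡ _))
    swap : ∀ x y v → minor cs (x ∷ y ∷ v) ≡ - minor cs (y ∷ x ∷ v)
    swap x y v = trans (expand x y v) (trans
      (opp (laplace₂-antisym k (x ∘ cs) (y ∘ cs) _ (λ h → Det-cong k (λ a b → cong (lookup v a ∘ cs) (h b)))))
      (cong -_ (sym (expand y x v))))

  minor-multilinear : ∀ {C : Set} k (cs : Fin k → C) → Multilinear k (minor cs)
  minor-multilinear zero cs = tt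
  minor-multilinear (suc k) cs = (λ v → Linear-∑ (suc k) (λ j → sg j * minor (λ b → cs (punchIn j b)) v)
      (λ j x → x (cs j))
      (λ x → trans (minor-cons cs x v) (∑-cong (suc k) (λ j → solve 3 (λ a b c → (a :* b) :* c := (a :* c) :* b) refl
          (sg j) (x (cs j)) _)))
      (λ j → record { additive = λ _ _ → refl ; homogeneous = λ _ _ → refl ; extensional = λ h → h (cs j) })) ,
    λ x → Multilinear-∑ k (suc k) (λ j → sg j * x (cs j)) _ (minor-cons cs x) (λ j → minor-multilinear k _)

  -- Unless v avoids 0, adjacent transpositions bubble an occurrence of 0 to the front.
  to-front : ∀ {m n k} (v : Vec (Fin (suc n)) (suc k)) → (∃ λ w → v ≡ Vec.map Fin.suc w) ⊎
    (∃ λ w → ∀ f → Alternating (suc k) f → m ∣ f (Fin.zero ∷ w) → m ∣ f v)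
  to-front (Fin.zero ∷ w) = inj₂ (w , λ f alt d → d)
  to-front (Fin.suc i ∷ []) = inj₁ (i ∷ [] , refl)
  to-front (Fin.suc i ∷ v@(_ ∷ _)) with to-front v
  ... | inj₁ (w , eq) = inj₁ (i ∷ w , cong (Fin.suc i ∷_) eq)
  ... | inj₂ (w , h) = inj₂ (Fin.suc i ∷ w , λ f alt d →
          h (λ u → f (Fin.suc i ∷ u)) (proj₂ alt (Fin.suc i)) (∣-resp (sym (proj₁ alt _ _ w)) (∣-neg d)))

  -- Reordering by induction on n: an index 0 moves to the front, and the remaining indices then
  -- avoid 0 unless the value vanishes.
  alternating-∣ : ∀ {m} n k (f : Vec (Fin n) k → ℤ) → Alternating k f →
    (∀ v → v ∈ subsets k n → m ∣ f v) → ∀ v → m ∣ f v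
  alternating-∣ n zero f alt h [] = h [] (here refl)
  alternating-∣ zero (suc k) f alt h (() ∷ _)
  alternating-∣ {m} (suc n) (suc k) f alt h v with to-front {m} v
  ... | inj₁ (w , refl) = alternating-∣ n (suc k) (f ∘ Vec.map Fin.suc) (Alternating-map Fin.suc (suc k) alt)
          (λ u i → h _ (∈-++⁺ʳ _ (∈-map⁺ _ i))) w
  ... | inj₂ (w , move) = move f alt (first k f alt h w)
    where
    first : ∀ k (f : Vec (Fin (suc n)) (suc k) → ℤ) → Alternating (suc k) f →
      (∀ v → v ∈ subsets (suc k) (suc n) → m ∣ f v) → ∀ w → m ∣ f (Fin.zero ∷ w)
    suffix : ∀ k (f : Vec (Fin (suc n)) (suc k) → ℤ) → Alternating (suc k) f →
      (∀ v → v ∈ subsets (suc k) (suc n) → m ∣ f v) → ∀ w → m ∣ f (Fin.zero ∷ Vec.map Fin.suc w)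
    suffix k f alt h w = alternating-∣ n k (λ u → f (Fin.zero ∷ Vec.map Fin.suc u))
      (Alternating-map Fin.suc k (Alternating-tail k alt Fin.zero)) (λ u i → h _ (∈-++⁺ˡ (∈-map⁺ _ i))) w
    first zero f alt h [] = suffix zero f alt h []
    first (suc k) f alt h w with to-front {m} w
    ... | inj₁ (u , refl) = suffix (suc k) f alt h u
    -- A second 0 can be moved next to the first, where the swap gives f = - f and hence the value
    -- 0.
    ... | inj₂ (u , move) = move _ (proj₂ alt Fin.zero)
            (∣-resp (sym (≡-neg⇒≡0 (proj₁ alt Fin.zero Fin.zero u))) ∣-zero)

  Matrix : Set → Set → Set
  Matrix R C = R → C → ℤ

  submatrix : ∀ {R C : Set} {k} → Matrix R C → Vec R k → Vec C k → Fin k → Fin k → ℤ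
  submatrix A rs cs a b = A (lookup rs a) (lookup cs b)

  Det-submatrix : ∀ {R C : Set} {k} (A : Matrix R C) (rs : Vec R k) (cs : Vec C k) →
    Det k (submatrix A rs cs) ≡ minor (lookup cs) (Vec.map A rs)
  Det-submatrix {k = k} A rs cs = Det-cong k (λ a b → cong-app (sym (Vecₚ.lookup-map a A rs)) (lookup cs b))

  Det-submatrix-flip : ∀ {R C : Set} {k} (A : Matrix R C) (rs : Vec R k) (cs : Vec C k) →
    Det k (submatrix A rs cs) ≡ Det k (submatrix (flip A) cs rs)
  Det-submatrix-flip {k = k} A rs cs = Det-transpose k _

  increasing-rows-∣ : ∀ {m R k} {C : Set} (A : Matrix (Fin R) C) (cs : Vec C k) →
    (∀ rs → rs ∈ subsets k R → m ∣ Det k (submatrix A rs cs)) → ∀ rs → m ∣ Det k (submatrix A rs cs)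
  increasing-rows-∣ {R = R} {k} A cs h rs = ∣-resp (sym (Det-submatrix A rs cs))
    (alternating-∣ R k (minor (lookup cs) ∘ Vec.map A) (Alternating-map A k (minor-alternating k _))
      (λ v i → ∣-resp (Det-submatrix A v cs) (h v i)) rs)

  -- Bridges `minors`, which runs over increasing tuples, and row or column operations, which lead
  -- to arbitrary ones. Transposition lets columns be treated as rows.
  increasing-∣ : ∀ {m R C} (A : Matrix (Fin R) (Fin C)) k →
    (∀ rs cs → rs ∈ subsets k R → cs ∈ subsets k C → m ∣ Det k (submatrix A rs cs)) →
    ∀ rs cs → m ∣ Det k (submatrix A rs cs)
  increasing-∣ A k h rs cs = increasing-rows-∣ A cs (λ rs' i → ∣-resp (Det-submatrix-flip (flip A) cs rs')
    (increasing-rows-∣ (flip A) rs' (λ cs' j → ∣-resp (Det-submatrix-flip A rs' cs') (h rs' cs' i j)) cs)) rs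

  -- Equivalence of matrices over ℤ₍ₚ₎

  infixl 5 _⊞_

  _⊞_ : ∀ {R C R' C' : Set} → Matrix R C → Matrix R' C' → Matrix (R ⊎ R') (C ⊎ C')
  (A ⊞ B) (inj₁ r) = [ A r , const (pos 0) ]′
  (A ⊞ B) (inj₂ r) = [ const (pos 0) , B r ]′

  flip-⊞ : ∀ {R C R' C' : Set} (A : Matrix R C) (B : Matrix R' C') c r → (flip A ⊞ flip B) c r ≡ (A ⊞ B) r c
  flip-⊞ A B (inj₁ c) (inj₁ r) = refl
  flip-⊞ A B (inj₁ c) (inj₂ r) = refl
  flip-⊞ A B (inj₂ c) (inj₁ r) = refl
  flip-⊞ A B (inj₂ c) (inj₂ r) = refl

  module Local (p : ℕ) (prime : Prime p) where

    instance
      p-nonZero : NonZero p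
      p-nonZero = prime⇒nonZero prime

    opaque
      P : ℕ → ℤ
      P e = pos (p ^ e)

      P-def : ∀ e → P e ≡ pos (p ^ e)
      P-def e = refl

    P-+ : ∀ a b → P (a ℕ.+ b) ≡ P a * P b
    P-+ a b = trans (P-def (a ℕ.+ b)) (trans (cong pos (ℕₚ.^-distribˡ-+-* p a b))
      (trans (ℤₚ.pos-* (p ^ a) (p ^ b)) (trans (sym (*-def _ _)) (sym (cong₂ _*_ (P-def a) (P-def b))))))

    P∣⇒ℕ∣ : ∀ {e z} → P e ∣ z → p ^ e ℕ∣.∣ ∣ z ∣
    P∣⇒ℕ∣ {e} {z} d = ∣⇒ℕ∣ {pos (p ^ e)} {z} (subst (_∣ z) (P-def e) d)

    ℕ∣⇒P∣ : ∀ {e z} → p ^ e ℕ∣.∣ ∣ z ∣ → P e ∣ z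
    ℕ∣⇒P∣ {e} {z} d = subst (_∣ z) (sym (P-def e)) (ℕ∣⇒∣ {pos (p ^ e)} {z} d)

    P-mono : ∀ {a b z} → a ≤ b → P b ∣ z → P a ∣ z
    P-mono {a} {b} {z} le (k , refl) = k * P (b ℕ.∸ a) , trans (cong (k *_) (trans (cong P (sym (ℕₚ.m∸n+n≡m le)))
        (P-+ (b ℕ.∸ a) a))) (sym (*-assoc k _ _))

    P-≤ : ∀ {a b} → P a ∣ P b → a ≤ b
    P-≤ {a} {b} d = ℕₚ.≮⇒≥ (λ b<a → ℕₚ.<⇒≱ (ℕₚ.^-monoʳ-< p (ℕ.nonTrivial⇒n>1 p ⦃ prime⇒nonTrivial prime ⦄) b<a)
      (ℕ∣.∣⇒≤ ⦃ ℕₚ.m^n≢0 p b ⦄ (subst (λ z → p ^ a ℕ∣.∣ ∣ z ∣) (P-def b) (P∣⇒ℕ∣ d))))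

    -- Bounds the search for the valuation of a nonzero entry in `pivot`.
    n<p^n : ∀ n → n < p ^ n
    n<p^n zero = s≤s z≤n
    n<p^n (suc n) = ℕₚ.<-≤-trans (s≤s (n<p^n n)) (ℕₚ.^-monoʳ-< p (ℕ.nonTrivial⇒n>1 p ⦃ prime⇒nonTrivial prime ⦄)
        (ℕₚ.n<1+n n))

    P∣? : ∀ e z → Dec (P e ∣ z)
    P∣? e z = map′ ℕ∣⇒P∣ P∣⇒ℕ∣ (p ^ e ℕ∣.∣? ∣ z ∣)

    -- The integers that are invertible in ℤ₍ₚ₎.
    Unit : ℤ → Set
    Unit u = ¬ pos p ∣ u

    -- One factor p at a time: Euclid's lemma places it in z, and it is then cancelled on both
    -- sides.
    p^-cancel : ∀ e {u z} → ¬ p ℕ∣.∣ u → p ^ e ℕ∣.∣ u ℕ.* z → p ^ e ℕ∣.∣ z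
    p^-cancel zero unit d = ℕ∣.1∣ _
    p^-cancel (suc e) {u} {z} unit d with euclidsLemma u z prime (ℕ∣.∣-trans (ℕ∣.m∣m*n (p ^ e)) d)
    ... | inj₁ p∣u = ⊥-elim (unit p∣u)
    ... | inj₂ (ℕ∣.divides z' refl) = subst (p ^ suc e ℕ∣.∣_) (ℕₚ.*-comm p z')
        (ℕ∣.*-monoʳ-∣ p (p^-cancel e unit (ℕ∣.*-cancelˡ-∣ p (subst (p ^ suc e ℕ∣.∣_) shuffle d))))
      where
      shuffle : u ℕ.* (z' ℕ.* p) ≡ p ℕ.* (u ℕ.* z')
      shuffle = trans (sym (ℕₚ.*-assoc u z' p)) (ℕₚ.*-comm (u ℕ.* z') p)

    unit-cancel : ∀ e {u z} → Unit u → P e ∣ u * z → P e ∣ z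
    unit-cancel e {u} {z} unit d = ℕ∣⇒P∣ (p^-cancel e {∣ u ∣} {∣ z ∣} (unit ∘ ℕ∣⇒∣)
      (subst (p ^ e ℕ∣.∣_) (trans (cong ∣_∣ (*-def u z)) (ℤₚ.abs-* u z)) (P∣⇒ℕ∣ d)))

    -- The ℤ₍ₚ₎-span of the rows, restricted to integer vectors.
    data Span {R C : Set} (B : Matrix R C) : (C → ℤ) → Set where
      gen : ∀ r → Span B (B r)
      zero : Span B (λ _ → pos 0)
      add : ∀ {x y} → Span B x → Span B y → Span B (λ c → x c + y c)
      scale : ∀ s {x} → Span B x → Span B (λ c → s * x c)
      ext : ∀ {x y} → (∀ c → x c ≡ y c) → Span B x → Span B y
      cancel : ∀ {u x} → Unit u → Span B (λ c → u * x c) → Span B x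

    -- The constructor `cancel` is sound here because divisibility by a power of p ignores factors
    -- prime to p. This is the point where localisation meets divisibility.
    Linear-Span : ∀ {R C : Set} {B : Matrix R C} {g} {e} → Linear g →
        (∀ r → P e ∣ g (B r)) → ∀ {v} → Span B v → P e ∣ g v
    Linear-Span lin h (gen r) = h r
    Linear-Span {g = g} lin h zero = ∣-resp
      (trans (sym (zeroˡ _)) (trans (sym (lin .homogeneous (pos 0) (λ _ → pos 0)))
          (lin .extensional (λ _ → zeroˡ _)))) ∣-zero
    Linear-Span lin h (add s t) = ∣-resp (sym (lin .additive _ _)) (∣-+ (Linear-Span lin h s) (Linear-Span lin h t))
    Linear-Span lin h (scale c s) = ∣-resp (sym (lin .homogeneous c _)) (∣-* c (Linear-Span lin h s))
    Linear-Span lin h (ext eq s) = ∣-resp (lin .extensional eq) (Linear-Span lin h s)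
    Linear-Span {e = e} lin h (cancel unit s) = unit-cancel e unit (∣-resp (lin .homogeneous _ _) (Linear-Span lin h s))

    -- Plays the part of the Cauchy-Binet formula: the rows are exchanged one argument at a time,
    -- without a coefficient matrix.
    Multilinear-Span : ∀ {R C : Set} {B : Matrix R C} {e} k {f : Vec (C → ℤ) k → ℤ} → Multilinear k f →
      (∀ (rs : Vec R k) → P e ∣ f (Vec.map B rs)) → ∀ {v} → All (Span B) v → P e ∣ f v
    Multilinear-Span zero ml h [] = h []
    Multilinear-Span (suc k) {f} ml h (s ∷ ss) = Linear-Span (proj₁ ml _)
      (λ r → Multilinear-Span k (proj₂ ml _) (λ rs → h (r ∷ rs)) ss) s

    Span-mono : ∀ {R R' C : Set} {A : Matrix R C} {B : Matrix R' C} → (∀ r → Span B (A r)) → ∀ {v} → Span A v → Span B v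
    Span-mono h (gen r) = h r
    Span-mono h zero = zero
    Span-mono h (add s t) = add (Span-mono h s) (Span-mono h t)
    Span-mono h (scale c s) = scale c (Span-mono h s)
    Span-mono h (ext eq s) = ext eq (Span-mono h s)
    Span-mono h (cancel u s) = cancel u (Span-mono h s)

    Span-∑ : ∀ {R C : Set} {B : Matrix R C} n {f : Fin n → C → ℤ} → (∀ i → Span B (f i)) → Span B
        (λ c → ∑ n (λ i → f i c))
    Span-∑ zero h = ext (λ c → sym (∑-empty _)) zero
    Span-∑ (suc n) h = ext (λ c → sym (∑-suc n _)) (add (h Fin.zero) (Span-∑ n (h ∘ Fin.suc)))

    Span-neg : ∀ {R C : Set} {B : Matrix R C} {x} → Span B x → Span B (λ c → - x c)
    Span-neg {x = x} s = ext (λ c → trans (sym (-‿distribˡ-* (pos 1) (x c))) (cong -_ (*-identityˡ _)))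
        (scale (- pos 1) s)

    Span-inj₁ : ∀ {R C R' C' : Set} {A : Matrix R C} {B : Matrix R' C'} {v} → Span A v → Span (A ⊞ B) [ v , const
        (pos 0) ]′
    Span-inj₁ (gen r) = gen (inj₁ r)
    Span-inj₁ zero = ext (λ { (inj₁ _) → refl ; (inj₂ _) → refl }) zero
    Span-inj₁ (add s t) = ext (λ { (inj₁ _) → refl ; (inj₂ _) → +-identityˡ _ }) (add (Span-inj₁ s) (Span-inj₁ t))
    Span-inj₁ (scale c s) = ext (λ { (inj₁ _) → refl ; (inj₂ _) → zeroʳ c }) (scale c (Span-inj₁ s))
    Span-inj₁ (ext eq s) = ext (λ { (inj₁ c) → eq c ; (inj₂ _) → refl }) (Span-inj₁ s)
    Span-inj₁ (cancel {u} unit s) = cancel unit (ext (λ { (inj₁ _) → refl ; (inj₂ _) → sym (zeroʳ u) }) (Span-inj₁ s))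

    Span-inj₂ : ∀ {R C R' C' : Set} {A : Matrix R C} {B : Matrix R' C'} {v} → Span B v → Span (A ⊞ B) [ const
        (pos 0) , v ]′
    Span-inj₂ (gen r) = gen (inj₂ r)
    Span-inj₂ zero = ext (λ { (inj₁ _) → refl ; (inj₂ _) → refl }) zero
    Span-inj₂ (add s t) = ext (λ { (inj₂ _) → refl ; (inj₁ _) → +-identityˡ _ }) (add (Span-inj₂ s) (Span-inj₂ t))
    Span-inj₂ (scale c s) = ext (λ { (inj₂ _) → refl ; (inj₁ _) → zeroʳ c }) (scale c (Span-inj₂ s))
    Span-inj₂ (ext eq s) = ext (λ { (inj₂ c) → eq c ; (inj₁ _) → refl }) (Span-inj₂ s)
    Span-inj₂ (cancel {u} unit s) = cancel unit (ext (λ { (inj₂ _) → refl ; (inj₁ _) → sym (zeroʳ u) }) (Span-inj₂ s))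

    infix 4 _≼_ _~_

    -- A ≼ B: over ℤ₍ₚ₎, A = U B V for some matrices U and V.
    data _≼_ : ∀ {R C R' C' : Set} → Matrix R C → Matrix R' C' → Set₁ where
      byRows : ∀ {R R' C : Set} {A : Matrix R C} {B : Matrix R' C} → (∀ r → Span B (A r)) → A ≼ B
      byCols : ∀ {R C C' : Set} {A : Matrix R C} {B : Matrix R C'} → (∀ c → Span (flip B) (flip A c)) → A ≼ B
      ≼-trans : ∀ {R C R' C' R'' C'' : Set} {A : Matrix R C} {B : Matrix R' C'} {D : Matrix R'' C''} → A ≼ B → B ≼ D → A ≼ D

    _~_ : ∀ {R C R' C' : Set} → Matrix R C → Matrix R' C' → Set₁
    A ~ B = A ≼ B × B ≼ A

    ~-trans : ∀ {R C R' C' R'' C'' : Set} {A : Matrix R C} {B : Matrix R' C'} {D : Matrix R'' C''} → A ~ B → B ~ D → A ~ D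
    ~-trans (f , g) (f' , g') = ≼-trans f f' , ≼-trans g' g

    ~-sym : ∀ {R C R' C' : Set} {A : Matrix R C} {B : Matrix R' C'} → A ~ B → B ~ A
    ~-sym (f , g) = g , f

    -- The maps are arbitrary, so rows and columns may be repeated or dropped. Two such pairs of
    -- maps, one in each direction, identify a matrix indexed by bases with one indexed by
    -- subspaces.
    ≼-reindex : ∀ {R C R' C' : Set} {A : Matrix R C} {B : Matrix R' C'} (φ : R → R') (ψ : C → C') →
      (∀ r c → A r c ≡ B (φ r) (ψ c)) → A ≼ B
    ≼-reindex {A = A} {B} φ ψ eq = ≼-trans {B = λ r c → B (φ r) c}
      (byCols (λ c → ext (λ r → sym (eq r c)) (gen (ψ c)))) (byRows (λ r → gen (φ r)))

    ~-refl : ∀ {R C : Set} {A : Matrix R C} → A ~ A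
    ~-refl = ≼-reindex id id (λ _ _ → refl) , ≼-reindex id id (λ _ _ → refl)

    ⊞-monoˡ : ∀ {R C R' C' R'' C'' : Set} {A : Matrix R C} {A' : Matrix R' C'}
        (B : Matrix R'' C'') → A ≼ A' → A ⊞ B ≼ A' ⊞ B
    ⊞-monoˡ B (byRows h) = byRows (λ { (inj₁ r) → Span-inj₁ (h r) ; (inj₂ r) → gen (inj₂ r) })
    ⊞-monoˡ B (byCols {A = A} {B = A'} h) = byCols (λ c → Span-mono {A = flip A' ⊞ flip B}
        (λ c' → ext (λ r → sym (flip-⊞ A' B c' r)) (gen c'))
      (ext (flip-⊞ A B c) (cols c)))
      where
      cols : ∀ c → Span (flip A' ⊞ flip B) ((flip A ⊞ flip B) c)
      cols (inj₁ c) = Span-inj₁ (h c)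
      cols (inj₂ c) = gen (inj₂ c)
    ⊞-monoˡ B (≼-trans f g) = ≼-trans (⊞-monoˡ B f) (⊞-monoˡ B g)

    ⊞-monoʳ : ∀ {R C R' C' R'' C'' : Set}
        (B : Matrix R'' C'') {A : Matrix R C} {A' : Matrix R' C'} → A ≼ A' → B ⊞ A ≼ B ⊞ A'
    ⊞-monoʳ B (byRows h) = byRows (λ { (inj₂ r) → Span-inj₂ (h r) ; (inj₁ r) → gen (inj₁ r) })
    ⊞-monoʳ B (byCols {A = A} {B = A'} h) = byCols (λ c → Span-mono {A = flip B ⊞ flip A'}
        (λ c' → ext (λ r → sym (flip-⊞ B A' c' r)) (gen c'))
      (ext (flip-⊞ B A c) (cols c)))
      where
      cols : ∀ c → Span (flip B ⊞ flip A') ((flip B ⊞ flip A) c)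
      cols (inj₂ c) = Span-inj₂ (h c)
      cols (inj₁ c) = gen (inj₁ c)
    ⊞-monoʳ B (≼-trans f g) = ≼-trans (⊞-monoʳ B f) (⊞-monoʳ B g)

    ⊞-cong : ∀ {R C R' C' S D S' D' : Set} {A : Matrix R C} {A' : Matrix R' C'} {B : Matrix S D} {B' : Matrix S' D'} →
      A ~ A' → B ~ B' → A ⊞ B ~ A' ⊞ B'
    ⊞-cong {A' = A'} {B} (f , g) (f' , g') =
      ≼-trans (⊞-monoˡ B f) (⊞-monoʳ A' f') , ≼-trans (⊞-monoʳ A' g') (⊞-monoˡ B g)

    -- All index tuples count, including those with repetitions, so the notion makes sense for
    -- unordered index types and passes along `≼`.
    MinorDiv : ∀ {R C : Set} → Matrix R C → ℕ → ℕ → Set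
    MinorDiv A k e = ∀ rs cs → P e ∣ Det k (submatrix A rs cs)

    MinorDiv-flip : ∀ {R C : Set} {A : Matrix R C} {k e} → MinorDiv A k e → MinorDiv (flip A) k e
    MinorDiv-flip {A = A} h rs cs = ∣-resp (Det-submatrix-flip A cs rs) (h cs rs)

    MinorDiv-rows : ∀ {R R' C : Set} {A : Matrix R C} {B : Matrix R' C} {k e} →
        (∀ r → Span B (A r)) → MinorDiv B k e → MinorDiv A k e
    MinorDiv-rows {A = A} {B} {k} span h rs cs = ∣-resp (sym (Det-submatrix A rs cs))
      (Multilinear-Span k (minor-multilinear k (lookup cs)) (λ rs' → ∣-resp (Det-submatrix B rs' cs) (h rs' cs))
          (spans rs))
      where
      spans : ∀ {k} (rs : Vec _ k) → All (Span B) (Vec.map A rs)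
      spans [] = []
      spans (r ∷ rs) = span r ∷ spans rs

    MinorDiv-≼ : ∀ {R C R' C' : Set} {A : Matrix R C} {B : Matrix R' C'} {k e} → A ≼ B → MinorDiv B k e → MinorDiv A k e
    MinorDiv-≼ (byRows h) d = MinorDiv-rows h d
    MinorDiv-≼ {A = A} {B} (byCols h) d = MinorDiv-flip {A = flip A} (MinorDiv-rows {A = flip A} {B = flip B} h
        (MinorDiv-flip {A = B} d))
    MinorDiv-≼ (≼-trans f g) d = MinorDiv-≼ f (MinorDiv-≼ g d)

    single : ℕ → Matrix ⊤ ⊤
    single e _ _ = P e

    -- Only the nonzero block of a Smith form: zero rows and columns are absorbed by `~`, and the
    -- length of the list is the rank.
    diag : (cs : List ℕ) → Matrix (Fin (length cs)) (Fin (length cs))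
    diag (c ∷ cs) Fin.zero Fin.zero = P c
    diag (c ∷ cs) Fin.zero (Fin.suc j) = pos 0
    diag (c ∷ cs) (Fin.suc i) Fin.zero = pos 0
    diag (c ∷ cs) (Fin.suc i) (Fin.suc j) = diag cs i j

    diag-cons : ∀ c cs → diag (c ∷ cs) ~ single c ⊞ diag cs
    diag-cons c cs = ≼-reindex to to to-eq , ≼-reindex from from from-eq
      where
      to : Fin (suc (length cs)) → ⊤ ⊎ Fin (length cs)
      to Fin.zero = inj₁ tt
      to (Fin.suc i) = inj₂ i
      from : ⊤ ⊎ Fin (length cs) → Fin (suc (length cs))
      from (inj₁ _) = Fin.zero
      from (inj₂ i) = Fin.suc i
      to-eq : ∀ i j → diag (c ∷ cs) i j ≡ (single c ⊞ diag cs) (to i) (to j)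
      to-eq Fin.zero Fin.zero = refl
      to-eq Fin.zero (Fin.suc j) = refl
      to-eq (Fin.suc i) Fin.zero = refl
      to-eq (Fin.suc i) (Fin.suc j) = refl
      from-eq : ∀ i j → (single c ⊞ diag cs) i j ≡ diag (c ∷ cs) (from i) (from j)
      from-eq (inj₁ _) (inj₁ _) = refl
      from-eq (inj₁ _) (inj₂ _) = refl
      from-eq (inj₂ _) (inj₁ _) = refl
      from-eq (inj₂ _) (inj₂ _) = refl

    diag-++ : ∀ xs ys → diag xs ⊞ diag ys ~ diag (xs ++ ys)
    diag-++ [] ys = ≼-reindex f f (λ { (inj₂ _) (inj₂ _) → refl }) , ≼-reindex inj₂ inj₂ (λ _ _ → refl)
      where
      f : Fin 0 ⊎ Fin (length ys) → Fin (length ys)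
      f (inj₂ i) = i
    diag-++ (x ∷ xs) ys = ~-trans (⊞-cong (diag-cons x xs) ~-refl) (~-trans assoc
      (~-trans (⊞-cong ~-refl (diag-++ xs ys)) (~-sym (diag-cons x (xs ++ ys)))))
      where
      assoc : (single x ⊞ diag xs) ⊞ diag ys ~ single x ⊞ (diag xs ⊞ diag ys)
      assoc = ≼-reindex to to to-eq , ≼-reindex from from from-eq
        where
        to : ∀ {X Y Z : Set} → (X ⊎ Y) ⊎ Z → X ⊎ (Y ⊎ Z)
        to (inj₁ (inj₁ i)) = inj₁ i
        to (inj₁ (inj₂ i)) = inj₂ (inj₁ i)
        to (inj₂ i) = inj₂ (inj₂ i)
        from : ∀ {X Y Z : Set} → X ⊎ (Y ⊎ Z) → (X ⊎ Y) ⊎ Z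
        from (inj₁ i) = inj₁ (inj₁ i)
        from (inj₂ (inj₁ i)) = inj₁ (inj₂ i)
        from (inj₂ (inj₂ i)) = inj₂ i
        to-eq : ∀ i j → ((single x ⊞ diag xs) ⊞ diag ys) i j ≡ (single x ⊞ (diag xs ⊞ diag ys)) (to i) (to j)
        to-eq (inj₁ (inj₁ _)) (inj₁ (inj₁ _)) = refl
        to-eq (inj₁ (inj₁ _)) (inj₁ (inj₂ _)) = refl
        to-eq (inj₁ (inj₁ _)) (inj₂ _) = refl
        to-eq (inj₁ (inj₂ _)) (inj₁ (inj₁ _)) = refl
        to-eq (inj₁ (inj₂ _)) (inj₁ (inj₂ _)) = refl
        to-eq (inj₁ (inj₂ _)) (inj₂ _) = refl
        to-eq (inj₂ _) (inj₁ (inj₁ _)) = refl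
        to-eq (inj₂ _) (inj₁ (inj₂ _)) = refl
        to-eq (inj₂ _) (inj₂ _) = refl
        to-from : ∀ {X Y Z : Set} (i : X ⊎ (Y ⊎ Z)) → to (from i) ≡ i
        to-from (inj₁ _) = refl
        to-from (inj₂ (inj₁ _)) = refl
        to-from (inj₂ (inj₂ _)) = refl
        from-eq : ∀ i j → (single x ⊞ (diag xs ⊞ diag ys)) i j ≡ ((single x ⊞ diag xs) ⊞ diag ys) (from i) (from j)
        from-eq i j = trans (sym (cong₂ (single x ⊞ (diag xs ⊞ diag ys)) (to-from i) (to-from j)))
            (sym (to-eq (from i) (from j)))

    diag-↭ : ∀ {xs ys} → xs ↭ ys → diag xs ~ diag ys
    diag-↭ _↭_.refl = ~-refl
    diag-↭ (_↭_.prep x r) = ~-trans (diag-cons x _) (~-trans (⊞-cong ~-refl (diag-↭ r)) (~-sym (diag-cons x _)))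
    diag-↭ (_↭_.swap {xs} x y r) = ~-trans (exchange x y xs , exchange y x xs)
      (~-trans (diag-cons y _) (~-trans (⊞-cong ~-refl (~-trans (diag-cons x _) (~-trans (⊞-cong ~-refl (diag-↭ r))
          (~-sym (diag-cons x _)))))
        (~-sym (diag-cons y _))))
      where
      σ : ∀ {n} → Fin (suc (suc n)) → Fin (suc (suc n))
      σ Fin.zero = Fin.suc Fin.zero
      σ (Fin.suc Fin.zero) = Fin.zero
      σ (Fin.suc (Fin.suc i)) = Fin.suc (Fin.suc i)
      exchange : ∀ x y zs → diag (x ∷ y ∷ zs) ≼ diag (y ∷ x ∷ zs)
      exchange x y zs = ≼-reindex σ σ eq
        where
        eq : ∀ i j → diag (x ∷ y ∷ zs) i j ≡ diag (y ∷ x ∷ zs) (σ i) (σ j)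
        eq Fin.zero Fin.zero = refl
        eq Fin.zero (Fin.suc Fin.zero) = refl
        eq Fin.zero (Fin.suc (Fin.suc j)) = refl
        eq (Fin.suc Fin.zero) Fin.zero = refl
        eq (Fin.suc Fin.zero) (Fin.suc Fin.zero) = refl
        eq (Fin.suc Fin.zero) (Fin.suc (Fin.suc j)) = refl
        eq (Fin.suc (Fin.suc i)) Fin.zero = refl
        eq (Fin.suc (Fin.suc i)) (Fin.suc Fin.zero) = refl
        eq (Fin.suc (Fin.suc i)) (Fin.suc (Fin.suc j)) = refl
    diag-↭ (_↭_.trans r s) = ~-trans (diag-↭ r) (diag-↭ s)

  -- Smith normal form and invariant factors

  module SmithNormalForm (p : ℕ) (prime : Prime p) where
    open Local p prime

    -- An entry p ^ e · B i j of minimal p-adic valuation.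
    record Pivot {R C} (A : Matrix (Fin R) (Fin C)) : Set where
      field
        e : ℕ
        B : Matrix (Fin R) (Fin C)
        factor : ∀ x y → A x y ≡ P e * B x y
        i : Fin R
        j : Fin C
        unit : Unit (B i j)

    P-zero : P 0 ≡ pos 1
    P-zero = P-def 0

    P-suc : ∀ e → P (suc e) ≡ pos p * P e
    P-suc e = trans (P-+ 1 e) (cong (_* P e) (trans (P-def 1) (cong pos (ℕₚ.^-identityʳ p))))

    pivot : ∀ {R C} (A : Matrix (Fin R) (Fin C)) → (∀ x y → A x y ≡ pos 0) ⊎ Pivot A
    pivot {R} {C} A with Finₚ.all? (λ x → Finₚ.all? (λ y → A x y ℤ.≟ pos 0))
    ... | yes z = inj₁ z
    ... | no ¬z with Finₚ.¬∀⟶∃¬ R _ (λ x → Finₚ.all? (λ y → A x y ℤ.≟ pos 0)) ¬z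
    ... | x₀ , ¬z' with Finₚ.¬∀⟶∃¬ C _ (λ y → A x₀ y ℤ.≟ pos 0) ¬z'
    ... | y₀ , nz = inj₂ (search (suc ∣ A x₀ y₀ ∣) 0 (λ x y → A x y , trans (sym (*-identityʳ _))
        (cong (A x y *_) (sym P-zero))) (ℕₚ.n<1+n _))
      where
      -- Throughout, e + f exceeds the absolute value of the nonzero entry at (x₀ , y₀). When the
      -- fuel is gone, p^e would be a divisor larger than that entry.
      search : ∀ f e → (∀ x y → P e ∣ A x y) → ∣ A x₀ y₀ ∣ < e ℕ.+ f → Pivot A
      search zero e d lt = ⊥-elim (ℕₚ.<⇒≱ (ℕₚ.<-trans lt (subst (_< p ^ e) (sym (ℕₚ.+-identityʳ e)) (n<p^n e)))
        (ℕ∣.∣⇒≤ ⦃ ℕ.≢-nonZero (nz ∘ ℤₚ.∣i∣≡0⇒i≡0) ⦄ (P∣⇒ℕ∣ (d x₀ y₀))))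
      search (suc f) e d lt with Finₚ.all? (λ x → Finₚ.all? (λ y → P∣? (suc e) (A x y)))
      ... | yes d' = search f (suc e) d' (subst (∣ A x₀ y₀ ∣ <_) (ℕₚ.+-suc e f) lt)
      ... | no ¬d with Finₚ.¬∀⟶∃¬ R _ (λ x → Finₚ.all? (λ y → P∣? (suc e) (A x y))) ¬d
      ... | i , ¬d' with Finₚ.¬∀⟶∃¬ C _ (λ y → P∣? (suc e) (A i y)) ¬d'
      ... | j , ¬p = record { e = e ; B = λ x y → proj₁ (d x y) ; factor = λ x y → trans (proj₂ (d x y)) (*-comm _ _)
                            ; i = i ; j = j ; unit = λ { (k , eq) → ¬p (k , trans (proj₂ (d i j))
                                (trans (cong (_* P e) eq) (trans (*-assoc k _ _) (cong (k *_) (sym (P-suc e)))))) } }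

    -- The Schur complement of the pivot, multiplied by the unit B i j to stay integral.
    schur : ∀ {R C} {A : Matrix (Fin (suc R)) (Fin C)} → Pivot A → Matrix (Fin R) (Fin C)
    schur {A = A} π x y = B i j * A (punchIn i x) y + - (B (punchIn i x) j * A i y)
      where open Pivot π

    -- All entries are multiples of p^e, so the pivot clears its row by integer column operations.
    -- Clearing its column would need division by `B i j`; the other rows are multiplied by this
    -- unit instead, and `cancel` undoes it.
    pivot-split : ∀ {R C} {A : Matrix (Fin (suc R)) (Fin C)} (π : Pivot A) → A ~ single (Pivot.e π) ⊞ schur π
    pivot-split {R} {C} {A} π = ≼-trans (byRows A≼N) (byCols N≼D) , ≼-trans (byCols D≼N) (byRows N≼A)
      where
      open Pivot π
      N : Matrix (⊤ ⊎ Fin R) (Fin C)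
      N (inj₁ _) y = A i y
      N (inj₂ x) y = schur π x y
      A≼N : ∀ x → Span N (A x)
      A≼N x with i Fin.≟ x
      ... | yes refl = gen (inj₁ tt)
      ... | no i≢x = subst (λ z → Span N (A z)) (Finₚ.punchIn-punchOut i≢x) (cancel unit
        (ext (λ y → solve 2 (λ s t → (s :+ :- t) :+ t := s) refl _ _)
          (add (gen (inj₂ (punchOut i≢x))) (scale (B (punchIn i (punchOut i≢x)) j) (gen (inj₁ tt))))))
      N≼A : ∀ x → Span A (N x)
      N≼A (inj₁ _) = gen i
      N≼A (inj₂ x) = add (scale (B i j) (gen (punchIn i x))) (Span-neg (scale (B (punchIn i x) j) (gen i)))
      D : Matrix (⊤ ⊎ Fin R) (⊤ ⊎ Fin C)
      D = single e ⊞ schur π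
      N≼D : ∀ y → Span (flip D) (flip N y)
      N≼D y = ext (λ { (inj₁ _) → trans (+-identityʳ _) (trans (*-comm _ _) (sym (factor i y)))
                     ; (inj₂ x) → trans (cong (_+ schur π x y) (zeroʳ _)) (+-identityˡ _) })
        (add (scale (B i y) (gen (inj₁ tt))) (gen (inj₂ y)))
      -- The Schur complement vanishes in column j, so this column of N is `B i j` times the wanted
      -- one.
      first : Span (flip N) (flip D (inj₁ tt))
      first = cancel unit (ext (λ { (inj₁ _) → trans (factor i j) (*-comm _ _)
                                  ; (inj₂ x) → trans (cong₂ (λ s t → B i j * s + - (B (punchIn i x) j * t))
                                      (factor _ j) (factor i j))
                                      (solve 3 (λ b q c → b :* (q :* c) :+ :- (c :* (q :* b)) := b :* con (pos 0)) refl
                                          (B i j) (P e) (B (punchIn i x) j)) })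
        (gen j))
      D≼N : ∀ y → Span (flip N) (flip D y)
      D≼N (inj₁ _) = first
      D≼N (inj₂ y) = ext (λ { (inj₁ _) → trans (cong₂ (λ s t → s + - t) (factor i y) (*-comm (B i y) (P e)))
          (-‿inverseʳ _)
                            ; (inj₂ x) → trans (cong (λ z → schur π x y + - z) (zeroʳ (B i y)))
                                (trans (cong (schur π x y +_) -0#≈0#) (+-identityʳ _)) })
        (add (gen y) (Span-neg (scale (B i y) first)))

    smith : ∀ {R C} (A : Matrix (Fin R) (Fin C)) → ∃ λ cs → A ~ diag cs
    smith {zero} A = [] , byCols (λ c → ext (λ ()) zero) , byCols (λ ())
    smith {suc R} A with pivot A
    -- A zero matrix reaches the empty diagonal by way of the matrix with no rows.
    ... | inj₁ z = [] , ≼-trans {B = λ (x : Fin 0) → A Fin.zero} (byRows (λ r → ext (λ c → sym (z r c)) zero))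
                          (byCols (λ c → ext (λ ()) zero)) , ≼-trans {B = λ (x : Fin 0) → A Fin.zero} (byCols λ ())
                              (byRows λ ())
    ... | inj₂ π with smith (schur π)
    ... | cs , eq = Pivot.e π ∷ cs , ~-trans (pivot-split π) (~-trans (⊞-cong ~-refl eq)
        (~-sym (diag-cons (Pivot.e π) cs)))

  -- Multiplicities as differences of determinantal exponents

  sumN : (ℕ → ℕ) → ℕ → ℕ
  sumN h zero = 0
  sumN h (suc n) = h n ℕ.+ sumN h n

  recSum : (g h : ℕ → ℕ) → g 0 ≡ 0 → (∀ k → g (suc k) ≡ h k ℕ.+ g k) → ∀ n → g n ≡ sumN h n
  recSum g h z s zero = z
  recSum g h z s (suc n) = trans (s n) (cong (h n ℕ.+_) (recSum g h z s n))

  tick : ℕ → ℕ → ℕ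
  tick c α with c ℕ.≟ α
  ... | yes _ = 1
  ... | no _ = 0

  slope : Maybe ℕ → Maybe ℕ → ℕ → ℕ
  slope (just a) (just b) α = tick (a ℕ.∸ b) α
  slope _ _ α = 0

  -- The local functions of invMult and detDivExp cannot be named here, so g is left to unification.
  invMult-sum : ∀ {R C} p (A : Fin R → Fin C → ℤ) α →
    invMult p A α ≡ sumN (λ k → slope (detDivExp p A (suc k)) (detDivExp p A k) α) (R ℕ.⊓ C)
  invMult-sum {R} {C} p A α = trans unfold (recSum g _ refl step (R ℕ.⊓ C))
    where
    g : ℕ → ℕ
    g = _
    unfold : invMult p A α ≡ g (R ℕ.⊓ C)
    unfold with R ℕ.⊓ C
    ... | w = refl
    step : ∀ k → g (suc k) ≡ slope (detDivExp p A (suc k)) (detDivExp p A k) α ℕ.+ g k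
    step k with detDivExp p A (suc k) | detDivExp p A k
    ... | just a | just b with (a ℕ.∸ b) ℕ.≟ α
    ... | yes _ = refl
    ... | no _ = refl
    step k | just a | nothing = refl
    step k | nothing | _ = refl

  minVal : ℕ → List ℤ → Maybe ℕ
  minVal p [] = nothing
  minVal p (z ∷ zs) with ∣ z ∣
  ... | zero = minVal p zs
  ... | suc m = minMaybe (just (val p (suc m))) (minVal p zs)

  detDivExp-minVal : ∀ {R C} p (A : Fin R → Fin C → ℤ) k → detDivExp p A k ≡ minVal p (minors A k)
  detDivExp-minVal p A k = trans unfold (go (minors A k))
    where
    g : List ℤ → Maybe ℕ
    g = _
    unfold : detDivExp p A k ≡ g (minors A k)
    unfold with minors A k
    ... | w = refl
    go : ∀ zs → g zs ≡ minVal p zs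
    go [] = refl
    go (z ∷ zs) with ∣ z ∣
    ... | zero = go zs
    ... | suc m = cong (minMaybe (just (val p (suc m)))) (go zs)

  subsets-empty : ∀ {k n} → n < k → subsets k n ≡ []
  subsets-empty {suc k} {zero} lt = refl
  subsets-empty {suc k} {suc n} (s≤s lt) rewrite subsets-empty lt | subsets-empty (ℕₚ.m≤n⇒m≤1+n lt) = refl

  module Invariants (p : ℕ) (prime : Prime p) where
    open Local p prime
    open SmithNormalForm p prime

    -- For sorted cs and k at most its length, the valuation of the k-th determinantal divisor of
    -- `diag cs`.
    prefixSum : ℕ → List ℕ → ℕ
    prefixSum zero cs = 0
    prefixSum (suc k) [] = 0
    prefixSum (suc k) (c ∷ cs) = c ℕ.+ prefixSum k cs

    indexSum : ∀ cs {k} → Vec (Fin (length cs)) k → ℕ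
    indexSum cs rs = Vec.sum (Vec.map (List.lookup cs) rs)

    δ : ∀ {n} → Fin n → Fin n → ℤ
    δ Fin.zero Fin.zero = pos 1
    δ Fin.zero (Fin.suc j) = pos 0
    δ (Fin.suc i) Fin.zero = pos 0
    δ (Fin.suc i) (Fin.suc j) = δ i j

    diag-δ : ∀ cs i j → diag cs i j ≡ P (List.lookup cs i) * δ i j
    diag-δ (c ∷ cs) Fin.zero Fin.zero = sym (*-identityʳ _)
    diag-δ (c ∷ cs) Fin.zero (Fin.suc j) = sym (zeroʳ _)
    diag-δ (c ∷ cs) (Fin.suc i) Fin.zero = sym (zeroʳ _)
    diag-δ (c ∷ cs) (Fin.suc i) (Fin.suc j) = diag-δ cs i j

    Det-scale-rows : ∀ cs k (rs : Vec (Fin (length cs)) k) (X : Fin k → Fin k → ℤ) →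
      Det k (λ a b → P (List.lookup cs (lookup rs a)) * X a b) ≡ P (indexSum cs rs) * Det k X
    Det-scale-rows cs zero [] X = trans (Det-zero _) (trans (sym (*-identityˡ _)) (sym (cong₂ _*_ P-zero (Det-zero X))))
    Det-scale-rows cs (suc k) (r ∷ rs) X = trans (Det-row k _) (trans
      (∑-cong (suc k) (λ j → trans (cong (λ z → sg j * ((P (List.lookup cs r) * X Fin.zero j) * z))
          (Det-scale-rows cs k rs _))
        (trans (solve 5 (λ s u x v d → s :* ((u :* x) :* (v :* d)) := (u :* v) :* (s :* (x :* d))) refl (sg j) _ _ _ _)
          (cong (_* (sg j * (X Fin.zero j * Det k (λ a b → X (Fin.suc a) (punchIn j b)))))
              (sym (P-+ (List.lookup cs r) (indexSum cs rs)))))))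
      (trans (sym (*-distribˡ-∑ (suc k) _ _)) (cong (P (indexSum cs (r ∷ rs)) *_) (sym (Det-row k X)))))

    Sorted : List ℕ → Set
    Sorted = AllPairs _≤_

    -- Covers index tuples that skip the head of c ∷ cs: shifting a window of a sorted list by one
    -- place increases it term by term.
    prefixSum-step : ∀ c k cs → ListAll.All
        (c ≤_) cs → Sorted cs → suc k ≤ length cs → c ℕ.+ prefixSum k cs ≤ prefixSum (suc k) cs
    prefixSum-step c zero (d ∷ cs) (le ∷ _) _ _ = ℕₚ.+-monoˡ-≤ 0 le
    prefixSum-step c (suc k) (d ∷ cs) (_ ∷ les) (_ ∷ sorted) (s≤s len) = begin
      c ℕ.+ (d ℕ.+ prefixSum k cs)   ≡⟨ ℕₚ.+-assoc c d _ ⟨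
      (c ℕ.+ d) ℕ.+ prefixSum k cs   ≡⟨ cong (ℕ._+ prefixSum k cs) (ℕₚ.+-comm c d) ⟩
      (d ℕ.+ c) ℕ.+ prefixSum k cs   ≡⟨ ℕₚ.+-assoc d c _ ⟩
      d ℕ.+ (c ℕ.+ prefixSum k cs)   ≤⟨ ℕₚ.+-monoʳ-≤ d (prefixSum-step c k cs les sorted len) ⟩
      d ℕ.+ prefixSum (suc k) cs     ∎
      where open ℕₚ.≤-Reasoning

    indexSum-suc : ∀ c cs {k} (v : Vec (Fin (length cs)) k) → indexSum (c ∷ cs) (Vec.map Fin.suc v) ≡ indexSum cs v
    indexSum-suc c cs [] = refl
    indexSum-suc c cs (x ∷ v) = cong (List.lookup cs x ℕ.+_) (indexSum-suc c cs v)

    prefixSum-minimal : ∀ cs → Sorted cs → ∀ k v → v ∈ subsets k (length cs) → prefixSum k cs ≤ indexSum cs v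
    prefixSum-minimal cs sorted zero v i = z≤n
    prefixSum-minimal (c ∷ cs) (les ∷ sorted) (suc k) v i
      with ∈-++⁻ (List.map (λ v → Fin.zero ∷ Vec.map Fin.suc v) (subsets k (length cs))) i
    ... | inj₁ l with ∈-map⁻ _ l
    ... | w , m , refl = ℕₚ.+-monoʳ-≤ c (subst (prefixSum k cs ≤_) (sym (indexSum-suc c cs w))
        (prefixSum-minimal cs sorted k w m))
    prefixSum-minimal (c ∷ cs) (les ∷ sorted) (suc k) v i | inj₂ l with ∈-map⁻ _ l
    ... | w , m , refl with suc k ℕ.≤? length cs
    ... | yes len = ℕₚ.≤-trans (prefixSum-step c k cs les sorted len)
            (subst (prefixSum (suc k) cs ≤_) (sym (indexSum-suc c cs w)) (prefixSum-minimal cs sorted (suc k) w m))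
    ... | no ¬len with subsets (suc k) (length cs) | subsets-empty (ℕₚ.≰⇒> ¬len)
    prefixSum-minimal (c ∷ cs) (les ∷ sorted) (suc k) v i | inj₂ l | w , () , refl | no ¬len | .[] | refl

    diag-MinorDiv : ∀ cs → Sorted cs → ∀ k → MinorDiv (diag cs) k (prefixSum k cs)
    diag-MinorDiv cs sorted k rs cols = increasing-rows-∣ (diag cs) cols (λ v i →
      ∣-resp (sym (trans (Det-cong k (λ a b → diag-δ cs (lookup v a) (lookup cols b))) (Det-scale-rows cs k v _)))
        (P-mono (prefixSum-minimal cs sorted k v i) (Det k _ , *-comm _ _))) rs

    -- There is no increasing tuple of that length, so the minors vanish; divisibility by every
    -- power of p is the form of this that passes along `≼`.
    diag-MinorDiv-beyond : ∀ cs {k} → length cs < k → ∀ e → MinorDiv (diag cs) k e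
    diag-MinorDiv-beyond cs {k} lt e rs cols = increasing-rows-∣ (diag cs) cols absurd rs
      where
      absurd : ∀ v → v ∈ subsets k (length cs) → P e ∣ Det k (submatrix (diag cs) v cols)
      absurd v i with subsets k (length cs) | subsets-empty lt
      absurd v () | .[] | refl

    leading : ∀ (cs : List ℕ) k → k ≤ length cs → Vec (Fin (length cs)) k
    leading cs zero le = []
    leading (c ∷ cs) (suc k) (s≤s le) = Fin.zero ∷ Vec.map Fin.suc (leading cs k le)

    Det-leading : ∀ cs k (le : k ≤ length cs) → Det k (submatrix (diag cs) (leading cs k le) (leading cs k le)) ≡ P
        (prefixSum k cs)
    Det-leading cs zero le = trans (Det-zero _) (sym P-zero)
    Det-leading (c ∷ cs) (suc k) (s≤s le) = trans (Det-row k _) (trans (∑-suc k _) (trans (cong₂ _+_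
        (trans (cong₂ _*_ sg-zero (cong (P c *_)
            (trans (Det-cong k (λ a b → cong₂ (diag (c ∷ cs)) (Vecₚ.lookup-map a Fin.suc v)
            (Vecₚ.lookup-map b Fin.suc v))) (Det-leading cs k le))))
          (trans (*-identityˡ _) (sym (P-+ c _))))
        (∑-zero k (λ j → trans (cong (sg (Fin.suc j) *_) (cong₂ _*_ (cong (diag (c ∷ cs) Fin.zero)
            (Vecₚ.lookup-map j Fin.suc v)) refl))
          (trans (cong (sg (Fin.suc j) *_) (zeroˡ _)) (zeroʳ _)))))
      (+-identityʳ _)))
      where
      v : Vec (Fin (length cs)) k
      v = leading cs k le

    -- The leading k-minor is exactly p to the prefix sum, so the lower bound of `diag-MinorDiv` is
    -- attained.
    diag-MinorDiv-≤ : ∀ cs {k e} → k ≤ length cs → MinorDiv (diag cs) k e → e ≤ prefixSum k cs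
    diag-MinorDiv-≤ cs {k} le h = P-≤ (∣-resp (Det-leading cs k le) (h (leading cs k le) (leading cs k le)))

    valAux-spec : ∀ f m .{{_ : NonZero m}} → m ≤ f → p ^ valAux f p m ℕ∣.∣ m × ¬ p ^ suc (valAux f p m) ℕ∣.∣ m
    -- `valAux` matches on the base as suc (suc _), so the claim is proved for every base above 1,
    -- where this match is available.
    valAux-spec = go p (ℕ.nonTrivial⇒n>1 p ⦃ prime⇒nonTrivial prime ⦄)
      where
      go : ∀ p → 1 < p → ∀ f m .{{_ : NonZero m}} → m ≤ f → p ^ valAux f p m ℕ∣.∣ m × ¬ p ^ suc (valAux f p m) ℕ∣.∣ m
      go (suc zero) (s≤s ())
      go (suc (suc p)) _ (suc f) (suc m) le with suc m % suc (suc p) in eq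
      ... | suc _ = ℕ∣.1∣ _ , λ d → case (trans (sym eq) (ℕ∣.n∣m⇒m%n≡0 (suc m) (suc (suc p)) (subst (ℕ∣._∣ suc m)
          (ℕₚ.^-identityʳ (suc (suc p))) d)))
        where
        case : ∀ {n} → suc n ≡ 0 → ⊥
        case ()
      ... | zero with suc m / suc (suc p) in eq'
      ... | zero = ⊥-elim (case (trans (sym (m/n*n≡m (ℕ∣.m%n≡0⇒n∣m (suc m) (suc (suc p)) eq)))
          (cong (ℕ._* suc (suc p)) eq')))
        where
        case : ∀ {n} → suc n ≡ 0 → ⊥
        case ()
      ... | suc d with go (suc (suc p)) (s≤s (s≤s z≤n)) f (suc d)
          (ℕₚ.≤-pred (ℕₚ.≤-trans (subst (_< suc m) eq' (m/n<m (suc m) (suc (suc p)) (s≤s (s≤s z≤n)))) le))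
      ... | yes∣ , no∣ = subst (ℕ∣._∣_ _) prod (ℕ∣.*-monoʳ-∣ (suc (suc p)) yes∣) ,
                         λ h → no∣ (ℕ∣.*-cancelˡ-∣ (suc (suc p)) (subst (ℕ∣._∣_ _) (sym prod) h))
        where
        prod : suc (suc p) ℕ.* suc d ≡ suc m
        prod = trans (ℕₚ.*-comm (suc (suc p)) (suc d)) (trans (cong (ℕ._* suc (suc p)) (sym eq'))
            (m/n*n≡m (ℕ∣.m%n≡0⇒n∣m (suc m) (suc (suc p)) eq)))

    -- Describes the minimum by divisibility alone, since that is what equivalences transport.
    data MinValSpec (zs : List ℤ) : Maybe ℕ → Set where
      allZero : (∀ z → z ∈ zs → z ≡ pos 0) → MinValSpec zs nothing
      attained : ∀ e → (∀ z → z ∈ zs → P e ∣ z) → (∃ λ z → z ∈ zs × ¬ P (suc e) ∣ z) → MinValSpec zs (just e)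

    minVal-spec : ∀ zs → MinValSpec zs (minVal p zs)
    minVal-spec [] = allZero (λ z ())
    minVal-spec (z ∷ zs) with ∣ z ∣ in eq
    minVal-spec (z ∷ zs) | zero with minVal p zs | minVal-spec zs
    ... | _ | allZero h = allZero (λ { _ (here refl) → ℤₚ.∣i∣≡0⇒i≡0 eq ; y (there i) → h y i })
    ... | _ | attained e h (y , i , n) = attained e
      (λ { _ (here refl) → ∣-resp (sym (ℤₚ.∣i∣≡0⇒i≡0 eq)) ∣-zero ; y (there i) → h y i }) (y , there i , n)
    minVal-spec (z ∷ zs) | suc m with valAux-spec (suc m) (suc m) ℕₚ.≤-refl | minVal p zs | minVal-spec zs
    ... | d , n | _ | allZero h = attained _
        (λ { _ (here refl) → ℕ∣⇒P∣ (subst (ℕ∣._∣_ _) (sym eq) d) ; y (there i) → ∣-resp (sym (h y i)) ∣-zero })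
        (z , here refl , λ h' → n (subst (ℕ∣._∣_ _) eq (P∣⇒ℕ∣ h')))
    ... | d , n | _ | attained e h (y , i , n') = attained _
        (λ { _ (here refl) → P-mono (ℕₚ.m⊓n≤m v e) (ℕ∣⇒P∣ (subst (ℕ∣._∣_ _) (sym eq) d)) ; y (there i) → P-mono
            (ℕₚ.m⊓n≤n v e) (h y i) })
        witness
      where
      v : ℕ
      v = val p (suc m)
      witness : ∃ λ y → y ∈ (z ∷ zs) × ¬ P (suc (v ℕ.⊓ e)) ∣ y
      witness with ℕₚ.≤-total v e
      ... | inj₁ le = z , here refl , λ h' → n (subst (ℕ∣._∣_ _) eq
          (P∣⇒ℕ∣ (subst (λ k → P (suc k) ∣ z) (ℕₚ.m≤n⇒m⊓n≡m le) h')))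
      ... | inj₂ le = y , there i , λ h' → n' (subst (λ k → P (suc k) ∣ y) (ℕₚ.m≥n⇒m⊓n≡n le) h')

    minors-∈ : ∀ {R C} (A : Matrix (Fin R) (Fin C)) k {rs cs} → rs ∈ subsets k R → cs ∈ subsets k C →
      det k (submatrix A rs cs) ∈ minors A k
    minors-∈ {R} {C} A k {rs} i j = ∈-concatMap⁺ (λ rs → List.map (λ cs → det k (submatrix A rs cs))
        (subsets k C)) {xs = subsets k R} (lose i (∈-map⁺ (λ cs → det k (submatrix A rs cs)) j))

    ∈-minors : ∀ {R C} (A : Matrix (Fin R) (Fin C)) k {z} → z ∈ minors A k → ∃ λ rs → ∃ λ cs → z ≡ det k
        (submatrix A rs cs)
    ∈-minors {R} {C} A k i with find (∈-concatMap⁻ (λ rs → List.map (λ cs → det k (submatrix A rs cs))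
        (subsets k C)) {xs = subsets k R} i)
    ... | rs , _ , j with ∈-map⁻ (λ cs → det k (submatrix A rs cs)) {xs = subsets k C} j
    ... | cs , _ , eq = rs , cs , eq

    -- The two halves of `A ~ diag cs` give the two inequalities: `f` carries the divisibility of
    -- diagonal minors to A, and `g` carries any common power of p in the minors of A back to the
    -- leading diagonal minor.
    detDivExp-just : ∀ {R C} {A : Matrix (Fin R) (Fin C)} {cs} → A ~ diag cs → Sorted cs → ∀ {k} → k ≤ length cs →
      detDivExp p A k ≡ just (prefixSum k cs)
    detDivExp-just {A = A} {cs} (f , g) sorted {k} le = trans (detDivExp-minVal p A k) (pin (minVal-spec (minors A k)))
      where
      exact : ∀ e → (∀ z → z ∈ minors A k → P e ∣ z) → e ≤ prefixSum k cs
      exact e h = diag-MinorDiv-≤ cs le (MinorDiv-≼ g (increasing-∣ A k (λ rs cs i j → ∣-resp (Det-def k _)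
          (h _ (minors-∈ A k i j)))))
      pin : ∀ {m} → MinValSpec (minors A k) m → m ≡ just (prefixSum k cs)
      pin (allZero h) = ⊥-elim (ℕₚ.<-irrefl refl (exact (suc (prefixSum k cs)) (λ z i → ∣-resp (sym (h z i)) ∣-zero)))
      pin (attained e h (z , i , n)) = cong just (ℕₚ.≤-antisym (exact e h) (ℕₚ.≮⇒≥ (λ lt → n (P-mono lt (all z i)))))
        where
        all : ∀ z → z ∈ minors A k → P (prefixSum k cs) ∣ z
        all z i with ∈-minors A k i
        ... | rs , cols , refl = ∣-resp (sym (Det-def k _)) (MinorDiv-≼ f (diag-MinorDiv cs sorted k) rs cols)

    detDivExp-nothing : ∀ {R C} {A : Matrix (Fin R)
        (Fin C)} {cs} → A ~ diag cs → ∀ {k} → length cs < k → detDivExp p A k ≡ nothing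
    detDivExp-nothing {A = A} {cs} (f , g) {k} lt = trans (detDivExp-minVal p A k) (pin (minVal-spec (minors A k)))
      where
      pin : ∀ {m} → MinValSpec (minors A k) m → m ≡ nothing
      pin (allZero h) = refl
      pin (attained e h (z , i , n)) with ∈-minors A k i
      ... | rs , cols , refl = ⊥-elim (n (∣-resp (sym (Det-def k _)) (MinorDiv-≼ f (diag-MinorDiv-beyond cs lt
          (suc e)) rs cols)))

    -- With too few rows or columns there would be no minors of size `length cs`, although their
    -- exponent is finite.
    length-≤ : ∀ {R C} {A : Matrix (Fin R) (Fin C)} {cs} → A ~ diag cs → Sorted cs → length cs ≤ R ℕ.⊓ C
    length-≤ {R} {C} {A} {cs} eq sorted = ℕₚ.⊓-glb (ℕₚ.≮⇒≥ noRows) (ℕₚ.≮⇒≥ noCols)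
      where
      k : ℕ
      k = length cs
      contra : minors A k ≡ [] → ⊥
      contra e with trans (sym (detDivExp-just eq sorted ℕₚ.≤-refl)) (trans (detDivExp-minVal p A k)
          (cong (minVal p) e))
      ... | ()
      noRows : ¬ R < k
      noRows lt = contra (cong (List.concatMap (λ rs → List.map (λ cols → det k (submatrix A rs cols)) (subsets k C)))
          (subsets-empty lt))
      noCols : ¬ C < k
      noCols lt = contra (trans
        (cong (λ xs → List.concatMap (λ rs → List.map (λ cols → det k (submatrix A rs cols)) xs) (subsets k R))
            (subsets-empty lt))
        (concatMap-[] (subsets k R)))
        where
        concatMap-[] : ∀ {X Y : Set} (xs : List X) → List.concatMap {B = Y} (λ _ → []) xs ≡ []
        concatMap-[] [] = refl
        concatMap-[] (x ∷ xs) = concatMap-[] xs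

    count : ℕ → List ℕ → ℕ
    count α [] = 0
    count α (c ∷ cs) = tick c α ℕ.+ count α cs

    count-++ : ∀ α xs ys → count α (xs ++ ys) ≡ count α xs ℕ.+ count α ys
    count-++ α [] ys = refl
    count-++ α (x ∷ xs) ys = trans (cong (tick x α ℕ.+_) (count-++ α xs ys)) (sym (ℕₚ.+-assoc (tick x α) _ _))

    count-↭ : ∀ α {xs ys} → xs ↭ ys → count α xs ≡ count α ys
    count-↭ α _↭_.refl = refl
    count-↭ α (_↭_.prep x r) = cong (tick x α ℕ.+_) (count-↭ α r)
    count-↭ α (_↭_.swap x y r) = trans (cong (λ z → tick x α ℕ.+ (tick y α ℕ.+ z)) (count-↭ α r))
      (trans (sym (ℕₚ.+-assoc (tick x α) (tick y α) _)) (trans (cong₂ ℕ._+_ (ℕₚ.+-comm (tick x α) (tick y α)) refl)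
          (ℕₚ.+-assoc (tick y α) (tick x α) _)))
    count-↭ α (_↭_.trans r s) = trans (count-↭ α r) (count-↭ α s)

    -- The offset d stands for the entries already removed from the list; it cancels in every
    -- difference and makes the induction possible.
    slopeSum-count : ∀ α d cs (h : ℕ → ℕ) → (∀ k → k < length cs → h k ≡ slope (just (d ℕ.+ prefixSum (suc k) cs))
        (just (d ℕ.+ prefixSum k cs)) α) →
      sumN h (length cs) ≡ count α cs
    slopeSum-count α d [] h eq = refl
    slopeSum-count α d (c ∷ cs) h eq = trans (sumN-suc h (length cs)) (trans
        (cong₂ ℕ._+_ (trans (eq 0 (s≤s z≤n)) (cong (λ z → slope (just z) (just (d ℕ.+ 0)) α)
            (cong (d ℕ.+_) (ℕₚ.+-identityʳ c))))
          (slopeSum-count α (d ℕ.+ c) cs (h ∘ suc) (λ k lt → trans (eq (suc k) (s≤s lt))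
            (cong₂ (λ x y → slope (just x) (just y) α) (sym (ℕₚ.+-assoc d c _)) (sym (ℕₚ.+-assoc d c _))))))
        head)
      where
      sumN-suc : ∀ h n → sumN h (suc n) ≡ h 0 ℕ.+ sumN (h ∘ suc) n
      sumN-suc h zero = refl
      sumN-suc h (suc n) = trans (cong (h (suc n) ℕ.+_) (sumN-suc h n)) (trans (sym (ℕₚ.+-assoc (h (suc n)) (h 0) _))
        (trans (cong (ℕ._+ sumN (h ∘ suc) n) (ℕₚ.+-comm (h (suc n)) (h 0))) (ℕₚ.+-assoc (h 0) (h (suc n)) _)))
      diff : (d ℕ.+ c) ℕ.∸ (d ℕ.+ 0) ≡ c
      diff = trans (cong ((d ℕ.+ c) ℕ.∸_) (ℕₚ.+-identityʳ d)) (ℕₚ.m+n∸m≡n d c)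
      head : slope (just (d ℕ.+ c)) (just (d ℕ.+ 0)) α ℕ.+ count α cs ≡ count α (c ∷ cs)
      head = cong (λ z → tick z α ℕ.+ count α cs) diff

    sumN-+ : ∀ (h : ℕ → ℕ) m n → (∀ k → m ≤ k → h k ≡ 0) → sumN h (n ℕ.+ m) ≡ sumN h m
    sumN-+ h m zero z = refl
    sumN-+ h m (suc n) z = cong₂ ℕ._+_ (z (n ℕ.+ m) (ℕₚ.m≤n+m m n)) (sumN-+ h m n z)

    -- Up to the rank, the differences of prefix sums are the entries of cs; beyond it the exponent
    -- is `nothing` and contributes 0.
    invMult-count : ∀ {R C} {A : Matrix (Fin R)
        (Fin C)} {cs} → A ~ diag cs → Sorted cs → ∀ α → invMult p A α ≡ count α cs
    invMult-count {R} {C} {A} {cs} eq sorted α = trans (invMult-sum p A α) (trans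
        (cong (sumN h) (sym (ℕₚ.m∸n+n≡m (length-≤ eq sorted))))
        (trans (sumN-+ h (length cs) (R ℕ.⊓ C ℕ.∸ length cs) beyond) (slopeSum-count α 0 cs h within)))
      where
      h : ℕ → ℕ
      h k = slope (detDivExp p A (suc k)) (detDivExp p A k) α
      beyond : ∀ k → length cs ≤ k → h k ≡ 0
      beyond k le = cong (λ x → slope x (detDivExp p A k) α) (detDivExp-nothing {cs = cs} eq (s≤s le))
      within : ∀ k → k < length cs → h k ≡ slope (just (prefixSum (suc k) cs)) (just (prefixSum k cs)) α
      within k lt = cong₂ (λ x y → slope x y α) (detDivExp-just eq sorted lt) (detDivExp-just eq sorted (ℕₚ.<⇒≤ lt))

    sortedSmith : ∀ {R C} (A : Matrix (Fin R) (Fin C)) → ∃ λ cs → A ~ diag cs × Sorted cs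
    sortedSmith A with smith A
    ... | cs , eq = sort cs , ~-trans eq (~-sym (diag-↭ (sort-↭ cs))) , Sorted⇒AllPairs ℕₚ.≤-totalOrder (sort-↗ cs)

    -- The joined list of exponents presents the block sum but must be sorted before determinantal
    -- exponents can be read off; counting is insensitive to the sorting.
    invMult-⊞ : ∀ {R C R' C' S D} {A : Matrix (Fin R) (Fin C)} {B : Matrix (Fin R') (Fin C')} {W : Matrix (Fin S)
        (Fin D)} →
      W ~ A ⊞ B → ∀ α → invMult p A α ℕ.+ invMult p B α ≡ invMult p W α
    invMult-⊞ {A = A} {B} {W} eq α with sortedSmith A | sortedSmith B
    ... | as , eqA , sA | bs , eqB , sB = trans (cong₂ ℕ._+_ (invMult-count eqA sA α) (invMult-count eqB sB α))
        (trans (sym (count-++ α as bs)) (trans (sym (count-↭ α (sort-↭ (as ++ bs))))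
          (sym (invMult-count (~-trans eq (~-trans (⊞-cong eqA eqB) (~-trans (diag-++ as bs)
              (~-sym (diag-↭ (sort-↭ (as ++ bs)))))))
            (Sorted⇒AllPairs ℕₚ.≤-totalOrder (sort-↗ (as ++ bs))) α))))

    -- Bounding the exponents by bordered minors

    δ-refl : ∀ {n} (i : Fin n) → δ i i ≡ pos 1
    δ-refl Fin.zero = refl
    δ-refl (Fin.suc i) = δ-refl i

    δ-≢ : ∀ {n} {i j : Fin n} → i ≢ j → δ i j ≡ pos 0
    δ-≢ {i = Fin.zero} {Fin.zero} ne = ⊥-elim (ne refl)
    δ-≢ {i = Fin.zero} {Fin.suc j} ne = refl
    δ-≢ {i = Fin.suc i} {Fin.zero} ne = refl
    δ-≢ {i = Fin.suc i} {Fin.suc j} ne = δ-≢ (ne ∘ cong Fin.suc)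

    missing : ∀ {k n} → k < n → (v : Vec (Fin n) k) → ∃ λ y → ∀ a → lookup v a ≢ y
    missing {k} {n} lt v with Finₚ.¬∀⟶∃¬ n _ (λ y → Finₚ.any? (λ a → lookup v a Fin.≟ y)) onto
      where
      onto : ¬ (∀ y → ∃ λ a → lookup v a ≡ y)
      onto h = ℕₚ.<⇒≱ lt (Finₚ.injective⇒≤ {f = λ y → proj₁ (h y)}
        (λ {x} {y} eq → trans (sym (proj₂ (h x))) (trans (cong (lookup v) eq) (proj₂ (h y)))))
    ... | y , ∉v = y , λ a eq → ∉v (a , eq)

    P-cancel : ∀ b e {z} → P e ∣ P b * z → P (e ℕ.∸ b) ∣ z
    P-cancel b e {z} d with b ℕ.≤? e
    -- Truncated subtraction leaves the exponent 0, so only divisibility by 1 is claimed.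
    ... | no b≰e = subst (λ k → P k ∣ z) (sym (ℕₚ.m≤n⇒m∸n≡0 (ℕₚ.<⇒≤ (ℕₚ.≰⇒> b≰e)))) (ℕ∣⇒P∣ (ℕ∣.1∣ _))
    ... | yes b≤e = ℕ∣⇒P∣ (ℕ∣.*-cancelˡ-∣ (p ^ b) ⦃ ℕₚ.m^n≢0 p b ⦄ (subst₂ ℕ∣._∣_
        (trans (cong (p ^_) (sym (ℕₚ.m+[n∸m]≡n b≤e))) (ℕₚ.^-distribˡ-+-* p b (e ℕ.∸ b)))
        (trans (cong ∣_∣ (trans (cong (_* z) (P-def b)) (*-def _ z))) (ℤₚ.abs-* (pos (p ^ b)) z)) (P∣⇒ℕ∣ d)))

    -- Border a k-minor by a row p ^ b · δ y, where y is a column it does not use.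
    MinorDiv-descend : ∀ {R : Set} {C} {A : Matrix R (Fin C)} b → (∀ y → Span A (λ c → P b * δ y c)) →
      ∀ {k} → k < C → ∀ e → MinorDiv A (suc k) e → MinorDiv A k (e ℕ.∸ b)
    MinorDiv-descend {R} {C} {A} b span {k} lt e h rs cols with missing lt cols
    ... | y , avoid = P-cancel b e (∣-resp border (MinorDiv-rows {A = A⁺} inSpan h (inj₁ tt ∷ Vec.map inj₂ rs)
        (y ∷ cols)))
      where
      A⁺ : Matrix (⊤ ⊎ R) (Fin C)
      A⁺ (inj₁ _) c = P b * δ y c
      A⁺ (inj₂ r) c = A r c
      inSpan : ∀ r → Span A (A⁺ r)
      inSpan (inj₁ _) = span y
      inSpan (inj₂ r) = gen r
      border : Det (suc k) (submatrix A⁺ (inj₁ tt ∷ Vec.map inj₂ rs) (y ∷ cols)) ≡ P b * Det k (submatrix A rs cols)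
      border = trans (Det-row k _) (trans (∑-suc k _) (trans (cong₂ _+_
        (trans (cong₂ _*_ sg-zero (cong₂ _*_ (trans (cong (P b *_) (δ-refl y)) (*-identityʳ _))
          (Det-cong k (λ a c → cong (λ r → A⁺ r (lookup cols c)) (Vecₚ.lookup-map a inj₂ rs))))) (*-identityˡ _))
        (∑-zero k (λ j → trans (cong (sg (Fin.suc j) *_) (trans (cong₂ _*_ (trans (cong (P b *_) (δ-≢ (avoid j ∘ sym)))
            (zeroʳ _)) refl)
          (zeroˡ _))) (zeroʳ _))))
        (+-identityʳ _)))

    prefixSum-bound : ∀ b cs → (∀ k → k < length cs → prefixSum (suc k) cs ≤ prefixSum k cs ℕ.+ b) → ListAll.All
        (_≤ b) cs
    prefixSum-bound b [] h = []
    prefixSum-bound b (c ∷ cs) h = subst (_≤ b) (ℕₚ.+-identityʳ c) (h 0 (s≤s z≤n)) ∷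
      prefixSum-bound b cs (λ k lt → ℕₚ.+-cancelˡ-≤ c _ _ (subst (c ℕ.+ prefixSum (suc k) cs ≤_)
          (ℕₚ.+-assoc c (prefixSum k cs) b) (h (suc k) (s≤s lt))))

    sumUpTo-cong : ∀ n {f g} → (∀ α → f α ≡ g α) → sumUpTo n f ≡ sumUpTo n g
    sumUpTo-cong zero h = h 0
    sumUpTo-cong (suc n) h = cong₂ ℕ._+_ (sumUpTo-cong n h) (h (suc n))

    sumUpTo-+ : ∀ n f g → sumUpTo n (λ α → f α ℕ.+ g α) ≡ sumUpTo n f ℕ.+ sumUpTo n g
    sumUpTo-+ zero f g = refl
    sumUpTo-+ (suc n) f g = trans (cong (ℕ._+ (f (suc n) ℕ.+ g (suc n))) (sumUpTo-+ n f g))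
      (exchange (sumUpTo n f) (sumUpTo n g) (f (suc n)) (g (suc n)))
      where
      open import Data.Nat.Solver using (module +-*-Solver)
      exchange : ∀ a b c d → (a ℕ.+ b) ℕ.+ (c ℕ.+ d) ≡ (a ℕ.+ c) ℕ.+ (b ℕ.+ d)
      exchange = +-*-Solver.solve 4 (λ a b c d → (a +-*-Solver.:+ b) +-*-Solver.:+ (c +-*-Solver.:+ d)
        +-*-Solver.:= (a +-*-Solver.:+ c) +-*-Solver.:+ (b +-*-Solver.:+ d)) refl

    tick-refl : ∀ c → tick c c ≡ 1
    tick-refl c with c ℕ.≟ c
    ... | yes _ = refl
    ... | no ne = ⊥-elim (ne refl)

    tick-≢ : ∀ {c α} → c ≢ α → tick c α ≡ 0
    tick-≢ {c} {α} ne with c ℕ.≟ α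
    ... | yes eq = ⊥-elim (ne eq)
    ... | no _ = refl

    sumUpTo-tick-> : ∀ n {c} → n < c → sumUpTo n (tick c) ≡ 0
    sumUpTo-tick-> zero lt = tick-≢ (ℕₚ.>⇒≢ lt)
    sumUpTo-tick-> (suc n) lt = cong₂ ℕ._+_ (sumUpTo-tick-> n (ℕₚ.<-trans (ℕₚ.n<1+n n) lt)) (tick-≢ (ℕₚ.>⇒≢ lt))

    sumUpTo-tick : ∀ n {c} → c ≤ n → sumUpTo n (tick c) ≡ 1
    sumUpTo-tick zero z≤n = tick-refl 0
    sumUpTo-tick (suc n) {c} le with ℕₚ.m≤n⇒m<n∨m≡n le
    ... | inj₁ lt = cong₂ ℕ._+_ (sumUpTo-tick n (ℕₚ.≤-pred lt)) (tick-≢ (ℕₚ.<⇒≢ lt))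
    ... | inj₂ refl = cong₂ ℕ._+_ (sumUpTo-tick-> n (ℕₚ.n<1+n n)) (tick-refl (suc n))

    sumUpTo-count : ∀ n {cs} → ListAll.All (_≤ n) cs → sumUpTo n (λ α → count α cs) ≡ length cs
    sumUpTo-count n [] = zeros n
      where
      zeros : ∀ n → sumUpTo n (λ _ → 0) ≡ 0
      zeros zero = refl
      zeros (suc n) = cong (ℕ._+ 0) (zeros n)
    sumUpTo-count n {c ∷ cs} (le ∷ les) = trans (sumUpTo-+ n (tick c) (λ α → count α cs))
        (cong₂ ℕ._+_ (sumUpTo-tick n le) (sumUpTo-count n les))

    -- `MinorDiv-descend` bounds the growth of the determinantal exponents by b at every size below
    -- C. A rank below C is impossible, since the next larger minors would be divisible by all
    -- powers of p; and each exponent, being such a growth, is at most b.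
    fullRank-sum : ∀ {R C} {A : Matrix (Fin R) (Fin C)} b → (∀ y → Span A (λ c → P b * δ y c)) → sumUpTo b
        (invMult p A) ≡ C
    fullRank-sum {R} {C} {A} b span with sortedSmith A
    ... | cs , eq@(f , g) , sorted = trans (sumUpTo-cong b (invMult-count eq sorted))
        (trans (sumUpTo-count b bounded) full)
      where
      descend : ∀ {k} → k < C → k ≤ length cs → ∀ e → MinorDiv (diag cs) (suc k) e → e ≤ b ℕ.+ prefixSum k cs
      descend lt le e h = ℕₚ.≤-trans (ℕₚ.m≤n+m∸n e b) (ℕₚ.+-monoʳ-≤ b
        (diag-MinorDiv-≤ cs le (MinorDiv-≼ g (MinorDiv-descend b span lt e (MinorDiv-≼ f h)))))
      full : length cs ≡ C
      full = ℕₚ.≤-antisym (ℕₚ.≤-trans (length-≤ eq sorted) (ℕₚ.m⊓n≤n R C)) (ℕₚ.≮⇒≥ (λ lt → ℕₚ.<-irrefl refl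
        (descend lt ℕₚ.≤-refl (suc (b ℕ.+ prefixSum (length cs) cs)) (diag-MinorDiv-beyond cs (ℕₚ.n<1+n _) _))))
      bounded : ListAll.All (_≤ b) cs
      bounded = prefixSum-bound b cs (λ k lt → subst (prefixSum (suc k) cs ≤_) (ℕₚ.+-comm b _)
        (descend (subst (k <_) full lt) (ℕₚ.<⇒≤ lt) _ (diag-MinorDiv cs sorted (suc k))))

  -- Linear algebra over a finite field

  ∑-const : ∀ n x → ∑ n (λ _ → x) ≡ pos n * x
  ∑-const zero x = trans (∑-empty _) (sym (zeroˡ x))
  ∑-const (suc n) x = trans (∑-suc n _) (trans (cong (x +_) (∑-const n x)) (trans
    (solve 2 (λ x y → x :+ y :* x := (con (pos 1) :+ y) :* x) refl x (pos n))
    (cong (_* x) (+-def (pos 1) (pos n)))))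

  ∑-single : ∀ n {f : Fin n → ℤ} i → (∀ j → j ≢ i → f j ≡ pos 0) → ∑ n f ≡ f i
  ∑-single (suc n) Fin.zero h = trans (∑-suc n _) (trans (cong (_+_ _) (∑-zero n (λ j → h (Fin.suc j) (λ ()))))
      (+-identityʳ _))
  ∑-single (suc n) (Fin.suc i) h = trans (∑-suc n _) (trans (cong₂ _+_ (h Fin.zero (λ ()))
      (∑-single n i (λ j ne → h (Fin.suc j) (ne ∘ Finₚ.suc-injective)))) (+-identityˡ _))

  indicator : ∀ {X : Set} → Dec X → ℤ
  indicator (yes _) = pos 1
  indicator (no _) = pos 0

  indicator-yes : ∀ {X : Set} (d : Dec X) → X → indicator d ≡ pos 1
  indicator-yes (yes _) x = refl
  indicator-yes (no ¬x) x = ⊥-elim (¬x x)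

  indicator-no : ∀ {X : Set} (d : Dec X) → ¬ X → indicator d ≡ pos 0
  indicator-no (yes x) ¬x = ⊥-elim (¬x x)
  indicator-no (no _) ¬x = refl

  indicator-⇔ : ∀ {X Y : Set} (d : Dec X) (d' : Dec Y) → (X → Y) → (Y → X) → indicator d ≡ indicator d'
  indicator-⇔ (yes x) d' f g = sym (indicator-yes d' (f x))
  indicator-⇔ (no ¬x) d' f g = sym (indicator-no d' (¬x ∘ g))

  module VectorSpace {q : ℕ} (F : FiniteField q) where
    open FiniteField F using (0≢1; inverse; isCommutativeRing; 0#; 1#) renaming (_+_ to _+ᶠ_; _*_ to _*ᶠ_; -_ to -ᶠ_)
    open LinAlg F
    private module 𝔽 = IntegerCoefficients isCommutativeRing
    open 𝔽 using () renaming (solve to solveᶠ; _:+_ to _⊹_; _:*_ to _⋆_; :-_ to neg; _:=_ to _≐_; con to conᶠ)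

    V : ℕ → Set
    V n = Vec (Fin q) n

    infixl 6 _⊖_

    _⊖_ : ∀ {n} → V n → V n → V n
    _⊖_ = Vec.zipWith (λ x y → x +ᶠ (-ᶠ y))

    lincomb-⊕-step : ∀ {n} c d (v x y : V n) → ((c +ᶠ d) ⊙ v) ⊕ (x ⊕ y) ≡ ((c ⊙ v) ⊕ x) ⊕ ((d ⊙ v) ⊕ y)
    lincomb-⊕-step c d [] [] [] = refl
    lincomb-⊕-step c d (v ∷ vs) (x ∷ xs) (y ∷ ys) = cong₂ _∷_
      (solveᶠ 5 (λ c d v x y → ((c ⊹ d) ⋆ v) ⊹ (x ⊹ y) ≐ ((c ⋆ v) ⊹ x) ⊹ ((d ⋆ v) ⊹ y)) refl c d v x y)
          (lincomb-⊕-step c d vs xs ys)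

    lincomb-⊙-step : ∀ {n} s c (v x : V n) → ((s *ᶠ c) ⊙ v) ⊕ (s ⊙ x) ≡ s ⊙ ((c ⊙ v) ⊕ x)
    lincomb-⊙-step s c [] [] = refl
    lincomb-⊙-step s c (v ∷ vs) (x ∷ xs) = cong₂ _∷_
      (solveᶠ 4 (λ s c v x → ((s ⋆ c) ⋆ v) ⊹ (s ⋆ x) ≐ s ⋆ ((c ⋆ v) ⊹ x)) refl s c v x) (lincomb-⊙-step s c vs xs)

    ⊕-⊖ : ∀ {n} (x y : V n) → (x ⊕ ((-ᶠ 1#) ⊙ y)) ≡ x ⊖ y
    ⊕-⊖ [] [] = refl
    ⊕-⊖ (x ∷ xs) (y ∷ ys) = cong₂ _∷_ (solveᶠ 2 (λ x y → x ⊹ (neg (conᶠ (pos 1)) ⋆ y) ≐ x ⊹ neg y) refl x y) (⊕-⊖ xs ys)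

    zero-⊕ : ∀ {n} (v x : V n) → ((0# ⊙ v) ⊕ x) ≡ x
    zero-⊕ [] [] = refl
    zero-⊕ (v ∷ vs) (x ∷ xs) = cong₂ _∷_ (solveᶠ 2 (λ v x → (conᶠ (pos 0) ⋆ v) ⊹ x ≐ x) refl v x) (zero-⊕ vs xs)

    ⊙-zero : ∀ {n} s → s ⊙ zeroV {n} ≡ zeroV
    ⊙-zero {zero} s = refl
    ⊙-zero {suc n} s = cong₂ _∷_ (𝔽.zeroʳ s) (⊙-zero s)

    zeroV-⊕ : ∀ {n} (x : V n) → zeroV ⊕ x ≡ x
    zeroV-⊕ [] = refl
    zeroV-⊕ (x ∷ xs) = cong₂ _∷_ (𝔽.+-identityˡ x) (zeroV-⊕ xs)

    ⊕-zeroV : ∀ {n} (x : V n) → x ⊕ zeroV ≡ x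
    ⊕-zeroV [] = refl
    ⊕-zeroV (x ∷ xs) = cong₂ _∷_ (𝔽.+-identityʳ x) (⊕-zeroV xs)

    one-⊙ : ∀ {n} (x : V n) → 1# ⊙ x ≡ x
    one-⊙ [] = refl
    one-⊙ (x ∷ xs) = cong₂ _∷_ (𝔽.*-identityˡ x) (one-⊙ xs)

    zero-⊙ : ∀ {n} (x : V n) → 0# ⊙ x ≡ zeroV
    zero-⊙ [] = refl
    zero-⊙ (x ∷ xs) = cong₂ _∷_ (𝔽.zeroˡ x) (zero-⊙ xs)

    ⊙-⊙ : ∀ {n} s t (x : V n) → s ⊙ (t ⊙ x) ≡ (s *ᶠ t) ⊙ x
    ⊙-⊙ s t [] = refl
    ⊙-⊙ s t (x ∷ xs) = cong₂ _∷_ (sym (𝔽.*-assoc s t x)) (⊙-⊙ s t xs)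

    ⊖-self : ∀ {n} (x : V n) → x ⊖ x ≡ zeroV
    ⊖-self [] = refl
    ⊖-self (x ∷ xs) = cong₂ _∷_ (𝔽.-‿inverseʳ x) (⊖-self xs)

    ⊕-⊖-cancel : ∀ {n} (x y : V n) → (x ⊕ y) ⊖ x ≡ y
    ⊕-⊖-cancel [] [] = refl
    ⊕-⊖-cancel (x ∷ xs) (y ∷ ys) = cong₂ _∷_ (solveᶠ 2 (λ x y → (x ⊹ y) ⊹ neg x ≐ y) refl x y) (⊕-⊖-cancel xs ys)

    ⊕-⊖-cancelʳ : ∀ {n} (x y : V n) → (x ⊕ y) ⊖ y ≡ x
    ⊕-⊖-cancelʳ [] [] = refl
    ⊕-⊖-cancelʳ (x ∷ xs) (y ∷ ys) = cong₂ _∷_ (solveᶠ 2 (λ x y → (x ⊹ y) ⊹ neg y ≐ x) refl x y) (⊕-⊖-cancelʳ xs ys)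

    ⊖-⊕-cancelʳ : ∀ {n} (x y : V n) → (x ⊖ y) ⊕ y ≡ x
    ⊖-⊕-cancelʳ [] [] = refl
    ⊖-⊕-cancelʳ (x ∷ xs) (y ∷ ys) = cong₂ _∷_ (solveᶠ 2 (λ x y → (x ⊹ neg y) ⊹ y ≐ x) refl x y) (⊖-⊕-cancelʳ xs ys)

    ⊖-⊕-cancel : ∀ {n} (x y : V n) → x ⊕ (y ⊖ x) ≡ y
    ⊖-⊕-cancel [] [] = refl
    ⊖-⊕-cancel (x ∷ xs) (y ∷ ys) = cong₂ _∷_ (solveᶠ 2 (λ x y → x ⊹ (y ⊹ neg x) ≐ y) refl x y) (⊖-⊕-cancel xs ys)

    ⊖-⊖-swap : ∀ {n} (x y : V n) → x ⊖ (x ⊖ y) ≡ y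
    ⊖-⊖-swap [] [] = refl
    ⊖-⊖-swap (x ∷ xs) (y ∷ ys) = cong₂ _∷_ (solveᶠ 2 (λ x y → x ⊹ neg (x ⊹ neg y) ≐ y) refl x y) (⊖-⊖-swap xs ys)

    ⊖-⊖ : ∀ {n} (x y z : V n) → x ⊖ y ⊖ z ≡ x ⊖ (y ⊕ z)
    ⊖-⊖ [] [] [] = refl
    ⊖-⊖ (x ∷ xs) (y ∷ ys) (z ∷ zs) = cong₂ _∷_ (solveᶠ 3 (λ x y z → (x ⊹ neg y) ⊹ neg z ≐ x ⊹ neg (y ⊹ z)) refl x y z)
        (⊖-⊖ xs ys zs)

    ⊙-⊕-⊙ : ∀ {n} d c (x y w : V n) → (d ⊙ (x ⊕ (c ⊙ y))) ⊕ w ≡ (d ⊙ x) ⊕ (((d *ᶠ c) ⊙ y) ⊕ w)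
    ⊙-⊕-⊙ d c [] [] [] = refl
    ⊙-⊕-⊙ d c (x ∷ xs) (y ∷ ys) (w ∷ ws) = cong₂ _∷_
      (solveᶠ 5 (λ d c x y w → (d ⋆ (x ⊹ (c ⋆ y))) ⊹ w ≐ (d ⋆ x) ⊹ (((d ⋆ c) ⋆ y) ⊹ w)) refl d c x y w)
          (⊙-⊕-⊙ d c xs ys ws)

    invert : ∀ {n} {b y} → b *ᶠ y ≡ 1# → (x : V n) → y ⊙ (b ⊙ x) ≡ x
    invert {b = b} {y} eq x = trans (⊙-⊙ y b x) (trans (cong (_⊙ x) (trans (𝔽.*-comm y b) eq)) (one-⊙ x))

    In : ∀ {n k} → Vec (V n) k → V n → Set
    In vs x = ∃ λ c → x ≡ lincomb c vs

    lincomb-⊕ : ∀ {n k} c d (vs : Vec (V n) k) → lincomb (c ⊕ d) vs ≡ lincomb c vs ⊕ lincomb d vs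
    lincomb-⊕ [] [] [] = sym (zeroV-⊕ zeroV)
    lincomb-⊕ (c ∷ cs) (d ∷ ds) (v ∷ vs) = trans (cong (((c +ᶠ d) ⊙ v) ⊕_) (lincomb-⊕ cs ds vs))
        (lincomb-⊕-step c d v _ _)

    lincomb-⊙ : ∀ {n k} s c (vs : Vec (V n) k) → lincomb (s ⊙ c) vs ≡ s ⊙ lincomb c vs
    lincomb-⊙ s [] [] = sym (⊙-zero s)
    lincomb-⊙ s (c ∷ cs) (v ∷ vs) = trans (cong (((s *ᶠ c) ⊙ v) ⊕_) (lincomb-⊙ s cs vs)) (lincomb-⊙-step s c v _)

    lincomb-⊖ : ∀ {n k} c d (vs : Vec (V n) k) → lincomb (c ⊖ d) vs ≡ lincomb c vs ⊖ lincomb d vs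
    lincomb-⊖ c d vs = trans (cong (λ z → lincomb z vs) (sym (⊕-⊖ c d))) (trans (lincomb-⊕ c _ vs)
      (trans (cong (lincomb c vs ⊕_) (lincomb-⊙ _ d vs)) (⊕-⊖ _ _)))

    lincomb-zero : ∀ {n k} (vs : Vec (V n) k) → lincomb zeroV vs ≡ zeroV
    lincomb-zero vs = trans (cong (λ z → lincomb z vs) (sym (⊖-self zeroV))) (trans (lincomb-⊖ zeroV zeroV vs)
        (⊖-self _))

    In-zero : ∀ {n k} (vs : Vec (V n) k) → In vs zeroV
    In-zero vs = zeroV , sym (lincomb-zero vs)

    In-⊕ : ∀ {n k} {vs : Vec (V n) k} {x y} → In vs x → In vs y → In vs (x ⊕ y)
    In-⊕ {vs = vs} (c , refl) (d , refl) = c ⊕ d , sym (lincomb-⊕ c d vs)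

    In-⊙ : ∀ {n k} {vs : Vec (V n) k} s {x} → In vs x → In vs (s ⊙ x)
    In-⊙ {vs = vs} s (c , refl) = s ⊙ c , sym (lincomb-⊙ s c vs)

    In-⊖ : ∀ {n k} {vs : Vec (V n) k} {x y} → In vs x → In vs y → In vs (x ⊖ y)
    In-⊖ {vs = vs} (c , refl) (d , refl) = c ⊖ d , sym (lincomb-⊖ c d vs)

    In-there : ∀ {n k} {vs : Vec (V n) k} {e x} → In vs x → In (e ∷ vs) x
    In-there {e = e} (c , refl) = 0# ∷ c , sym (zero-⊕ e _)

    In-here : ∀ {n k} (e : V n) (vs : Vec (V n) k) → In (e ∷ vs) e
    In-here e vs = 1# ∷ zeroV , sym (trans (cong ((1# ⊙ e) ⊕_) (lincomb-zero vs)) (trans (⊕-zeroV _) (one-⊙ e)))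

    In-lincomb : ∀ {n k l} {vs : Vec (V n) k} {ws : Vec (V n) l} → (∀ i → In vs (lookup ws i)) → ∀ c → In vs
        (lincomb c ws)
    In-lincomb {vs = vs} {[]} h [] = In-zero vs
    In-lincomb {ws = w ∷ ws} h (c ∷ cs) = In-⊕ (In-⊙ c (h Fin.zero)) (In-lincomb {ws = ws} (h ∘ Fin.suc) cs)

    In-mono : ∀ {n k l} {vs : Vec (V n) k} {ws : Vec (V n) l} → (∀ i → In vs (lookup ws i)) → ∀ {x} → In ws x → In vs x
    In-mono {ws = ws} h (c , refl) = In-lincomb {ws = ws} h c

    In-lookup : ∀ {n k} (vs : Vec (V n) k) i → In vs (lookup vs i)
    In-lookup (v ∷ vs) Fin.zero = In-here v vs
    In-lookup (v ∷ vs) (Fin.suc i) = In-there {e = v} (In-lookup vs i)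

    anyVec? : ∀ k {Q : V k → Set} → (∀ c → Dec (Q c)) → Dec (∃ Q)
    anyVec? zero d = map′ (λ h → [] , h) (λ { ([] , h) → h }) (d [])
    anyVec? (suc k) d = map′ (λ { (x , c , h) → x ∷ c , h }) (λ { (x ∷ c , h) → x , c , h })
        (Finₚ.any? (λ x → anyVec? k (λ c → d (x ∷ c))))

    opaque
      In? : ∀ {n k} (vs : Vec (V n) k) x → Dec (In vs x)
      In? {k = k} vs x = anyVec? k (λ c → Vecₚ.≡-dec Fin._≟_ x (lincomb c vs))

    opaque
      ind : ∀ {n k} → Vec (V n) k → V n → ℤ
      ind vs x = indicator (In? vs x)

      ind-yes : ∀ {n k} {vs : Vec (V n) k} {x} → In vs x → ind vs x ≡ pos 1
      ind-yes {vs = vs} {x} = indicator-yes (In? vs x)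

      ind-no : ∀ {n k} {vs : Vec (V n) k} {x} → ¬ In vs x → ind vs x ≡ pos 0
      ind-no {vs = vs} {x} = indicator-no (In? vs x)

      ind-⇔ : ∀ {n k n' k'} {vs : Vec (V n) k} {ws : Vec (V n') k'} {x y} →
        (In vs x → In ws y) → (In ws y → In vs x) → ind vs x ≡ ind ws y
      ind-⇔ {vs = vs} {ws} {x} {y} = indicator-⇔ (In? vs x) (In? ws y)

    LinIndep-injective : ∀ {n k} {vs : Vec (V n) k} → LinIndep vs → ∀ {c d} → lincomb c vs ≡ lincomb d vs → c ≡ d
    LinIndep-injective {vs = vs} li {c} {d} eq = trans (sym (⊖-⊕-cancel d c)) (trans
      (cong (d ⊕_) (li (c ⊖ d) (trans (lincomb-⊖ c d vs) (trans (cong (_⊖ lincomb d vs) eq) (⊖-self _))))) (⊕-zeroV d))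

    LinIndep-tail : ∀ {n k} {e : V n} {vs : Vec (V n) k} → LinIndep (e ∷ vs) → LinIndep vs
    LinIndep-tail {e = e} li c eq = cong Vec.tail (li (0# ∷ c) (trans (zero-⊕ e _) eq))

    LinIndep-head : ∀ {n k} {e : V n} {vs : Vec (V n) k} → LinIndep (e ∷ vs) → ¬ In vs e
    LinIndep-head {e = e} {vs} li (c , eq) = 0≢1 (sym (cong Vec.head (LinIndep-injective li {1# ∷ zeroV} {0# ∷ c}
      (trans (sym (proj₂ (In-here e vs))) (trans eq (sym (zero-⊕ e _)))))))

    scalar-zero : ∀ {n k} {e : V n} {vs : Vec (V n) k} → ¬ In vs e → ∀ {b} → In vs (b ⊙ e) → b ≡ 0#
    scalar-zero {e = e} {vs} ∉vs {b} h with b Fin.≟ 0#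
    ... | yes eq = eq
    ... | no ne = let y , eq = inverse b ne in ⊥-elim (∉vs (subst (In vs) (invert eq e) (In-⊙ y h)))

    LinIndep-cons : ∀ {n k} {e : V n} {vs : Vec (V n) k} → LinIndep vs → ¬ In vs e → LinIndep (e ∷ vs)
    LinIndep-cons {e = e} {vs} li ∉vs (b ∷ c) eq = cong₂ _∷_ b≡0
        (li c (trans (sym (zero-⊕ e _)) (trans (cong (λ z → (z ⊙ e) ⊕ lincomb c vs) (sym b≡0)) eq)))
      where
      b≡0 : b ≡ 0#
      b≡0 = scalar-zero ∉vs (subst (In vs) (trans (cong (_⊖ lincomb c vs) (sym eq)) (⊕-⊖-cancelʳ _ _))
          (In-⊖ (In-zero vs) (c , refl)))

    q>1 : 1 < q
    q>1 = go q 0# 1# 0≢1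
      where
      go : ∀ q (x y : Fin q) → x ≢ y → 1 < q
      go (suc zero) Fin.zero Fin.zero ne = ⊥-elim (ne refl)
      go (suc (suc q)) x y ne = s≤s (s≤s z≤n)

    -- Compares the cardinalities q^k and q^l, with q > 1. Counting replaces the exchange argument
    -- in the theory of dimension.
    injective⇒≤ : ∀ {k l} (f : V k → V l) → (∀ {c d} → f c ≡ f d → c ≡ d) → k ≤ l
    injective⇒≤ {k} {l} f inj = ℕₚ.≮⇒≥ (λ lt → ℕₚ.<⇒≱ (ℕₚ.^-monoʳ-< q q>1 lt) (Finₚ.injective⇒≤ {f = g} g-inj))
      where
      g : Fin (q ^ k) → Fin (q ^ l)
      g i = Fin.funToFin (lookup (f (Vec.tabulate (Fin.finToFun i))))
      vec-ext : ∀ {m} {x y : V m} → (∀ i → lookup x i ≡ lookup y i) → x ≡ y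
      vec-ext {x = x} {y} h = trans (sym (Vecₚ.tabulate∘lookup x)) (trans (Vecₚ.tabulate-cong h)
          (Vecₚ.tabulate∘lookup y))
      funToFin-cong : ∀ {m n} {f g : Fin m → Fin n} → (∀ i → f i ≡ g i) → Fin.funToFin f ≡ Fin.funToFin g
      funToFin-cong {zero} h = refl
      funToFin-cong {suc m} h = cong₂ Fin.combine (h Fin.zero) (funToFin-cong (h ∘ Fin.suc))
      g-inj : ∀ {i j} → g i ≡ g j → i ≡ j
      g-inj {i} {j} eq = trans (sym (Finₚ.funToFin-finToFin {k} {q} i)) (trans (funToFin-cong same)
          (Finₚ.funToFin-finToFin {k} {q} j))
        where
        vecs : Vec.tabulate (Fin.finToFun {q} {k} i) ≡ Vec.tabulate (Fin.finToFun {q} {k} j)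
        vecs = inj (vec-ext (λ a → trans (sym (Finₚ.finToFun-funToFin _ a)) (trans (cong (λ z → Fin.finToFun z a) eq)
            (Finₚ.finToFun-funToFin _ a))))
        same : ∀ a → Fin.finToFun i a ≡ Fin.finToFun j a
        same a = trans (sym (Vecₚ.lookup∘tabulate _ a)) (trans (cong (λ z → lookup z a) vecs)
            (Vecₚ.lookup∘tabulate _ a))

    opaque
      -- Rewriting combinations of vs in terms of ws maps coefficient vectors to coefficient
      -- vectors, injectively because vs is independent.
      LinIndep-≤ : ∀ {n k l} {vs : Vec (V n) k} {ws : Vec (V n) l} → LinIndep vs → (∀ i → In ws (lookup vs i)) → k ≤ l
      LinIndep-≤ {vs = vs} {ws} li h = injective⇒≤ (λ c → proj₁ (In-lincomb {ws = vs} h c))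
        (λ {c} {d} eq → LinIndep-injective li (trans (proj₂ (In-lincomb {ws = vs} h c))
            (trans (cong (λ z → lincomb z ws) eq) (sym (proj₂ (In-lincomb {ws = vs} h d))))))

      extend : ∀ {n k l} {vs : Vec (V n) k} {ws : Vec (V n) l} → LinIndep ws → k < l → ∃ λ e → In ws e × ¬ In vs e
      extend {l = l} {vs} {ws} li lt with Finₚ.¬∀⟶∃¬ l _ (λ i → In? vs (lookup ws i))
          (λ h → ℕₚ.<⇒≱ lt (LinIndep-≤ {ws = vs} li h))
      ... | i , ∉vs = lookup ws i , In-lookup ws i , ∉vs

    module _ {n k : ℕ} {e₁ e₂ : V n} {vs : Vec (V n) k} (li : LinIndep (e₁ ∷ e₂ ∷ vs)) where
      private
        record At (u : V n) (b b' : Fin q) : Set where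
          constructor at
          field
            c : V k
            eq : u ≡ lincomb (b ∷ b' ∷ c) (e₁ ∷ e₂ ∷ vs)

        coords : ∀ {u b b' d d'} → At u b b' → At u d d' → b ≡ d × b' ≡ d'
        coords {u} {b} {b'} {d} {d'} (at c eq) (at c' eq') with LinIndep-injective li {b ∷ b' ∷ c} {d ∷ d' ∷ c'}
            (trans (sym eq) eq')
        ... | h = cong Vec.head h , cong (Vec.head ∘ Vec.tail) h

        At⇒In : ∀ {u b b'} → At u b b' → In (e₁ ∷ e₂ ∷ vs) u
        At⇒In {u} {b} {b'} (at c eq) = b ∷ b' ∷ c , eq

        from-vs : ∀ {u} → In vs u → At u 0# 0#
        from-vs (c , refl) = at c (sym (trans (zero-⊕ e₁ _) (zero-⊕ e₂ _)))

        from-e₂ : ∀ {u} → In (e₂ ∷ vs) u → ∃ (At u 0#)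
        from-e₂ (d ∷ c , refl) = d , at c (sym (zero-⊕ e₁ _))

        from-pencil : ∀ {u} x → In ((e₁ ⊕ (x ⊙ e₂)) ∷ vs) u → ∃ λ d → At u d (d *ᶠ x)
        from-pencil x (d ∷ c , refl) = d , at c (⊙-⊕-⊙ d x e₁ e₂ _)

      pencil-indep : ∀ x → LinIndep ((e₁ ⊕ (x ⊙ e₂)) ∷ vs)
      pencil-indep x = LinIndep-cons (LinIndep-tail (LinIndep-tail li)) (λ h → 0≢1 (proj₁ (coords (from-vs h)
        (at {b = 1#} {1# *ᶠ x} zeroV (trans (proj₂ (In-here _ vs)) (⊙-⊕-⊙ 1# x e₁ e₂ _))))))

      -- With D spanned by vs and E by e₁, e₂ and D, the summands on the left are the q + 1 spaces
      -- between D and E. A vector of D lies in all of them, a vector of E outside D in exactly one.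
      pencil-sum : ∀ u → ∑ q (λ x → ind ((e₁ ⊕ (x ⊙ e₂)) ∷ vs) u) + ind (e₂ ∷ vs) u ≡ pos q * ind vs u + ind
          (e₁ ∷ e₂ ∷ vs) u
      pencil-sum u with In? (e₁ ∷ e₂ ∷ vs) u
      ... | no ∉ = trans (cong₂ _+_ (∑-zero q (λ x → ind-no (λ h → ∉ (At⇒In (proj₂ (from-pencil x h))))))
          (ind-no (λ h → ∉ (At⇒In (proj₂ (from-e₂ h))))))
          (sym (cong₂ _+_ (trans (cong (pos q *_) (ind-no (λ h → ∉ (At⇒In (from-vs h))))) (zeroʳ _)) (ind-no ∉)))
      ... | yes ∈E@(b ∷ b' ∷ c , eq) with b Fin.≟ 0# | b' Fin.≟ 0#
      ... | yes refl | yes refl = trans (cong₂ _+_ (trans (∑-cong q (λ x → ind-yes (In-there {e = e₁ ⊕ (x ⊙ e₂)} ∈vs)))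
          (∑-const q (pos 1))) (ind-yes (In-there {e = e₂} ∈vs)))
          (sym (cong₂ _+_ (cong (pos q *_) (ind-yes ∈vs)) (ind-yes ∈E)))
        where
        ∈vs : In vs u
        ∈vs = c , trans eq (trans (zero-⊕ e₁ _) (zero-⊕ e₂ _))
      ... | yes refl | no b'≢0 = trans (cong₂ _+_ (∑-zero q (λ x → ind-no (λ h → b'≢0 (off x (from-pencil x h)))))
          (ind-yes (b' ∷ c , trans eq (zero-⊕ e₁ _))))
          (sym (cong₂ _+_ (trans (cong (pos q *_) (ind-no (λ h → b'≢0 (proj₂ (coords (at c eq) (from-vs h))))))
              (zeroʳ _)) (ind-yes ∈E)))
        where
        off : ∀ x → (∃ λ d → At u d (d *ᶠ x)) → b' ≡ 0#
        off x (d , pt) with coords (at c eq) pt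
        ... | refl , b'≡ = trans b'≡ (𝔽.zeroˡ x)
      ... | no b≢0 | _ = trans (cong₂ _+_ (trans (∑-single q x₀ other) (ind-yes on))
          (ind-no (λ h → b≢0 (proj₁ (coords (at c eq) (proj₂ (from-e₂ h)))))))
          (trans (+-comm _ _) (sym (cong₂ _+_
              (trans (cong (pos q *_) (ind-no (λ h → b≢0 (proj₁ (coords (at c eq) (from-vs h)))))) (zeroʳ _))
              (ind-yes ∈E))))
        where
        y : Fin q
        y = proj₁ (inverse b b≢0)
        -- The member through u is found by dividing the e₂-coordinate b' by the e₁-coordinate b.
        x₀ : Fin q
        x₀ = y *ᶠ b'
        b*x₀ : b *ᶠ x₀ ≡ b'
        b*x₀ = trans (sym (𝔽.*-assoc b y b')) (trans (cong (_*ᶠ b') (proj₂ (inverse b b≢0))) (𝔽.*-identityˡ b'))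
        on : In ((e₁ ⊕ (x₀ ⊙ e₂)) ∷ vs) u
        on = b ∷ c , trans eq (sym (trans (⊙-⊕-⊙ b x₀ e₁ e₂ _)
            (cong (λ z → (b ⊙ e₁) ⊕ ((z ⊙ e₂) ⊕ lincomb c vs)) b*x₀)))
        slope-unique : ∀ {x} → (∃ λ d → At u d (d *ᶠ x)) → x ≡ x₀
        slope-unique {x} (d , pt) with coords (at c eq) pt
        ... | refl , b'≡ = sym (trans (cong (y *ᶠ_) b'≡) (trans (sym (𝔽.*-assoc y b x))
                (trans (cong (_*ᶠ x) (trans (𝔽.*-comm y b) (proj₂ (inverse b b≢0)))) (𝔽.*-identityˡ x))))
        other : ∀ x → x ≢ x₀ → ind ((e₁ ⊕ (x ⊙ e₂)) ∷ vs) u ≡ pos 0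
        other x ne = ind-no (λ h → ne (slope-unique (from-pencil x h)))

    -- The translates by multiples of e partition the larger space, because the coordinate along e
    -- is unique.
    parallel-sum : ∀ {n k} {e : V n} {vs : Vec (V n) k} → LinIndep (e ∷ vs) → ∀ u → ind (e ∷ vs) u ≡ ∑ q
        (λ x → ind vs (u ⊖ (x ⊙ e)))
    parallel-sum {e = e} {vs} li u with In? (e ∷ vs) u
    ... | no ∉ = trans (ind-no ∉) (sym
        (∑-zero q (λ x → ind-no (λ { (c , eq) → ∉ (x ∷ c , trans (sym (⊖-⊕-cancel (x ⊙ e) u))
        (cong ((x ⊙ e) ⊕_) eq)) }))))
    ... | yes (b ∷ c , refl) = trans (ind-yes (b ∷ c , refl))
        (sym (trans (∑-single q b other) (ind-yes (c , ⊕-⊖-cancel _ _))))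
      where
      other : ∀ x → x ≢ b → ind vs (u ⊖ (x ⊙ e)) ≡ pos 0
      other x ne = ind-no (λ { (c' , eq) → ne (cong Vec.head (LinIndep-injective li {x ∷ c'} {b ∷ c}
        (trans (cong ((x ⊙ e) ⊕_) (sym eq)) (⊖-⊕-cancel (x ⊙ e) u)))) })

  -- Incidence matrices

  module Incidence {q : ℕ} (F : FiniteField q) (p : ℕ) (prime : Prime p) (p∣q : pos p ∣ pos q) where
    open FiniteField F using (0≢1; inverse; isCommutativeRing; 0#; 1#) renaming (_+_ to _+ᶠ_; _*_ to _*ᶠ_; -_ to -ᶠ_)
    open LinAlg F
    open VectorSpace F
    open Local p prime
    private module 𝔽 = IntegerCoefficients isCommutativeRing

    Basis : ℕ → ℕ → Set
    Basis n k = Σ (Vec (V n) k) LinIndep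

    NonZeroVec : ℕ → Set
    NonZeroVec n = Σ (V n) (_≢ zeroV)

    -- Each subspace occurs once for every basis and each point once for every nonzero multiple.
    -- Equivalence does not see these repetitions, and no representatives have to be chosen.
    Proj : ∀ n i → Matrix (Basis n i) (NonZeroVec n)
    Proj n i (vs , _) (u , _) = ind vs u

    Aff : ∀ n r → Matrix (V n × Basis n r) (V n)
    Aff n r (a , vs , _) x = ind vs (x ⊖ a)

    lincomb-0∷ : ∀ {n k} c (vs : Vec (V n) k) → lincomb c (Vec.map (0# ∷_) vs) ≡ 0# ∷ lincomb c vs
    lincomb-0∷ [] [] = refl
    lincomb-0∷ (c ∷ cs) (v ∷ vs) = trans (cong ((c ⊙ (0# ∷ v)) ⊕_) (lincomb-0∷ cs vs))
      (cong (_∷ ((c ⊙ v) ⊕ lincomb cs vs)) (trans (𝔽.+-identityʳ _) (𝔽.zeroʳ c)))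

    In-0∷ : ∀ {n k} {vs : Vec (V n) k} {u} → In vs u → In (Vec.map (0# ∷_) vs) (0# ∷ u)
    In-0∷ {vs = vs} (c , refl) = c , sym (lincomb-0∷ c vs)

    In-0∷⁻ : ∀ {n k} {vs : Vec (V n) k} {y u} → In (Vec.map (0# ∷_) vs) (y ∷ u) → y ≡ 0# × In vs u
    In-0∷⁻ {vs = vs} (c , eq) = cong Vec.head (trans eq (lincomb-0∷ c vs)) , c , cong Vec.tail
        (trans eq (lincomb-0∷ c vs))

    LinIndep-0∷ : ∀ {n k} {vs : Vec (V n) k} → LinIndep vs → LinIndep (Vec.map (0# ∷_) vs)
    LinIndep-0∷ {vs = vs} li c eq = li c (cong Vec.tail (trans (sym (lincomb-0∷ c vs)) eq))

    -- The homogenisation of the flat a + ⟨vs⟩: affine points have first coordinate 1, and the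
    -- hyperplane at infinity is where it vanishes.
    cone : ∀ {n k} → V n → Vec (V n) k → Vec (V (suc n)) (suc k)
    cone a vs = (1# ∷ a) ∷ Vec.map (0# ∷_) vs

    In-cone : ∀ {n k} {a : V n} {vs : Vec (V n) k} {y u} → In (cone a vs) (y ∷ u) → In vs (u ⊖ (y ⊙ a))
    In-cone {a = a} {vs} (b ∷ c , eq) with trans eq (cong (((b *ᶠ 1#) ∷ (b ⊙ a)) ⊕_) (lincomb-0∷ c vs))
    ... | eq' with trans (cong Vec.head eq') (trans (𝔽.+-identityʳ _) (𝔽.*-identityʳ b))
    ... | refl = c , trans (cong (_⊖ (b ⊙ a)) (cong Vec.tail eq')) (⊕-⊖-cancel _ _)

    In-cone⁻ : ∀ {n k} {a : V n} {vs : Vec (V n) k} {y u} → In vs (u ⊖ (y ⊙ a)) → In (cone a vs) (y ∷ u)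
    In-cone⁻ {a = a} {vs} {y} {u} (c , eq) = y ∷ c , sym (trans (cong (((y *ᶠ 1#) ∷ (y ⊙ a)) ⊕_) (lincomb-0∷ c vs))
      (cong₂ _∷_ (trans (𝔽.+-identityʳ _) (𝔽.*-identityʳ y)) (trans (cong ((y ⊙ a) ⊕_) (sym eq)) (⊖-⊕-cancel _ u))))

    LinIndep-cone : ∀ {n k} a {vs : Vec (V n) k} → LinIndep vs → LinIndep (cone a vs)
    LinIndep-cone a li = LinIndep-cons (LinIndep-0∷ li) (λ h → 0≢1 (sym (proj₁ (In-0∷⁻ h))))

    standardBasis : ∀ n → Basis n n
    standardBasis zero = [] , λ { [] _ → refl }
    standardBasis (suc n) = cone zeroV (proj₁ (standardBasis n)) , LinIndep-cone zeroV (proj₂ (standardBasis n))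

    opaque
      extend₂ : ∀ {n k l} {ws : Vec (V n) l} {vs : Vec (V n) k} → LinIndep ws → LinIndep vs → suc k < l →
        ∃ λ e₁ → ∃ λ e₂ → LinIndep (e₁ ∷ e₂ ∷ vs) × In ws e₁ × In ws e₂
      extend₂ {ws = ws} {vs} liw li lt with extend {vs = vs} {ws} liw (ℕₚ.<-trans (ℕₚ.n<1+n _) lt)
      ... | e₂ , e₂∈ , e₂∉ with extend {vs = e₂ ∷ vs} {ws} liw lt
      ... | e₁ , e₁∈ , e₁∉ = e₁ , e₂ , LinIndep-cons (LinIndep-cons li e₂∉) e₁∉ , e₁∈ , e₂∈

    Q : ℕ → ℤ
    Q zero = pos 1
    Q (suc j) = pos q * Q j

    -- θ j = 1 + q + ⋯ + q ^ (j - 1)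
    θ : ℕ → ℤ
    θ zero = pos 0
    θ (suc j) = pos 1 + pos q * θ j

    -- θ (j + 1) is 1 modulo q, hence modulo p.
    θ-unit : ∀ j → Unit (θ (suc j))
    θ-unit j d = ℕₚ.<⇒≱ (ℕ.nonTrivial⇒n>1 p ⦃ prime⇒nonTrivial prime ⦄) (ℕ∣.∣⇒≤ (∣⇒ℕ∣ {pos p} {pos 1}
      (∣-resp (solve 2 (λ q t → (con (pos 1) :+ q :* t) :+ :- (t :* q) := con (pos 1)) refl (pos q) (θ j))
        (∣-+ d (∣-neg (∣-* (θ j) p∣q))))))

    -- The coefficients in `descend`: the relation for j + 1 at the q + 1 members of a pencil, minus
    -- q times the relation for j at their join. The weight of [E] fits because (q + 1) θ (j + 1) -
    -- q θ j = θ (j + 2).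
    descend-identity : ∀ q Q t S k w s x → S + k ≡ q * x + s →
      (((q * Q) * S + q * ((pos 1 + q * t) * w)) + ((q * Q) * k + (pos 1 + q * t) * w)) + - (q * (Q * s + t * w))
        ≡ (q * (q * Q)) * x + (pos 1 + q * (pos 1 + q * t)) * w
    descend-identity q Q t S k w s x eq = begin
      (((q * Q) * S + q * ((pos 1 + q * t) * w)) + ((q * Q) * k + (pos 1 + q * t) * w)) + - (q * (Q * s + t * w))
        ≡⟨ solve 7 (λ q Q t S k w s →
             (((q :* Q) :* S :+ q :* ((con (pos 1) :+ q :* t) :* w)) :+
                 ((q :* Q) :* k :+ (con (pos 1) :+ q :* t) :* w)) :+ :- (q :* (Q :* s :+ t :* w))
             := (q :* Q) :* ((S :+ k) :+ :- s) :+ (con (pos 1) :+ q :*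
                 (con (pos 1) :+ q :* t)) :* w) refl q Q t S k w s ⟩
      (q * Q) * ((S + k) + - s) + (pos 1 + q * (pos 1 + q * t)) * w
        ≡⟨ cong (λ z → (q * Q) * (z + - s) + (pos 1 + q * (pos 1 + q * t)) * w) eq ⟩
      (q * Q) * ((q * x + s) + - s) + (pos 1 + q * (pos 1 + q * t)) * w
        ≡⟨ solve 5 (λ q Q x s r → (q :* Q) :* ((q :* x :+ s) :+ :- s) :+ r := (q :* (q :* Q)) :* x :+ r) refl q Q x s _ ⟩
      (q * (q * Q)) * x + (pos 1 + q * (pos 1 + q * t)) * w ∎
      where open ≡-Reasoning

    flat-identity : ∀ q Q s t w x → s + t ≡ q * x + w → (Q * s + Q * t) + - (Q * w) ≡ (q * Q) * x
    flat-identity q Q s t w x eq = begin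
      (Q * s + Q * t) + - (Q * w)     ≡⟨ solve 4 (λ Q s t w → (Q :* s :+ Q :* t) :+ :- (Q :* w) := Q :* ((s :+ t) :+ :- w)) refl Q s t w ⟩
      Q * ((s + t) + - w)             ≡⟨ cong (λ z → Q * (z + - w)) eq ⟩
      Q * ((q * x + w) + - w)         ≡⟨ solve 4 (λ q Q x s → Q :* ((q :* x :+ s) :+ :- s) := (q :* Q) :* x) refl q Q x w ⟩
      (q * Q) * x                     ∎
      where open ≡-Reasoning

    -- Inside a fixed E of dimension r + 2, the pencils through L give q ^ j [L] ≡ - θ j [E] modulo the span of the
    -- (r + 1)-spaces, for L of dimension r + 1 - j.
    module _ {n r : ℕ} {ws : Vec (V n) (suc (suc r))} (liE : LinIndep ws) where

      private
        Span-row : ∀ {k} → k ≡ suc r → (us : Vec (V n) k) → LinIndep us → Span (Proj n (suc r)) (λ u → ind us (proj₁ u))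
        Span-row refl us li = gen (us , li)

        pad : ∀ x y → x ≡ pos 1 * x + pos 0 * y
        pad = solve 2 (λ x y → x := con (pos 1) :* x :+ con (pos 0) :* y) refl

        base : ∀ q x y → q * x + y ≡ (q * pos 1) * x + (pos 1 + q * pos 0) * y
        base = solve 3 (λ q x y → q :* x :+ y := (q :* con (pos 1)) :* x :+ (con (pos 1) :+ q :* con (pos 0)) :* y) refl

      descend : ∀ j {m} (vs : Vec (V n) m) → m ℕ.+ j ≡ suc r → LinIndep vs → (∀ i → In ws (lookup vs i)) →
        Span (Proj n (suc r)) (λ u → Q j * ind vs (proj₁ u) + θ j * ind ws (proj₁ u))
      descend zero {m} vs eq li sub = ext (λ u → pad (ind vs (proj₁ u)) (ind ws (proj₁ u)))
          (Span-row (trans (sym (ℕₚ.+-identityʳ m)) eq) vs li)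
      descend (suc zero) {m} vs eq li sub with extend₂ liE li
          (ℕₚ.≤-reflexive (cong suc (trans (sym (ℕₚ.+-comm m 1)) eq)))
      ... | e₁ , e₂ , li₂ , e₁∈ , e₂∈ = ext final (add (Span-∑ q (λ x → Span-row m≡r ((e₁ ⊕ (x ⊙ e₂)) ∷ vs)
          (pencil-indep li₂ x))) (Span-row m≡r (e₂ ∷ vs) (LinIndep-tail li₂)))
        where
        m≡r : suc m ≡ suc r
        m≡r = trans (sym (ℕₚ.+-comm m 1)) eq
        inE : ∀ i → In ws (lookup (e₁ ∷ e₂ ∷ vs) i)
        inE Fin.zero = e₁∈
        inE (Fin.suc Fin.zero) = e₂∈
        inE (Fin.suc (Fin.suc i)) = sub i
        -- Here L has codimension 2 in E, so e₁, e₂ and L already span E: a vector outside would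
        -- make r + 3 independent vectors in a space of dimension r + 2.
        whole : ∀ {u} → In ws u → In (e₁ ∷ e₂ ∷ vs) u
        whole {u} h with In? (e₁ ∷ e₂ ∷ vs) u
        ... | yes h' = h'
        ... | no ∉ = ⊥-elim (ℕₚ.<-irrefl (cong suc m≡r) (LinIndep-≤ (LinIndep-cons li₂ ∉)
            (λ { Fin.zero → h ; (Fin.suc i) → inE i })))
        final : ∀ u → ∑ q (λ x → ind ((e₁ ⊕ (x ⊙ e₂)) ∷ vs) (proj₁ u)) + ind (e₂ ∷ vs) (proj₁ u)
            ≡ Q 1 * ind vs (proj₁ u) + θ 1 * ind ws (proj₁ u)
        final (u , _) = trans (pencil-sum li₂ u)
            (trans (cong (pos q * ind vs u +_) (ind-⇔ (In-mono {ws = e₁ ∷ e₂ ∷ vs} inE) whole))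
          (base (pos q) (ind vs u) (ind ws u)))
      descend (suc (suc j)) {m} vs eq li sub =
        let e₁ , e₂ , li₂ , e₁∈ , e₂∈ = extend₂ liE li (s≤s (ℕₚ.≤-trans (ℕₚ.m≤m+n (suc m) (suc j)) (ℕₚ.≤-reflexive eq₁))) in
        ext (final li₂)
            (add (add (Span-∑ q (λ x → descend (suc j) ((e₁ ⊕ (x ⊙ e₂)) ∷ vs) eq₁ (pencil-indep li₂ x)
                (λ { Fin.zero → In-⊕ e₁∈ (In-⊙ x e₂∈) ; (Fin.suc i) → sub i })))
                      (descend (suc j) (e₂ ∷ vs) eq₁ (LinIndep-tail li₂) (λ { Fin.zero → e₂∈ ; (Fin.suc i) → sub i })))
                 (Span-neg (scale (pos q) (descend j (e₁ ∷ e₂ ∷ vs) eq₂ li₂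
                     (λ { Fin.zero → e₁∈ ; (Fin.suc Fin.zero) → e₂∈ ; (Fin.suc (Fin.suc i)) → sub i })))))
        where
        eq₁ : suc m ℕ.+ suc j ≡ suc r
        eq₁ = trans (sym (ℕₚ.+-suc m (suc j))) eq
        eq₂ : suc (suc m) ℕ.+ j ≡ suc r
        eq₂ = trans (cong suc (sym (ℕₚ.+-suc m j))) eq₁
        final : ∀ {e₁ e₂} → LinIndep (e₁ ∷ e₂ ∷ vs) → ∀ u →
            (∑ q (λ x → Q (suc j) * ind ((e₁ ⊕ (x ⊙ e₂)) ∷ vs) (proj₁ u) + θ (suc j) * ind ws (proj₁ u))
            + (Q (suc j) * ind (e₂ ∷ vs) (proj₁ u) + θ (suc j) * ind ws (proj₁ u)))
            + - (pos q * (Q j * ind (e₁ ∷ e₂ ∷ vs) (proj₁ u) + θ j * ind ws (proj₁ u)))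
            ≡ Q (suc (suc j)) * ind vs (proj₁ u) + θ (suc (suc j)) * ind ws (proj₁ u)
        final {e₁} {e₂} li₂ (u , _) = trans (cong (λ z → (z + (Q (suc j) * ind (e₂ ∷ vs) u + θ (suc j) * ind ws u))
            + - (pos q * (Q j * ind (e₁ ∷ e₂ ∷ vs) u + θ j * ind ws u)))
            (trans (∑-distrib-+ q (λ x → Q (suc j) * ind ((e₁ ⊕ (x ⊙ e₂)) ∷ vs) u) (λ _ → θ (suc j) * ind ws u))
              (cong₂ _+_ (sym (*-distribˡ-∑ q (Q (suc j)) (λ x → ind ((e₁ ⊕ (x ⊙ e₂)) ∷ vs) u)))
                  (∑-const q (θ (suc j) * ind ws u)))))
          (descend-identity (pos q) (Q j) (θ j) _ _ (ind ws u) _ (ind vs u) (pencil-sum li₂ u))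

      -- The columns are nonzero vectors, so the indicator of the zero space drops out of the last
      -- relation.
      Span-E : Span (Proj n (suc r)) (λ u → ind ws (proj₁ u))
      Span-E = cancel (θ-unit r) (ext (λ { (u , u≢0) → trans (cong (λ z → Q (suc r) * z + θ (suc r) * ind ws u)
          (ind-no (λ { ([] , eq) → u≢0 eq })))
        (trans (cong (_+ (θ (suc r) * ind ws u)) (zeroʳ _)) (+-identityˡ _)) }) (descend (suc r) [] refl
            (λ { [] _ → refl }) (λ ())))

    -- `suc r < n` leaves room for two further directions, whose pencil relation is solved for q
    -- [D].
    Span-qD : ∀ {n r} → suc r < n → {vs : Vec (V n) r} → LinIndep vs → Span (Proj n (suc r)) (λ u → pos q * ind vs
        (proj₁ u))
    Span-qD {n} {r} lt {vs} li with extend₂ {ws = proj₁ (standardBasis n)} (proj₂ (standardBasis n)) li lt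
    ... | e₁ , e₂ , li₂ , _ = ext (λ { (u , _) → trans (cong (_+ - ind (e₁ ∷ e₂ ∷ vs) u) (pencil-sum li₂ u))
        (solve 2 (λ x y → (x :+ y) :+ :- y := x) refl _ _) })
      (add (add (Span-∑ q (λ x → gen ((e₁ ⊕ (x ⊙ e₂)) ∷ vs , pencil-indep li₂ x))) (gen (e₂ ∷ vs , LinIndep-tail li₂)))
          (Span-neg (Span-E li₂)))

    -- No fixed E has to be carried along, unlike in `descend`: the join of a pencil is cut into
    -- translates of ⟨e₂, vs⟩ along e₁, which have the dimension of the pencil members, so the same
    -- induction hypothesis covers them.
    Span-flat : ∀ {n r} → r < n → ∀ j {m} (vs : Vec (V n) m) → m ℕ.+ j ≡ r → LinIndep vs → ∀ a →
      Span (Aff n r) (λ x → Q j * ind vs (x ⊖ a))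
    Span-flat {n} {r} lt zero {m} vs eq li a = ext (λ x → sym (*-identityˡ _))
        (row (trans (sym (ℕₚ.+-identityʳ m)) eq) vs li)
      where
      row : ∀ {k} → k ≡ r → (us : Vec (V n) k) → LinIndep us → Span (Aff n r) (λ x → ind us (x ⊖ a))
      row refl us li = gen (a , us , li)
    Span-flat {n} {r} lt (suc j) {m} vs eq li a
      with extend₂ {ws = proj₁ (standardBasis n)} (proj₂ (standardBasis n)) li
          (ℕₚ.≤-<-trans (ℕₚ.≤-trans (ℕₚ.m≤m+n (suc m) j) (ℕₚ.≤-reflexive (trans (sym (ℕₚ.+-suc m j)) eq))) lt)
    ... | e₁ , e₂ , li₂ , _ = ext final
        (add (add (Span-∑ q (λ c → Span-flat lt j ((e₁ ⊕ (c ⊙ e₂)) ∷ vs) eq₁ (pencil-indep li₂ c) a))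
                  (Span-flat lt j (e₂ ∷ vs) eq₁ (LinIndep-tail li₂) a))
             (Span-neg (Span-∑ q (λ c → Span-flat lt j (e₂ ∷ vs) eq₁ (LinIndep-tail li₂) (a ⊕ (c ⊙ e₁))))))
      where
      eq₁ : suc m ℕ.+ j ≡ r
      eq₁ = trans (sym (ℕₚ.+-suc m j)) eq
      final : ∀ x → (∑ q (λ c → Q j * ind ((e₁ ⊕ (c ⊙ e₂)) ∷ vs) (x ⊖ a)) + Q j * ind (e₂ ∷ vs) (x ⊖ a))
          + - ∑ q (λ c → Q j * ind (e₂ ∷ vs) (x ⊖ (a ⊕ (c ⊙ e₁)))) ≡ Q (suc j) * ind vs (x ⊖ a)
      final x = trans (cong₂ (λ s t → (s + Q j * ind (e₂ ∷ vs) (x ⊖ a)) + - t)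
          (sym (*-distribˡ-∑ q (Q j) (λ c → ind ((e₁ ⊕ (c ⊙ e₂)) ∷ vs) (x ⊖ a))))
          (trans (sym (*-distribˡ-∑ q (Q j) (λ c → ind (e₂ ∷ vs) (x ⊖ (a ⊕ (c ⊙ e₁))))))
            (cong (Q j *_) (trans (∑-cong q (λ c → cong (ind (e₂ ∷ vs)) (sym (⊖-⊖ x a (c ⊙ e₁)))))
                (sym (parallel-sum li₂ (x ⊖ a)))))))
        (flat-identity (pos q) (Q j) _ _ _ (ind vs (x ⊖ a)) (pencil-sum li₂ (x ⊖ a)))

  -- Splitting off the hyperplane at infinity

  module Decomposition {q : ℕ} (F : FiniteField q) (p : ℕ) (prime : Prime p) (p∣q : pos p ∣ pos q) where
    open FiniteField F using (0≢1; inverse; isCommutativeRing; 0#; 1#) renaming (_+_ to _+ᶠ_; _*_ to _*ᶠ_; -_ to -ᶠ_)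
    open LinAlg F
    open VectorSpace F
    open Local p prime
    open Incidence F p prime p∣q
    private module 𝔽 = IntegerCoefficients isCommutativeRing

    ⊖-zeroV : ∀ {n} (x : V n) → x ⊖ zeroV ≡ x
    ⊖-zeroV [] = refl
    ⊖-zeroV (x ∷ xs) = cong₂ _∷_ (trans (cong (x +ᶠ_) 𝔽.-0#≈0#) (𝔽.+-identityʳ x)) (⊖-zeroV xs)

    ⊙-distrib-⊖ : ∀ {n} s (x y : V n) → s ⊙ (x ⊖ y) ≡ (s ⊙ x) ⊖ (s ⊙ y)
    ⊙-distrib-⊖ s [] [] = refl
    ⊙-distrib-⊖ s (x ∷ xs) (y ∷ ys) = cong₂ _∷_
      (𝔽.solve 3 (λ s x y → s 𝔽.:* (x 𝔽.:+ 𝔽.:- y) 𝔽.:= s 𝔽.:* x 𝔽.:+ 𝔽.:- (s 𝔽.:* y)) refl s x y) (⊙-distrib-⊖ s xs ys)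

    In-cons-elim : ∀ {n k l} {w : V n} {ws : Vec (V n) k} {us : Vec (V n) l} → In us w →
        (∀ {x} → In ws x → In us x) → ∀ {x} → In (w ∷ ws) x → In us x
    In-cons-elim w∈ h (b ∷ c , refl) = In-⊕ (In-⊙ b w∈) (h (c , refl))

    module _ {n r : ℕ} (lt : suc r < n) where

      -- ∑ over c ≠ 0 of [c u ∈ a + D], plus [u ∈ D]: this is q [u ∈ D] if the flat passes through 0, and
      -- [u ∈ ⟨a, D⟩] otherwise.
      correction : V n × Basis n r → V n → ℤ
      correction (a , vs , _) u = ind vs u + (∑ q (λ c → ind vs ((c ⊙ u) ⊖ a)) + - ind vs (zeroV ⊖ a))

      -- The flat is D itself. All q multiples c u lie in it if u ∈ D, and only the one with c = 0,
      -- which is subtracted, otherwise.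
      correction-through-0 : ∀ {a vs li} → In vs a → ∀ u → correction (a , vs , li) u ≡ pos q * ind vs u
      correction-through-0 {a} {vs} a∈ u with In? vs u
      ... | yes u∈ = trans (cong₂ _+_ (ind-yes u∈) (cong₂ (λ s t → s + - t)
          (trans (∑-cong q (λ c → ind-yes (In-⊖ (In-⊙ c u∈) a∈))) (∑-const q (pos 1)))
              (ind-yes (In-⊖ (In-zero vs) a∈))))
          (trans (solve 1 (λ q → con (pos 1) :+ (q :* con (pos 1) :+ :- con (pos 1)) := q :* con (pos 1)) refl (pos q))
              (cong (pos q *_) (sym (ind-yes u∈))))
      ... | no u∉ = trans (cong₂ _+_ (ind-no u∉) (cong₂ (λ s t → s + - t)
          (trans (∑-single q 0# (λ c c≢0 → ind-no (λ h → c≢0 (scalar-zero u∉ (subst (In vs) (⊖-⊕-cancelʳ (c ⊙ u) a)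
              (In-⊕ h a∈))))))
            (ind-yes (subst (λ z → In vs (z ⊖ a)) (sym (zero-⊙ u)) (In-⊖ (In-zero vs) a∈))))
          (ind-yes (In-⊖ (In-zero vs) a∈))))
          (trans (solve 1 (λ q → con (pos 0) :+ (con (pos 1) :+ :- con (pos 1)) := q :* con (pos 0)) refl (pos q))
              (cong (pos q *_) (sym (ind-no u∉))))

      -- A line through 0 in ⟨a, D⟩ but not in D meets a + D exactly once, namely in u divided by
      -- its coordinate along a; lines in D never meet it and are counted by the separate summand.
      correction-off-0 : ∀ {a vs li} → ¬ In vs a → ∀ u → correction (a , vs , li) u ≡ ind (a ∷ vs) u
      correction-off-0 {a} {vs} {li} a∉ u = trans (cong (λ z → ind vs u + (∑ q (λ c → ind vs ((c ⊙ u) ⊖ a)) + - z))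
          (ind-no zero∉))
          (trans (solve 2 (λ x s → x :+ (s :+ :- con (pos 0)) := x :+ s) refl _ _) count)
        where
        neg∈ : In vs (zeroV ⊖ a) → In vs a
        neg∈ h = subst (In vs) (⊖-⊖-swap zeroV a) (In-⊖ (In-zero vs) h)
        zero∉ : ¬ In vs (zeroV ⊖ a)
        zero∉ h = a∉ (neg∈ h)
        count : ind vs u + ∑ q (λ c → ind vs ((c ⊙ u) ⊖ a)) ≡ ind (a ∷ vs) u
        count with In? (a ∷ vs) u
        ... | no u∉ = trans (cong₂ _+_ (ind-no (u∉ ∘ In-there {e = a})) (∑-zero q (λ c → ind-no (never c))))
            (trans (+-identityˡ _) (sym (ind-no u∉)))
          where
          never : ∀ c → ¬ In vs ((c ⊙ u) ⊖ a)
          never c h with c Fin.≟ 0#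
          ... | yes refl = zero∉ (subst (λ z → In vs (z ⊖ a)) (zero-⊙ u) h)
          ... | no c≢0 = u∉ (subst (In (a ∷ vs)) (invert (proj₂ (inverse c c≢0)) u) (In-⊙ (proj₁ (inverse c c≢0))
                  (subst (In (a ∷ vs)) (⊖-⊕-cancelʳ (c ⊙ u) a) (In-⊕ (In-there {e = a} h) (In-here a vs)))))
        ... | yes u∈@(b ∷ w , eq) with b Fin.≟ 0#
        ... | yes refl = trans (cong₂ _+_ (ind-yes u∈vs)
            (∑-zero q (λ c → ind-no (λ h → a∉ (subst (In vs) (⊖-⊖-swap (c ⊙ u) a) (In-⊖ (In-⊙ c u∈vs) h))))))
                (trans (+-identityʳ _) (sym (ind-yes u∈)))
          where
          u∈vs : In vs u
          u∈vs = w , trans eq (zero-⊕ a _)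
        ... | no b≢0 = trans (cong₂ _+_ (ind-no u∉vs) (trans (∑-single q y other) (ind-yes on))) (trans (+-identityˡ _)
            (sym (ind-yes u∈)))
          where
          y : Fin q
          y = proj₁ (inverse b b≢0)
          by≡1 : b *ᶠ y ≡ 1#
          by≡1 = proj₂ (inverse b b≢0)
          residue : u ⊖ (b ⊙ a) ≡ lincomb w vs
          residue = trans (cong (_⊖ (b ⊙ a)) eq) (⊕-⊖-cancel _ _)
          u∉vs : ¬ In vs u
          u∉vs h = b≢0 (scalar-zero a∉ (subst (In vs) (⊖-⊖-swap u (b ⊙ a)) (In-⊖ h (w , residue))))
          on : In vs ((y ⊙ u) ⊖ a)
          on = subst (In vs) (trans (⊙-distrib-⊖ y u (b ⊙ a)) (cong ((y ⊙ u) ⊖_) (invert by≡1 a)))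
              (In-⊙ y (w , residue))
          other : ∀ c → c ≢ y → ind vs ((c ⊙ u) ⊖ a) ≡ pos 0
          other c c≢y = ind-no (λ h → c≢y (collinear (scalar-zero u∉vs (subst (In vs) (two c y u a) (In-⊖ h on)))))
            where
            two : ∀ {n} c y (u a : V n) → ((c ⊙ u) ⊖ a) ⊖ ((y ⊙ u) ⊖ a) ≡ (c +ᶠ (-ᶠ y)) ⊙ u
            two c y [] [] = refl
            two c y (u ∷ us) (a ∷ as) = cong₂ _∷_ (𝔽.solve 4 (λ c y u a → (c 𝔽.:* u 𝔽.:+ 𝔽.:- a) 𝔽.:+ 𝔽.:-
                (y 𝔽.:* u 𝔽.:+ 𝔽.:- a)
              𝔽.:= (c 𝔽.:+ 𝔽.:- y) 𝔽.:* u) refl c y u a) (two c y us as)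
            collinear : c +ᶠ (-ᶠ y) ≡ 0# → c ≡ y
            collinear e = trans (𝔽.solve 2 (λ c y → c 𝔽.:= (c 𝔽.:+ 𝔽.:- y) 𝔽.:+ y) refl c y) (trans (cong (_+ᶠ y) e)
                (𝔽.+-identityˡ y))

      Span-correction : ∀ f → Span (Proj n (suc r)) (λ u → correction f (proj₁ u))
      Span-correction f@(a , vs , li) with In? vs a
      ... | yes a∈ = ext (λ u → sym (correction-through-0 {li = li} a∈ (proj₁ u))) (Span-qD lt li)
      ... | no a∉ = ext (λ u → sym (correction-off-0 {li = li} a∉ (proj₁ u))) (gen (a ∷ vs , LinIndep-cons li a∉))

      Rows Cols : Set
      Rows = (V n × Basis n r) ⊎ Basis n (suc r)
      Cols = V n ⊎ NonZeroVec n

      atInfinity : Matrix Rows Cols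
      atInfinity (inj₁ f@(_ , vs , _)) = [ Aff n r f , (λ u → ind vs (proj₁ u)) ]′
      atInfinity (inj₂ S) = [ const (pos 0) , Proj n (suc r) S ]′

      -- The upper right block is -A₁X: minus the number of nonzero multiples of u on the flat. It
      -- is what remains after subtracting the correction, and it is a combination of affine
      -- columns.
      cleared : Matrix Rows Cols
      cleared (inj₁ f@(a , vs , _)) = [ Aff n r f , (λ u → ind vs (zeroV ⊖ a) + - ∑ q
          (λ c → ind vs ((c ⊙ proj₁ u) ⊖ a))) ]′
      cleared (inj₂ S) = [ const (pos 0) , Proj n (suc r) S ]′

      private
        lower : ∀ {N : Matrix Rows Cols} → (∀ S → Span N [ const (pos 0) , Proj n (suc r) S ]′) →
          ∀ {v} → Span (Proj n (suc r)) v → Span N [ const (pos 0) , v ]′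
        -- A block without rows supplies the zeros in the affine columns.
        lower h s = Span-mono {A = noRows ⊞ Proj n (suc r)} (λ { (inj₂ S) → h S }) (Span-inj₂ s)
          where
          noRows : Matrix ⊥ (V n)
          noRows ()

      atInfinity~cleared : atInfinity ~ cleared
      atInfinity~cleared = byRows to , byRows from
        where
        to : ∀ f → Span cleared (atInfinity f)
        to (inj₂ S) = gen (inj₂ S)
        to (inj₁ f@(a , vs , _)) = ext (λ { (inj₁ x) → +-identityʳ _ ; (inj₂ u) → solve 3 (λ z s i → (z :+ :- s) :+
            (i :+ (s :+ :- z)) := i) refl _ _ _ })
          (add (gen (inj₁ f)) (lower (λ S → gen (inj₂ S)) (Span-correction f)))
        from : ∀ f → Span atInfinity (cleared f)
        from (inj₂ S) = gen (inj₂ S)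
        from (inj₁ f@(a , vs , _)) = ext (λ { (inj₁ x) → trans (cong (ind vs (x ⊖ a) +_) -0#≈0#) (+-identityʳ _)
                                             ; (inj₂ u) → solve 3 (λ z s i → i :+ :-
                                                 (i :+ (s :+ :- z)) := z :+ :- s) refl _ _ _ })
          (add (gen (inj₁ f)) (Span-neg (lower (λ S → gen (inj₂ S)) (Span-correction f))))

      cleared~⊞ : cleared ~ Aff n r ⊞ Proj n (suc r)
      cleared~⊞ = byCols to , byCols from
        where
        D : Matrix Rows Cols
        D = Aff n r ⊞ Proj n (suc r)
        to : ∀ c → Span (flip D) (flip cleared c)
        to (inj₁ x) = ext (λ { (inj₁ f) → refl ; (inj₂ S) → refl }) (gen (inj₁ x))
        to (inj₂ u) = ext (λ { (inj₁ f) → +-identityˡ _ ; (inj₂ S) → trans (cong (ind (proj₁ S) (proj₁ u) +_) vanish)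
            (+-identityʳ _) })
          (add (gen (inj₂ u)) (add (gen (inj₁ zeroV)) (Span-neg (Span-∑ q (λ c → gen (inj₁ (c ⊙ proj₁ u)))))))
          where
          vanish : pos 0 + - ∑ q (λ _ → pos 0) ≡ pos 0
          vanish = trans (cong (λ z → pos 0 + - z) (∑-zero q (λ _ → refl))) (trans (+-identityˡ _) -0#≈0#)
        from : ∀ c → Span (flip cleared) (flip D c)
        from (inj₁ x) = ext (λ { (inj₁ f) → refl ; (inj₂ S) → refl }) (gen (inj₁ x))
        from (inj₂ u) = ext (λ { (inj₁ f) → solve 2 (λ z s → (z :+ :- s) :+ (s :+ :- z) := con (pos 0)) refl _ _
                               ; (inj₂ S) → trans (cong (ind (proj₁ S) (proj₁ u) +_) vanish) (+-identityʳ _) })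
          (add (gen (inj₂ u)) (add (Span-∑ q (λ c → gen (inj₁ (c ⊙ proj₁ u)))) (Span-neg (gen (inj₁ zeroV)))))
          where
          vanish : ∑ q (λ _ → pos 0) + - pos 0 ≡ pos 0
          vanish = trans (cong (_+ - pos 0) (∑-zero q (λ _ → refl))) (trans (+-identityˡ _) -0#≈0#)

    SameSpan : ∀ {n k l} → Vec (V n) k → Vec (V n) l → Set
    SameSpan ws us = (∀ {x} → In ws x → In us x) × (∀ {x} → In us x → In ws x)

    -- Row reduction for the first coordinate only: either the space lies at infinity, or it is the
    -- closure of a flat and has one basis vector with first coordinate 1.
    data Normalised {n} : ∀ {k} → Vec (V (suc n)) k → Set where
      inside : ∀ {k} {ws : Vec (V (suc n)) k} {vs : Vec (V n) k} → LinIndep vs → SameSpan ws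
          (Vec.map (0# ∷_) vs) → Normalised ws
      across : ∀ {k} {ws : Vec (V (suc n)) (suc k)} a {vs : Vec (V n) k} → LinIndep vs → SameSpan ws
          (cone a vs) → Normalised ws

    private
      scaled : ∀ {n} {y y'} → y *ᶠ y' ≡ 1# → (w : V n) → y ⊙ (1# ∷ (y' ⊙ w)) ≡ y ∷ w
      scaled {y = y} {y'} eq w = cong₂ _∷_ (𝔽.*-identityʳ y) (invert (trans (𝔽.*-comm y' y) eq) w)

      unscaled : ∀ {n} {y y'} → y *ᶠ y' ≡ 1# → (w : V n) → y' ⊙ (y ∷ w) ≡ 1# ∷ (y' ⊙ w)
      unscaled {y = y} {y'} eq w = cong (_∷ (y' ⊙ w)) (trans (𝔽.*-comm y' y) eq)

      split : ∀ {n} y (w a : V n) → (y ⊙ (1# ∷ a)) ⊕ (0# ∷ (w ⊖ (y ⊙ a))) ≡ y ∷ w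
      split y w a = cong₂ _∷_ (trans (𝔽.+-identityʳ _) (𝔽.*-identityʳ y)) (⊖-⊕-cancel _ w)

      unsplit : ∀ {n} y (w a : V n) → (y ∷ w) ⊖ (y ⊙ (1# ∷ a)) ≡ 0# ∷ (w ⊖ (y ⊙ a))
      unsplit y w a = cong (_∷ (w ⊖ (y ⊙ a))) (trans (cong (λ z → y +ᶠ (-ᶠ z)) (𝔽.*-identityʳ y)) (𝔽.-‿inverseʳ y))

    normalise : ∀ {n k} (ws : Vec (V (suc n)) k) → LinIndep ws → Normalised ws
    normalise [] li = inside {vs = []} (λ { [] _ → refl }) (id , id)
    normalise {n} ((y ∷ w) ∷ ws) li with normalise ws (LinIndep-tail li)
    -- The apex (1, a) found in the tail clears the first coordinate y of the new vector.
    ... | across a {vs} liv (f , g) = across a {(w ⊖ (y ⊙ a)) ∷ vs}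
        (LinIndep-cons liv (λ h → LinIndep-head li (g (In-cone⁻ h))))
        (In-cons-elim (subst (In us) (split y w a) (In-⊕ (In-⊙ y (In-here _ _)) (In-there {e = 1# ∷ a} (In-here _ _))))
           (λ h → In-cons-elim (In-here _ _) (λ h' → In-there {e = 1# ∷ a} (In-there {e = 0# ∷ (w ⊖ (y ⊙ a))} h'))
               (f h)) ,
         In-cons-elim top (In-cons-elim
           (subst (In ((y ∷ w) ∷ ws)) (unsplit y w a) (In-⊖ (In-here _ ws) (In-⊙ y top)))
           (λ h → In-there {e = y ∷ w} (g (In-there {e = 1# ∷ a} h)))))
      where
      us : Vec (V (suc n)) _
      us = cone a ((w ⊖ (y ⊙ a)) ∷ vs)
      top : In ((y ∷ w) ∷ ws) (1# ∷ a)
      top = In-there {e = y ∷ w} (g (In-here _ _))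
    ... | inside {vs = vs} liv (f , g) with y Fin.≟ 0#
    ... | yes refl = inside {vs = w ∷ vs} (LinIndep-cons liv (λ h → LinIndep-head li (g (In-0∷ h))))
        (In-cons-elim (In-here _ _) (λ h → In-there {e = 0# ∷ w} (f h)) , In-cons-elim (In-here _ _)
            (λ h → In-there {e = 0# ∷ w} (g h)))
    -- The tail lies at infinity, so the new vector, scaled to first coordinate 1, becomes the apex.
    ... | no y≢0 = across (y' ⊙ w) liv
        (In-cons-elim (subst (In (cone (y' ⊙ w) vs)) (scaled yy' w) (In-⊙ y (In-here _ _)))
            (λ h → In-there {e = 1# ∷ (y' ⊙ w)} (f h)) ,
         In-cons-elim (subst (In ((y ∷ w) ∷ ws)) (unscaled yy' w) (In-⊙ y' (In-here _ ws))) (λ h → In-there {e = y ∷ w}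
             (g h)))
      where
      y' : Fin q
      y' = proj₁ (inverse y y≢0)
      yy' : y *ᶠ y' ≡ 1#
      yy' = proj₂ (inverse y y≢0)

    ind-0∷ : ∀ {n k} {vs : Vec (V n) k} u → ind (Vec.map (0# ∷_) vs) (0# ∷ u) ≡ ind vs u
    ind-0∷ u = ind-⇔ (λ h → proj₂ (In-0∷⁻ h)) In-0∷

    ind-0∷-≢ : ∀ {n k} {vs : Vec (V n) k} {y} u → y ≢ 0# → ind (Vec.map (0# ∷_) vs) (y ∷ u) ≡ pos 0
    ind-0∷-≢ u y≢0 = ind-no (λ h → y≢0 (proj₁ (In-0∷⁻ h)))

    ind-cone-0 : ∀ {n k} a {vs : Vec (V n) k} u → ind (cone a vs) (0# ∷ u) ≡ ind vs u
    ind-cone-0 a {vs} u = ind-⇔ (λ h → subst (In vs) eq (In-cone h)) (λ h → In-cone⁻ (subst (In vs) (sym eq) h))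
      where
      eq : u ⊖ (0# ⊙ a) ≡ u
      eq = trans (cong (u ⊖_) (zero-⊙ a)) (⊖-zeroV u)

    ind-cone : ∀ {n k} a {vs : Vec (V n) k} {y y'} u → y *ᶠ y' ≡ 1# → ind (cone a vs) (y ∷ u) ≡ ind vs ((y' ⊙ u) ⊖ a)
    ind-cone a {vs} {y} {y'} u yy' = ind-⇔ (λ h → subst (In vs) down (In-⊙ y' (In-cone h)))
        (λ h → In-cone⁻ (subst (In vs) up (In-⊙ y h)))
      where
      down : y' ⊙ (u ⊖ (y ⊙ a)) ≡ (y' ⊙ u) ⊖ a
      down = trans (⊙-distrib-⊖ y' u _) (cong ((y' ⊙ u) ⊖_) (invert yy' a))
      up : y ⊙ ((y' ⊙ u) ⊖ a) ≡ u ⊖ (y ⊙ a)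
      up = trans (⊙-distrib-⊖ y _ a) (cong (_⊖ (y ⊙ a)) (invert (trans (𝔽.*-comm y' y) yy') u))

    module _ {n r : ℕ} (lt : suc r < n) where

      -- Rows are matched through their normal forms, and a vector (y, x) with y nonzero is sent to
      -- the affine point x/y. The entries agree under the maps in either direction, which is all
      -- that `~` asks.
      Proj~atInfinity : Proj (suc n) (suc r) ~ atInfinity lt
      Proj~atInfinity = ≼-reindex (λ S → φ S (normalise (proj₁ S) (proj₂ S))) (λ u → ψ u (Vec.head (proj₁ u) Fin.≟ 0#))
                          (λ S u → φψ S (normalise (proj₁ S) (proj₂ S)) u (Vec.head (proj₁ u) Fin.≟ 0#))
                      , ≼-reindex φ' ψ' φψ'
        where
        φ : ∀ (S : Basis (suc n) (suc r)) → Normalised (proj₁ S) → Rows lt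
        φ S (inside {vs = vs} li _) = inj₂ (vs , li)
        φ S (across a {vs} li _) = inj₁ (a , vs , li)
        ψ : ∀ (u : NonZeroVec (suc n)) → Dec (Vec.head (proj₁ u) ≡ 0#) → Cols lt
        ψ (y ∷ x , ne) (yes refl) = inj₂ (x , λ eq → ne (cong (0# ∷_) eq))
        ψ (y ∷ x , ne) (no y≢0) = inj₁ (proj₁ (inverse y y≢0) ⊙ x)
        φψ : ∀ S (N : Normalised (proj₁ S)) u d → Proj (suc n) (suc r) S u ≡ atInfinity lt (φ S N) (ψ u d)
        φψ S (inside li (f , g)) (y ∷ x , ne) (yes refl) = trans (ind-⇔ f g) (ind-0∷ x)
        φψ S (inside li (f , g)) (y ∷ x , ne) (no y≢0) = trans (ind-⇔ f g) (ind-0∷-≢ x y≢0)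
        φψ S (across a li (f , g)) (y ∷ x , ne) (yes refl) = trans (ind-⇔ f g) (ind-cone-0 a x)
        φψ S (across a li (f , g)) (y ∷ x , ne) (no y≢0) = trans (ind-⇔ f g) (ind-cone a x (proj₂ (inverse y y≢0)))
        φ' : Rows lt → Basis (suc n) (suc r)
        φ' (inj₁ (a , vs , li)) = cone a vs , LinIndep-cone a li
        φ' (inj₂ (vs , li)) = Vec.map (0# ∷_) vs , LinIndep-0∷ li
        ψ' : Cols lt → NonZeroVec (suc n)
        ψ' (inj₁ x) = 1# ∷ x , λ eq → 0≢1 (sym (cong Vec.head eq))
        ψ' (inj₂ (u , ne)) = 0# ∷ u , λ eq → ne (cong Vec.tail eq)
        φψ' : ∀ f c → atInfinity lt f c ≡ Proj (suc n) (suc r) (φ' f) (ψ' c)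
        φψ' (inj₁ (a , vs , li)) (inj₁ x) = sym (trans (ind-cone a x (𝔽.*-identityʳ 1#)) (cong (λ z → ind vs (z ⊖ a))
            (one-⊙ x)))
        φψ' (inj₁ (a , vs , li)) (inj₂ (u , ne)) = sym (ind-cone-0 a u)
        φψ' (inj₂ (vs , li)) (inj₁ x) = sym (ind-0∷-≢ x (0≢1 ∘ sym))
        φψ' (inj₂ (vs , li)) (inj₂ (u , ne)) = sym (ind-0∷ u)

      decomposition : Proj (suc n) (suc r) ~ Aff n r ⊞ Proj n (suc r)
      decomposition = ~-trans Proj~atInfinity (~-trans (atInfinity~cleared lt) (cleared~⊞ lt))

  -- Transfer to enumerated incidence matrices

  module Enumerated {q : ℕ} (F : FiniteField q) (p : ℕ) (prime : Prime p) (p∣q : pos p ∣ pos q) where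
    open FiniteField F using (0≢1; 0#; 1#)
    open LinAlg F
    open VectorSpace F
    open Local p prime
    open Incidence F p prime p∣q
    open Equivalence using (to; from)

    does-⇔ : ∀ {X : Set} (d : Dec X) → (does d ≡ true) ⇔ X
    does-⇔ (yes x) = mk⇔ (λ _ → x) (λ _ → refl)
    does-⇔ (no ¬x) = mk⇔ (λ ()) (λ x → ⊥-elim (¬x x))

    ⇔-resp : ∀ {b b' : Bool} {X : Set} → b ≡ b' → (b ≡ true) ⇔ X → (b' ≡ true) ⇔ X
    ⇔-resp refl e = e

    true? : ∀ b → (b ≡ true) ⊎ (b ≡ false)
    true? true = inj₁ refl
    true? false = inj₂ refl

    false≢true : ∀ {b} → b ≡ false → ¬ b ≡ true
    false≢true refl ()

    module _ {N i : ℕ} (W : SubspaceIncidence N i) where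
      open SubspaceIncidence W

      subspace-entry : ∀ {vs : Vec (V (suc N)) i} {u} j k → (∀ x → (sp j x ≡ true) ⇔ In vs x) →
          (∀ x → (pt k x ≡ true) ⇔ In (u ∷ []) x) →
        M j k ≡ ind vs u
      subspace-entry {vs} {u} j k eS eP with In? vs u
      ... | yes u∈ = trans (M-inc j k (λ x h → from (eS x) (multiple (to (eP x) h)))) (sym (ind-yes u∈))
        where
        multiple : ∀ {x} → In (u ∷ []) x → In vs x
        multiple (c ∷ [] , refl) = In-⊕ (In-⊙ c u∈) (In-zero vs)
      ... | no u∉ = trans (M-out j k (λ h → u∉ (to (eS u) (h u (from (eP u) (In-here u []))))) ) (sym (ind-no u∉))

      private
        basis : Fin nRows → Basis (suc N) i
        basis j = proj₁ (sp-sub j) , proj₁ (proj₂ (sp-sub j))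

        generator : ∀ {P} → IsSubspace 1 P → NonZeroVec (suc N)
        generator (u ∷ [] , li , _) = u , λ eq → LinIndep-head li ([] , eq)

        generator-⇔ : ∀ {P} (s : IsSubspace 1 P) x → (P x ≡ true) ⇔ In (proj₁ (generator s) ∷ []) x
        generator-⇔ (u ∷ [] , li , e) = e

        spanOf : ∀ {k} → Basis (suc N) k → Σ (V (suc N) → Bool) (IsSubspace k)
        spanOf (vs , li) = (λ x → does (In? vs x)) , vs , li , λ x → does-⇔ (In? vs x)

        line : NonZeroVec (suc N) → Basis (suc N) 1
        line (u , u≢0) = u ∷ [] , LinIndep-cons {vs = []} (λ { [] _ → refl }) (λ { ([] , eq) → u≢0 eq })

        rowOf : Basis (suc N) i → Fin nRows
        rowOf B = proj₁ (sp-sur (proj₁ (spanOf B)) (proj₂ (spanOf B)))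

        colOf : NonZeroVec (suc N) → Fin nCols
        colOf u = proj₁ (pt-sur (proj₁ (spanOf (line u))) (proj₂ (spanOf (line u))))

      -- One direction takes the basis stored with an enumerated subspace, the other looks up the
      -- span of a given basis in the enumeration.
      subspaceMatrix~ : M ~ Proj (suc N) i
      subspaceMatrix~ =
        ≼-reindex basis (λ k → generator (pt-sub k)) (λ j k → subspace-entry j k (proj₂ (proj₂ (sp-sub j)))
            (generator-⇔ (pt-sub k))) ,
        ≼-reindex rowOf colOf (λ B u → sym (subspace-entry (rowOf B) (colOf u)
          (λ x → ⇔-resp (proj₂ (sp-sur (proj₁ (spanOf B)) (proj₂ (spanOf B))) x) (does-⇔ (In? (proj₁ B) x)))
          (λ x → ⇔-resp (proj₂ (pt-sur (proj₁ (spanOf (line u))) (proj₂ (spanOf (line u)))) x)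
              (does-⇔ (In? (proj₁ u ∷ []) x)))))

    module _ {n r : ℕ} (A : FlatIncidence n r) where
      open FlatIncidence A

      flat-⇔ : ∀ {vs : Vec (V n) r} {a x} {X : Set} → X ⇔ (∃ λ c → x ≡ a ⊕ lincomb c vs) → X ⇔ In vs (x ⊖ a)
      flat-⇔ {vs} {a} {x} e = mk⇔ (λ h → let c , eq = to e h in c , trans (cong (_⊖ a) eq) (⊕-⊖-cancel a _))
        (λ { (c , eq) → from e (c , trans (sym (⊖-⊕-cancel a x)) (cong (a ⊕_) eq)) })

      flat-entry : ∀ {vs : Vec (V n) r} {a} j k → (∀ x → (fl j x ≡ true) ⇔ In vs (x ⊖ a)) → M j k ≡ ind vs (pt k ⊖ a)
      flat-entry j k e with true? (fl j (pt k))
      ... | inj₁ t = trans (M-inc j k t) (sym (ind-yes (to (e (pt k)) t)))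
      ... | inj₂ f = trans (M-out j k f) (sym (ind-no (λ h → false≢true f (from (e (pt k)) h))))

      private
        flatOf : V n × Basis n r → Σ (V n → Bool) (IsFlat r)
        flatOf (a , vs , li) = (λ x → does (In? vs (x ⊖ a))) , a , vs , li , λ x → mk⇔
          (λ h → let c , eq = to (does-⇔ (In? vs (x ⊖ a))) h in c , trans (sym (⊖-⊕-cancel a x)) (cong (a ⊕_) eq))
          (λ { (c , eq) → from (does-⇔ (In? vs (x ⊖ a))) (c , trans (cong (_⊖ a) eq) (⊕-⊖-cancel a _)) })

        rowOf : V n × Basis n r → Fin nRows
        rowOf f = proj₁ (fl-sur (proj₁ (flatOf f)) (proj₂ (flatOf f)))

      rowOf-entry : ∀ f k → M (rowOf f) k ≡ Aff n r f (pt k)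
      rowOf-entry f@(a , vs , li) k = flat-entry (rowOf f) k
        (λ x → ⇔-resp (proj₂ (fl-sur (proj₁ (flatOf f)) (proj₂ (flatOf f))) x) (does-⇔ (In? vs (x ⊖ a))))

      flatMatrix~ : M ~ Aff n r
      flatMatrix~ =
        ≼-reindex (λ j → let a , vs , li , _ = fl-flat j in a , vs , li) pt
          (λ j k → flat-entry j k (λ x → flat-⇔ (proj₂ (proj₂ (proj₂ (fl-flat j))) x))) ,
        ≼-reindex rowOf (λ x → proj₁ (pt-sur x))
          (λ f x → sym (trans (rowOf-entry f (proj₁ (pt-sur x))) (cong (Aff n r f) (proj₂ (pt-sur x)))))

      -- Equivalence alone forgets which column is which, whereas `fullRank-sum` needs the vectors
      -- p^b δ_y of the enumerated columns themselves; so span membership is pulled back along `pt`.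
      Span-columns : ∀ {v} → Span (Aff n r) v → Span M (λ k → v (pt k))
      Span-columns (gen f) = ext (rowOf-entry f) (gen (rowOf f))
      Span-columns zero = zero
      Span-columns (add s t) = add (Span-columns s) (Span-columns t)
      Span-columns (scale c s) = scale c (Span-columns s)
      Span-columns (ext eq s) = ext (λ k → eq (pt k)) (Span-columns s)
      Span-columns (cancel u s) = cancel u (Span-columns s)

      open Invariants p prime using (δ; δ-refl; δ-≢)

      ind-δ : ∀ y k → ind {k = 0} [] (pt k ⊖ pt y) ≡ δ y k
      ind-δ y k with y Fin.≟ k
      ... | yes refl = trans (ind-yes ([] , ⊖-self (pt y))) (sym (δ-refl y))
      ... | no y≢k = trans (ind-no (λ { ([] , eq) → y≢k (pt-inj y k (sym (trans (sym (⊖-⊕-cancel (pt y) (pt k)))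
          (trans (cong (pt y ⊕_) eq) (⊕-zeroV (pt y)))))) })) (sym (δ-≢ y≢k))

      Span-point : r < n → ∀ y → Span M (λ k → Q r * δ y k)
      Span-point lt y = ext (λ k → cong (Q r *_) (ind-δ y k)) (Span-columns (Span-flat lt r [] refl (λ { [] _ → refl })
          (pt y)))

    invariantFactors : ∀ t → q ≡ p ^ t → ∀ {n r} → suc r < suc n →
      (A : FlatIncidence (suc n) r) (W : SubspaceIncidence (suc n) (suc r)) (W' : SubspaceIncidence n (suc r)) →
      (∀ α → invMult p (FlatIncidence.M A) α ℕ.+ invMult p (SubspaceIncidence.M W') α
        ≡ invMult p (SubspaceIncidence.M W) α)
      × sumUpTo (r ℕ.* t) (invMult p (FlatIncidence.M A)) ≡ FlatIncidence.nCols A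
    invariantFactors t q≡ {n} {r} lt A W W' =
        invMult-⊞ (~-trans (subspaceMatrix~ W) (~-trans (decomposition lt)
          (~-sym (⊞-cong (flatMatrix~ A) (subspaceMatrix~ W'))))) ,
        fullRank-sum (r ℕ.* t) (λ y → ext (λ k → cong (_* δ y k) (Q-P r)) (Span-point A (ℕₚ.<-trans (ℕₚ.n<1+n r) lt) y))
      where
      open Invariants p prime
      open Decomposition F p prime p∣q
      Q-P : ∀ j → Q j ≡ P (j ℕ.* t)
      Q-P zero = sym (P-def 0)
      Q-P (suc j) = trans (cong₂ _*_ (trans (cong pos q≡) (sym (P-def t))) (Q-P j)) (sym (P-+ t (j ℕ.* t)))

  -- A field has two distinct elements, which rules out t = 0.
  p∣q : ∀ {q} (F : FiniteField q) p t → q ≡ p ^ t → pos p ∣ pos q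
  p∣q F p zero q≡ = ⊥-elim (ℕₚ.<-irrefl (sym q≡) (VectorSpace.q>1 F))
  p∣q F p (suc t) q≡ = ℕ∣⇒∣ (subst (p ℕ∣.∣_) (sym q≡) (ℕ∣.m∣m*n (p ^ t)))

open import Data.Nat using (ℕ; suc; _≤_; _∸_; _^_; _*_; _+_)
open import Data.Nat.Primality using (Prime)
open import Data.Product using (_×_)
open import Relation.Binary.PropositionalEquality using (_≡_)

theorem8p2 : {q : ℕ} (F : FiniteField q) (p t : ℕ) → Prime p → q ≡ p ^ t →
    (n r : ℕ) → 3 ≤ n → 1 ≤ r → r ≤ n ∸ 2 →
    (A : LinAlg.FlatIncidence F n r) →
    (W : LinAlg.SubspaceIncidence F n (suc r)) →
    (W' : LinAlg.SubspaceIncidence F (n ∸ 1) (suc r)) →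
    ((α : ℕ) → invMult p (LinAlg.FlatIncidence.M A) α + invMult p (LinAlg.SubspaceIncidence.M W') α
    ≡ invMult p (LinAlg.SubspaceIncidence.M W) α)
    × (sumUpTo (r * t) (invMult p (LinAlg.FlatIncidence.M A)) ≡ LinAlg.FlatIncidence.nCols A)
theorem8p2 F p t _ _ (suc zero) r (s≤s ())
theorem8p2 F p t p-prime q≡ (suc (suc n)) r 3≤n 1≤r r≤n A W W' =
  IncidenceMatrices.Enumerated.invariantFactors F p p-prime (IncidenceMatrices.p∣q F p t q≡) t q≡ (s≤s (s≤s r≤n)) A W W'
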